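{- Let $d$ be one of the square-free positive integers $5,6,10,13,15,22,35,37,51,58,91,115,123,187,235,267,403,427$ (these are exactly the $d$ for which $E=\mathbb{Q}(\sqrt{ -d})$ has class number $2$). Let $\mathfrak{U}_2=k\mathcal{O}+\beta\mathcal{O}$ be the integral ideal given in the table below, so that $\mathfrak{U}_2\overline{\mathfrak{U}_2}=k\mathcal{O}$. For a positive integer $r_1$ let $L_1^{r_1}=\mathcal{O}v_1^{r_1}$ be the unary Hermitian lattice with $h(v_1^{r_1})=r_1$, and for a positive integer $r_2$ let $L_2^{r_2}=\mathfrak{U}_2v_2^{r_2}$ be the unary Hermitian lattice with $h(v_2^{r_2})=r_2/k$. Then a positive definite integral unary Hermitian lattice over $\mathcal{O}$ belongs to $\mathfrak{S}_d(1)$ if and only if it is isometric to some $L_1^{r_1}$ with $r_1\geq 1$, or to some $L_2^{r_2}$ with $r_2$ in the set $R_d$ listed below; moreover $g_d(1)$ is as listed: \begin{itemize} \item $d=5$: $\mathfrak{U}_2=(2,1+\omega)$, $k=2$, $R_d=\{r\geq2\}$, $g_d(1)=3$. \item $d=6$: $\mathfrak{U}_2=(2,\omega)$, $k=2$, $R_d=\{r\geq2\}$, $g_d(1)=3$. \item $d=10$: $\mathfrak{U}_2=(2,\omega)$, $k=2$, $R_d=\{r\geq2,\ r\neq3\}$, $g_d(1)=4$. \item $d=13$: $\mathfrak{U}_2=(2,1+\omega)$, $k=2$, $R_d=\{r\geq2,\ r\neq3,5\}$, $g_d(1)=4$. \item $d=15$: $\mathfrak{U}_2=(2,1+\omega)$,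 $k=2$, $R_d=\{r\geq2\}$, $g_d(1)=3$. \item $d=22$: $\mathfrak{U}_2=(2,\omega)$, $k=2$, $R_d=\{r\geq2,\ r\neq3,5,7,9\}$, $g_d(1)=4$. \item $d=35$: $\mathfrak{U}_2=(5,2+\omega)$, $k=5$, $R_d=\{r\geq3,\ r\neq4\}$, $g_d(1)=4$. \item $d=37$: $\mathfrak{U}_2=(2,1+\omega)$, $k=2$, $R_d=\{r\geq2,\ r\neq3,5,7,9,11,13,15,17\}$, $g_d(1)=4$. \item $d=51$: $\mathfrak{U}_2=(5,1+\omega)$, $k=5$, $R_d=\{r\geq3,\ r\neq4,7\}$, $g_d(1)=4$. \item $d=58$: $\mathfrak{U}_2=(2,\omega)$, $k=2$, $R_d=\{r\geq2,\ r\neq3,5,7,9,11,13,15,17,19,21,23,25,27\}$, $g_d(1)=4$. \item $d=91$: $\mathfrak{U}_2=(7,3+\omega)$, $k=7$, $R_d=\{r\geq5,\ r\neq6,8,9,11,16\}$, $g_d(1)=4$. \item $d=115$: $\mathfrak{U}_2=(5,-3+\omega)$, $k=5$, $R_d=\{r\geq5,\ r\neq6,8,9,11,13,16,18\}$, $g_d(1)=4$. \item $d=123$: $\mathfrak{U}_2=(3,1+\omega)$, $k=3$, $R_d=\{r\geq3,\ r\neq4,5,7,8,10,13,16,19\}$, $g_d(1)=4$. \item $d=187$: $\mathfrak{U}_2=(7,-2+\omega)$, $k=7$, $R_d=\{r\geq7,\ r\neq8,9,10,12,13,15,16,19,20,23,26,27,30,37\}$, $g_d(1)=4$. \item $d=235$: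 $\mathfrak{U}_2=(5,2+\omega)$, $k=5$, $R_d=\{r\geq5,\ r\neq6,7,8,9,11,12,14,16,17,19,21,22,24,27,29,32,34,37,42\}$, $g_d(1)=4$. \item $d=267$: $\mathfrak{U}_2=(3,1+\omega)$, $k=3$, $R_d=\{r\geq3,\ r\neq4,5,7,8,10,11,13,14,16,17,19,20,22,25,28,31,34,37,40,43\}$, $g_d(1)=4$. \item $d=403$: $\mathfrak{U}_2=(11,6+\omega)$, $k=11$, $R_d=\{r\geq11,\ r\neq12,14,15,16,17,18,19,20,21,23,25,27,28,29,30,32,34,36,38,40,41,43,45,47,49,51,54,56,58,60,67,69,71,80,82\}$, $g_d(1)=4$. \item $d=427$: $\mathfrak{U}_2=(7,3+\omega)$, $k=7$, $R_d=\{r\geq7,\ r\neq8,9,10,11,12,13,15,16,18,19,20,22,23,25,26,27,29,30,32,33,36,37,39,40,43,44,46,47,50,53,54,57,60,64,67,71,74,81,88\}$, $g_d(1)=4$. \end{itemize}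
   Context: $E=\mathbb{Q}(\sqrt{ -d})$ with $d$ a square-free positive integer, $\mathcal{O}=\mathbb{Z}+\mathbb{Z}\omega$ its ring of integers, where $\omega=\sqrt{ -d}$ if $d\equiv1,2\pmod 4$ and $\omega=(1+\sqrt{ -d})/2$ if $d\equiv3\pmod 4$; $(a,b)$ denotes the ideal $a\mathcal{O}+b\mathcal{O}$. A Hermitian space is an $E$-vector space $V$ with a form $h:V\times V\to E$, $E$-linear in the first variable and with $h(v,w)=\overline{h(w,v)}$; write $h(v)=h(v,v)\in\mathbb{Q}$. A Hermitian lattice is a finitely generated $\mathcal{O}$-submodule of such a space; it is positive definite integral if $h(v)\in\mathbb{Z}_{>0}$ for all nonzero $v$ in it and $h(v,w)\in\mathcal{O}$ for all $v,w$ in it. A unary lattice $\mathfrak{U}v$ ($\mathfrak{U}$ a fractional ideal) lies in the one-dimensional space $Ev$. A lattice $L$ is represented by $K$ if there is an injective $\mathcal{O}$-linear map $L\to K$ preserving $h$; isometric means such a map is bijective. For $m\geq1$, $I_m$ is the free Hermitian lattice of rank $m$ with an orthonormal basis (corresponding to the form $x_1\overline{x_1}+\cdots+x_m\overline{x_m}$). $\mathfrak{S}_d(1)$ is the set of positive definite integral unary Hermitian lattices over $\mathcal{O}$ which are represented by $I_m$ for some $m\geq1$, and $g_d(1)$ is the smallest positive integer $g$ such that every lattice in $\mathfrak{S}_d(1)$ is represented by $I_g$. -}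

module Defs where

open import Data.Bool using (Bool; true; false; if_then_else_)
open import Data.Nat using (ℕ; zero; suc; _≤_; _%_; _≡ᵇ_; NonZero)
open import Data.Integer using (ℤ; +_; -[1+_])
open import Data.Rational using (ℚ; _/_; 0ℚ; 1ℚ; _+_; _*_; -_)
open import Data.Product using (_×_; _,_; Σ; ∃-syntax; proj₂)
open import Data.Sum using (_⊎_)
open import Data.Vec using (Vec; []; _∷_; zipWith; foldr; map)
open import Data.Vec.Relation.Unary.All using (All)
open import Data.Vec.Relation.Unary.Any using (Any; here; there)
open import Data.List using (List; []; _∷_)
open import Data.List.Membership.Propositional using (_∉_)
open import Function.Bundles using (_⇔_)
open import Relation.Binary.PropositionalEquality using (_≡_; _≢_; cong)

-- The imaginary quadratic field E = Q(√-d), modelled in the Q-basis {1, ω}.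
-- ω = √-d if d ≢ 3 (mod 4), ω = (1+√-d)/2 if d ≡ 3 (mod 4).
-- In both cases ω² = t·ω − n with (t , n) = (0 , d) resp. (1 , (1+d)/4),
-- and the conjugate is ω̄ = t − ω.

module Field (d : ℕ) where

  three : Bool
  three = (d % 4) ≡ᵇ 3

  t : ℚ
  t = if three then 1ℚ else 0ℚ

  n : ℚ
  n = if three then (+ suc d) / 4 else (+ d) / 1

  -- (a , b) represents a + b ω
  E : Set
  E = ℚ × ℚ

  0E : E
  0E = 0ℚ , 0ℚ

  1E : E
  1E = 1ℚ , 0ℚ

  el : ℤ → ℤ → E
  el a b = a / 1 , b / 1

  infixl 6 _⊕_
  infixl 7 _⊗_

  _⊕_ : E → E → E
  (a , b) ⊕ (c , e) = a + c , b + e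

  _⊗_ : E → E → E
  (a , b) ⊗ (c , e) = (a * c + - (n * (b * e))) , (a * e + b * c + t * (b * e))

  conj : E → E
  conj (a , b) = a + t * b , - b

  isℤ : ℚ → Set
  isℤ q = ∃[ z ] q ≡ z / 1

  inO : E → Set
  inO (a , b) = isℤ a × isℤ b

  -- Unary Hermitian lattices.  The one-dimensional Hermitian space Ev
  -- with h(v,v) = q ∈ ℚ is modelled as E with h(x,y) = q · x · ȳ
  -- (x stands for x·v).  A unary lattice is the (nonzero) finitely
  -- generated O-submodule of Ev spanned by the listed generators.

  record UnaryLattice : Set where
    field
      q       : ℚ
      len     : ℕ
      gens    : Vec E len
      nonzero : Any (λ x → x ≢ 0E) gens

  open UnaryLattice public

  lincomb : ∀ {k} → Vec E k → Vec E k → E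
  lincomb cs gs = foldr _ _⊕_ 0E (zipWith _⊗_ cs gs)

  _∈L_ : E → UnaryLattice → Set
  x ∈L L = ∃[ cs ] (All inO cs × x ≡ lincomb cs (gens L))

  h : UnaryLattice → E → E → E
  h L x y = (q L , 0ℚ) ⊗ (x ⊗ conj y)

  PosDefIntegral : UnaryLattice → Set
  PosDefIntegral L =
    (∀ x → x ∈L L → x ≢ 0E → ∃[ m ] h L x x ≡ ((+ suc m) / 1 , 0ℚ))
    × (∀ x y → x ∈L L → y ∈L L → inO (h L x y))

  -- The lattice I_m = O^m ⊂ E^m with form Σ xᵢ ȳᵢ

  hI : ∀ {m} → Vec E m → Vec E m → E
  hI xs ys = foldr _ _⊕_ 0E (zipWith (λ a b → a ⊗ conj b) xs ys)

  record Represents (L : UnaryLattice) (m : ℕ) : Set where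
    field
      f         : (x : E) → x ∈L L → Vec E m
      into      : ∀ x p → All inO (f x p)
      additive  : ∀ x y p p' p'' → f (x ⊕ y) p'' ≡ zipWith _⊕_ (f x p) (f y p')
      homog     : ∀ c x → inO c → ∀ p p' → f (c ⊗ x) p' ≡ map (c ⊗_) (f x p)
      injective : ∀ x y p p' → f x p ≡ f y p' → x ≡ y
      isometric : ∀ x y p p' → hI (f x p) (f y p') ≡ h L x y

  record Isometric (L K : UnaryLattice) : Set where
    field
      f          : (x : E) → x ∈L L → E
      into       : ∀ x p → f x p ∈L K
      additive   : ∀ x y p p' p'' → f (x ⊕ y) p'' ≡ f x p ⊕ f y p'
      homog      : ∀ c x → inO c → ∀ p p' → f (c ⊗ x) p' ≡ c ⊗ f x p
      injective  : ∀ x y p p' → f x p ≡ f y p' → x ≡ y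
      surjective : ∀ y → y ∈L K → ∃[ x ] Σ (x ∈L L) (λ p → f x p ≡ y)
      isometric  : ∀ x y p p' → h K (f x p) (f y p') ≡ h L x y

  InS : UnaryLattice → Set
  InS L = PosDefIntegral L × ∃[ m ] (1 ≤ m × Represents L m)

  IsG : ℕ → Set
  IsG g = 1 ≤ g
        × (∀ L → InS L → Represents L g)
        × (∀ g' → 1 ≤ g' → (∀ L → InS L → Represents L g') → g ≤ g')

  L1 : ℕ → UnaryLattice
  L1 r = record { q = (+ r) / 1 ; len = 1 ; gens = 1E ∷ [] ; nonzero = here (λ ()) }

data Case : Set where
  c5 c6 c10 c13 c15 c22 c35 c37 c51 c58 c91 c115 c123 c187 c235 c267 c403 c427 : Case

dOf : Case → ℕ
dOf c5 = 5
dOf c6 = 6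
dOf c10 = 10
dOf c13 = 13
dOf c15 = 15
dOf c22 = 22
dOf c35 = 35
dOf c37 = 37
dOf c51 = 51
dOf c58 = 58
dOf c91 = 91
dOf c115 = 115
dOf c123 = 123
dOf c187 = 187
dOf c235 = 235
dOf c267 = 267
dOf c403 = 403
dOf c427 = 427

-- k − 1  (so that k = suc (kpred c) is visibly nonzero)
kpred : Case → ℕ
kpred c5 = 1
kpred c6 = 1
kpred c10 = 1
kpred c13 = 1
kpred c15 = 1
kpred c22 = 1
kpred c35 = 4
kpred c37 = 1
kpred c51 = 4
kpred c58 = 1
kpred c91 = 6
kpred c115 = 4
kpred c123 = 2
kpred c187 = 6
kpred c235 = 4
kpred c267 = 2
kpred c403 = 10
kpred c427 = 6

kOf : Case → ℕ
kOf c = suc (kpred c)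

βa : Case → ℤ
βa c5 = + 1
βa c6 = + 0
βa c10 = + 0
βa c13 = + 1
βa c15 = + 1
βa c22 = + 0
βa c35 = + 2
βa c37 = + 1
βa c51 = + 1
βa c58 = + 0
βa c91 = + 3
βa c115 = -[1+ 2 ]
βa c123 = + 1
βa c187 = -[1+ 1 ]
βa c235 = + 2
βa c267 = + 1
βa c403 = + 6
βa c427 = + 3

βb : Case → ℤ
βb _ = + 1

lowerOf : Case → ℕ
lowerOf c5 = 2
lowerOf c6 = 2
lowerOf c10 = 2
lowerOf c13 = 2
lowerOf c15 = 2
lowerOf c22 = 2
lowerOf c35 = 3
lowerOf c37 = 2
lowerOf c51 = 3
lowerOf c58 = 2
lowerOf c91 = 5
lowerOf c115 = 5
lowerOf c123 = 3
lowerOf c187 = 7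
lowerOf c235 = 5
lowerOf c267 = 3
lowerOf c403 = 11
lowerOf c427 = 7

exclOf : Case → List ℕ
exclOf c5 = []
exclOf c6 = []
exclOf c10 = 3 ∷ []
exclOf c13 = 3 ∷ 5 ∷ []
exclOf c15 = []
exclOf c22 = 3 ∷ 5 ∷ 7 ∷ 9 ∷ []
exclOf c35 = 4 ∷ []
exclOf c37 = 3 ∷ 5 ∷ 7 ∷ 9 ∷ 11 ∷ 13 ∷ 15 ∷ 17 ∷ []
exclOf c51 = 4 ∷ 7 ∷ []
exclOf c58 = 3 ∷ 5 ∷ 7 ∷ 9 ∷ 11 ∷ 13 ∷ 15 ∷ 17 ∷ 19 ∷ 21 ∷ 23 ∷ 25 ∷ 27 ∷ []
exclOf c91 = 6 ∷ 8 ∷ 9 ∷ 11 ∷ 16 ∷ []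
exclOf c115 = 6 ∷ 8 ∷ 9 ∷ 11 ∷ 13 ∷ 16 ∷ 18 ∷ []
exclOf c123 = 4 ∷ 5 ∷ 7 ∷ 8 ∷ 10 ∷ 13 ∷ 16 ∷ 19 ∷ []
exclOf c187 = 8 ∷ 9 ∷ 10 ∷ 12 ∷ 13 ∷ 15 ∷ 16 ∷ 19 ∷ 20 ∷ 23 ∷ 26 ∷ 27 ∷ 30 ∷ 37 ∷ []
exclOf c235 = 6 ∷ 7 ∷ 8 ∷ 9 ∷ 11 ∷ 12 ∷ 14 ∷ 16 ∷ 17 ∷ 19 ∷ 21 ∷ 22 ∷ 24 ∷ 27 ∷ 29 ∷ 32 ∷ 34 ∷ 37 ∷ 42 ∷ []
exclOf c267 = 4 ∷ 5 ∷ 7 ∷ 8 ∷ 10 ∷ 11 ∷ 13 ∷ 14 ∷ 16 ∷ 17 ∷ 19 ∷ 20 ∷ 22 ∷ 25 ∷ 28 ∷ 31 ∷ 34 ∷ 37 ∷ 40 ∷ 43 ∷ []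
exclOf c403 = 12 ∷ 14 ∷ 15 ∷ 16 ∷ 17 ∷ 18 ∷ 19 ∷ 20 ∷ 21 ∷ 23 ∷ 25 ∷ 27 ∷ 28 ∷ 29 ∷ 30 ∷ 32 ∷ 34 ∷ 36 ∷ 38 ∷ 40 ∷ 41 ∷ 43 ∷ 45 ∷ 47 ∷ 49 ∷ 51 ∷ 54 ∷ 56 ∷ 58 ∷ 60 ∷ 67 ∷ 69 ∷ 71 ∷ 80 ∷ 82 ∷ []
exclOf c427 = 8 ∷ 9 ∷ 10 ∷ 11 ∷ 12 ∷ 13 ∷ 15 ∷ 16 ∷ 18 ∷ 19 ∷ 20 ∷ 22 ∷ 23 ∷ 25 ∷ 26 ∷ 27 ∷ 29 ∷ 30 ∷ 32 ∷ 33 ∷ 36 ∷ 37 ∷ 39 ∷ 40 ∷ 43 ∷ 44 ∷ 46 ∷ 47 ∷ 50 ∷ 53 ∷ 54 ∷ 57 ∷ 60 ∷ 64 ∷ 67 ∷ 71 ∷ 74 ∷ 81 ∷ 88 ∷ []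

InR : Case → ℕ → Set
InR c r = lowerOf c ≤ r × r ∉ exclOf c

gOf : Case → ℕ
gOf c5 = 3
gOf c6 = 3
gOf c10 = 4
gOf c13 = 4
gOf c15 = 3
gOf c22 = 4
gOf c35 = 4
gOf c37 = 4
gOf c51 = 4
gOf c58 = 4
gOf c91 = 4
gOf c115 = 4
gOf c123 = 4
gOf c187 = 4
gOf c235 = 4
gOf c267 = 4
gOf c403 = 4
gOf c427 = 4

one≢zero : (+ 1) / 1 ≢ 0ℚ
one≢zero ()

module _ (c : Case) where
  open Field (dOf c)

  L2of : ℕ → UnaryLattice
  L2of r = record { q = (+ r) / kOf c ; len = 2
                  ; gens = el (+ kOf c) (+ 0) ∷ el (βa c) (βb c) ∷ []
                  ; nonzero = there (here (λ e → one≢zero (cong proj₂ e))) }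

  Claim : Set
  Claim =
    (∀ (L : UnaryLattice) → PosDefIntegral L →
       (InS L ⇔ ((∃[ r ] (1 ≤ r × Isometric L (L1 r)))
                 ⊎ (∃[ r ] (InR c r × Isometric L (L2of r))))))
    × IsG (gOf c)

{-# OPTIONS --safe #-}
module Submission where

-- A unary lattice is γ 𝔄 for an ideal 𝔄, and Gauss reduction of the ideal ℤ A + ℤ (B + ω) leaves only
-- the two classes O and 𝔘₂, so every lattice is some L₁ʳ or L₂ʳ. A representation of L₂ʳ by I_m is a
-- vector w ∈ k⁻¹ (𝔘̄₂)ᵐ of norm r / k, that is, a way of writing r as a sum of m values of the binary
-- form q(x , y) = N(k x + y β̄) / k. Up to equivalence q is A x² + C y² or A x² + A x y + C y²;
-- completing the square, r is a sum of m values of the latter iff 4 r = A S + (4 C - A) T for sums S,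
-- T of m squares of pairwise equal parity. By Lagrange's theorem with parities prescribed modulo 4,
-- four values of q yield exactly the numerical semigroup generated by A, C and 4 C - A (by A and C in
-- the diagonal case), which is R_d ∪ {0}; likewise r is a sum of four norms because it is a sum of
-- four squares. Three values suffice for d = 5, 6, 15: a quaternary form of class number one (four
-- squares, or two norms of Eisenstein integers) embeds, on suitable residue classes, into two copies
-- of the form in question, and the third copy is used to move r out of the bad residue classes.
-- Finally 7 (resp. 3) is not a sum of three (resp. two) norms.

-- A linear map out of a rank one lattice is multiplication by one vector w, and 𝔘₂ w lies in O^m
-- exactly if the coordinates of w lie in 𝔘₂⁻¹ = k⁻¹ 𝔘̄₂; this is where the conjugate comes from.
-- The third generator 4 C - A is the value of A x² + A x y + C y² at (1 , -2). The obstacle for d =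
-- 5, 6, 15 is that completing squares in three copies would call for sums of three squares with
-- prescribed parities, and three squares miss infinitely many numbers. A quaternary form is
-- therefore brought into only two copies: a congruence modulo 5 or 4 allows a pair of squares to be
-- rewritten as 5 or 2 times another pair, which is division by 2 + i or 1 + i in the Gaussian
-- integers. These congruences, the closure of R_d under the generators and the list of reduced
-- ideals are finite matters and are settled by evaluation.

open import Data.Nat as ℕ using (ℕ; zero; suc; z≤n; s≤s)
import Data.Nat.Properties as ℕ
open import Data.Product using (_×_; _,_; ∃; ∃₂; proj₁; proj₂)
open import Data.Sum using (_⊎_; inj₁; inj₂; [_,_]′)
open import Relation.Nullary using (¬_; Dec; yes; no; contradiction)
open import Relation.Binary.PropositionalEquality
open import Defs

-- Integer inequalities and rounding to a nearest multiple

module Integers where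
  open import Data.Integer
  open import Data.Integer.Properties
  open import Data.Integer.DivMod using (_/ℕ_; _%ℕ_; n%ℕd<d; a≡a%ℕn+[a/ℕn]*n)
  open import Data.Integer.Tactic.RingSolver using (solve-∀)

  0≤+ : ∀ n → 0ℤ ≤ + n
  0≤+ n = +≤+ z≤n

  0≤m+n : ∀ {i j} → 0ℤ ≤ i → 0ℤ ≤ j → 0ℤ ≤ i + j
  0≤m+n p q = +-mono-≤ p q

  0≤m*n : ∀ {i j} → 0ℤ ≤ i → 0ℤ ≤ j → 0ℤ ≤ i * j
  0≤m*n {+ m} {+ n} _ _ = subst (0ℤ ≤_) (pos-* m n) (0≤+ _)

  0≤n² : ∀ i → 0ℤ ≤ i * i
  0≤n² (+ n) = 0≤m*n (0≤+ n) (0≤+ n)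
  0≤n² (-[1+ n ]) = 0≤+ _

  0≤⇒+ : ∀ {i} → 0ℤ ≤ i → ∃ λ n → i ≡ + n
  0≤⇒+ {+ n} _ = n , refl

  -- Dividing 2 a + o + m - 1 by 2 m shifts the remainder so that 2 r + o falls between - m
  -- (excluded) and m (included). A nonzero offset `o` is for quadratic forms with a mixed term: 2 B
  -- + t in Gauss reduction, 2 e + f for an Eisenstein integer.
  round : ∀ m .{{_ : ℕ.NonZero m}} o a → ∃₂ λ r κ →
    a ≡ r + + m * κ × 0ℤ ≤ + m - (+ 2 * r + o) × 0ℤ ≤ + m + (+ 2 * r + o) - 1ℤ
  round m@(suc m-1) o a = a - + m * κ , κ , e₀ a (+ m) κ , lo , hi
    where
    y = + 2 * a + o + + m - 1ℤ
    κ = y /ℕ (2 ℕ.* m)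
    ρ = y %ℕ (2 ℕ.* m)
    eq : y ≡ + ρ + κ * (+ 2 * + m)
    eq = trans (a≡a%ℕn+[a/ℕn]*n y (2 ℕ.* m)) (cong (λ z → + ρ + κ * z) (pos-* 2 m))
    e₀ : ∀ a m κ → a ≡ a - m * κ + m * κ
    e₀ = solve-∀
    e₁ : ∀ a o m κ → m + (+ 2 * (a - m * κ) + o) - 1ℤ ≡ (+ 2 * a + o + m - 1ℤ) - κ * (+ 2 * m)
    e₁ = solve-∀
    e₂ : ∀ r s → r + s - s ≡ r
    e₂ = solve-∀
    is-ρ : + m + (+ 2 * (a - + m * κ) + o) - 1ℤ ≡ + ρ
    is-ρ = trans (e₁ a o (+ m) κ) (trans (cong (_- κ * (+ 2 * + m)) eq) (e₂ (+ ρ) (κ * (+ 2 * + m))))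
    hi : 0ℤ ≤ + m + (+ 2 * (a - + m * κ) + o) - 1ℤ
    hi = subst (0ℤ ≤_) (sym is-ρ) (0≤+ ρ)
    e₃ : ∀ m x → m - x ≡ + 2 * m - (1ℤ + (m + x - 1ℤ))
    e₃ = solve-∀
    lo : 0ℤ ≤ + m - (+ 2 * (a - + m * κ) + o)
    lo = subst (0ℤ ≤_)
      (sym (trans (e₃ (+ m) (+ 2 * (a - + m * κ) + o))
        (cong₂ (λ u v → u - (1ℤ + v)) (sym (pos-* 2 m)) is-ρ)))
      (i≤j⇒0≤j-i (+≤+ (n%ℕd<d y (2 ℕ.* m))))

  square-bound : ∀ m x → 0ℤ ≤ m - x → 0ℤ ≤ m + x → 0ℤ ≤ m * m - x * x
  square-bound m x p q = subst (0ℤ ≤_) (e m x) (0≤m*n p q)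
    where
    e : ∀ m x → (m - x) * (m + x) ≡ m * m - x * x
    e = solve-∀

  n²≡0⇒n≡0 : ∀ i → i * i ≡ 0ℤ → i ≡ 0ℤ
  n²≡0⇒n≡0 i e with i*j≡0⇒i≡0∨j≡0 i e
  ... | inj₁ p = p
  ... | inj₂ p = p

  0≤+0≤≡0 : ∀ {i j} → 0ℤ ≤ i → 0ℤ ≤ j → i + j ≡ 0ℤ → i ≡ 0ℤ × j ≡ 0ℤ
  0≤+0≤≡0 {+ zero} {+ n} _ _ e = refl , e

  -- An integer above - 1 is at least 0. The slack k - 1 is left over when a bound has been
  -- multiplied by k to clear the denominators of completed squares.
  0≤-div : ∀ k z → 0ℤ ≤ + k * z + (+ k - 1ℤ) → 0ℤ ≤ z
  0≤-div k (+ n) _ = 0≤+ n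
  0≤-div k z@(-[1+ n ]) p with subst (0ℤ ≤_) (e (+ k) (+ n)) (0≤m+n p (0≤m*n (0≤+ k) (0≤+ n)))
    where
    e : ∀ k n → k * - (1ℤ + n) + (k - 1ℤ) + k * n ≡ -1ℤ
    e = solve-∀
  ... | ()

-- Solutions of s² + c r² + 1 ≡ 0 modulo an odd prime

module Isotropy where
  open import Data.Nat
  open import Data.Nat.Properties
  open import Data.Nat.Divisibility
  open import Data.Nat.DivMod
  open import Data.Nat.Primality using (Prime; euclidsLemma)
  open import Data.Nat.Tactic.RingSolver using (solve-∀)
  open import Data.Fin as Fin using (Fin; toℕ; fromℕ<; splitAt)
  import Data.Fin.Properties as Fin
  open import Relation.Binary.Definitions using (tri<; tri≈; tri>)

  %≡⇒∣∸ : ∀ {m n} p .{{_ : NonZero p}} → m ≤ n → m % p ≡ n % p → p ∣ n ∸ m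
  %≡⇒∣∸ {m} {n} p m≤n eq = m%n≡0⇒n∣m (n ∸ m) p (begin
    (n ∸ m) % p                             ≡⟨ cong (λ z → (z ∸ m) % p) (m≡m%n+[m/n]*n n p) ⟩
    (n % p + n / p * p ∸ m) % p             ≡⟨ cong (λ z → (n % p + n / p * p ∸ z) % p) (m≡m%n+[m/n]*n m p) ⟩
    (n % p + n / p * p ∸ (m % p + m / p * p)) % p ≡⟨ cong (λ z → (n % p + n / p * p ∸ (z + m / p * p)) % p) eq ⟩
    (n % p + n / p * p ∸ (n % p + m / p * p)) % p ≡⟨ cong (_% p) ([m+n]∸[m+o]≡n∸o (n % p) (n / p * p) (m / p * p)) ⟩
    (n / p * p ∸ m / p * p) % p             ≡⟨ cong (_% p) (sym (*-distribʳ-∸ p (n / p) (m / p))) ⟩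
    ((n / p ∸ m / p) * p) % p               ≡⟨ m*n%n≡0 (n / p ∸ m / p) p ⟩
    0 ∎)
    where
    open ≡-Reasoning

  module _ {h : ℕ} (pr : Prime (1 + 2 * h)) (c : ℕ) (p∤c : ¬ (1 + 2 * h) ∣ c) where
    private
      p = 1 + 2 * h

      sum<p : ∀ {i j} → i ≤ h → j < i → i + j < p
      sum<p {i} {j} i≤h j<i = s≤s (subst (i + j ≤_) (cong (h +_) (sym (+-identityʳ h))) (+-mono-≤ i≤h (<⇒≤ (<-≤-trans j<i i≤h))))

      -- The difference splits as (i - j) (i + j), and both factors lie strictly between 0 and p.
      distinct : ∀ {i j} → i ≤ h → j < i → ¬ p ∣ i * i ∸ j * j
      distinct {i} {j} i≤h j<i d = [ (λ e → contradiction (∣⇒≤ {{>-nonZero (m<n⇒0<n∸m j<i)}} e) (<⇒≱ (≤-<-trans (m∸n≤m i j) (≤-<-trans (m≤m+n i j) (sum<p i≤h j<i)))))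
                                   , (λ e → contradiction (∣⇒≤ {{>-nonZero (<-≤-trans (≤-<-trans z≤n j<i) (m≤m+n i j))}} e) (<⇒≱ (sum<p i≤h j<i))) ]′
          (euclidsLemma (i ∸ j) (i + j) pr (subst (p ∣_) factor d))
        where
        factor : i * i ∸ j * j ≡ (i ∸ j) * (i + j)
        factor with k , refl ← m≤n⇒∃[o]m+o≡n (<⇒≤ j<i) = begin
          (j + k) * (j + k) ∸ j * j  ≡⟨ cong (_∸ j * j) (e j k) ⟩
          j * j + k * (j + k + j) ∸ j * j ≡⟨ m+n∸m≡n (j * j) _ ⟩
          k * (j + k + j) ≡⟨ cong (_* (j + k + j)) (sym (m+n∸m≡n j k)) ⟩
          (j + k ∸ j) * (j + k + j) ∎
          where
          open ≡-Reasoning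
          e : ∀ j k → (j + k) * (j + k) ≡ j * j + k * (j + k + j)
          e = solve-∀

      u v : ℕ → ℕ
      u i = i * i
      -- 2 h = p - 1 plays the part of - 1 modulo p, which keeps - (c j² + 1) a natural number.
      v j = (c * (j * j) + 1) * (2 * h)

      value : Fin (suc h) ⊎ Fin (suc h) → ℕ
      value (inj₁ i) = u (toℕ i)
      value (inj₂ j) = v (toℕ j)

      slot : Fin (suc h + suc h) → Fin p
      slot i = fromℕ< (m%n<n (value (splitAt (suc h) i)) p)

      bound : (i : Fin (suc h)) → toℕ i ≤ h
      bound i = ≤-pred (Fin.toℕ<n i)

      no-u : ∀ {i j} → i ≤ h → j < i → ¬ u j % p ≡ u i % p
      no-u i≤h j<i eq = distinct i≤h j<i (%≡⇒∣∸ p (*-mono-≤ (<⇒≤ j<i) (<⇒≤ j<i)) eq)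

      p∤2h : h ≢ 0 → ¬ p ∣ 2 * h
      p∤2h h≢0 d = contradiction (∣⇒≤ {{≢-nonZero (λ e → h≢0 ([ (λ ()) , (λ z → z) ]′ (m*n≡0⇒m≡0∨n≡0 2 e)))}} d) (<⇒≱ (n<1+n (2 * h)))

      no-v : ∀ {i j} → i ≤ h → j < i → ¬ v j % p ≡ v i % p
      no-v {i} {j} i≤h j<i eq = [ (λ e → [ p∤c , distinct i≤h j<i ]′ (euclidsLemma c _ pr e))
                                , p∤2h (λ { refl → contradiction i≤h (<⇒≱ (≤-<-trans z≤n j<i)) }) ]′
          (euclidsLemma (c * (i * i ∸ j * j)) (2 * h) pr (subst (p ∣_) e₁ (%≡⇒∣∸ p
            (*-monoˡ-≤ (2 * h) (+-monoˡ-≤ 1 (*-monoʳ-≤ c (*-mono-≤ (<⇒≤ j<i) (<⇒≤ j<i))))) eq)))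
        where
        e₁ : v i ∸ v j ≡ c * (i * i ∸ j * j) * (2 * h)
        e₁ = begin
          v i ∸ v j ≡⟨ sym (*-distribʳ-∸ (2 * h) (c * (i * i) + 1) (c * (j * j) + 1)) ⟩
          (c * (i * i) + 1 ∸ (c * (j * j) + 1)) * (2 * h) ≡⟨ cong (_* (2 * h)) (cong₂ _∸_ (+-comm (c * (i * i)) 1) (+-comm (c * (j * j)) 1)) ⟩
          (c * (i * i) ∸ c * (j * j)) * (2 * h) ≡⟨ cong (_* (2 * h)) (sym (*-distribˡ-∸ c (i * i) (j * j))) ⟩
          c * (i * i ∸ j * j) * (2 * h) ∎
          where
          open ≡-Reasoning

      both : ∀ i j → u i % p ≡ v j % p → p ∣ i * i + c * (j * j) + 1
      both i j eq = m%n≡0⇒n∣m _ p (begin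
        (i * i + c * (j * j) + 1) % p ≡⟨ cong (_% p) (+-assoc (i * i) (c * (j * j)) 1) ⟩
        (u i + w) % p ≡⟨ %-distribˡ-+ (u i) w p ⟩
        (u i % p + w % p) % p ≡⟨ cong (λ z → (z + w % p) % p) eq ⟩
        (v j % p + w % p) % p ≡⟨ %-distribˡ-+ (v j) w p ⟨
        (v j + w) % p ≡⟨ cong (_% p) (e w h) ⟩
        (w * p) % p ≡⟨ m*n%n≡0 w p ⟩
        0 ∎)
        where
        open ≡-Reasoning
        w = c * (j * j) + 1
        e : ∀ w h → w * (2 * h) + w ≡ w * (1 + 2 * h)
        e = solve-∀

      values-agree : ∀ x y → slot x ≡ slot y → value (splitAt (suc h) x) % p ≡ value (splitAt (suc h) y) % p
      values-agree x y eq = trans (sym (Fin.toℕ-fromℕ< _)) (trans (cong toℕ eq) (Fin.toℕ-fromℕ< _))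

      split-distinct : ∀ x y → x Fin.< y → splitAt (suc h) x ≢ splitAt (suc h) y
      split-distinct x y x<y e = Fin.<⇒≢ x<y
        (trans (sym (Fin.join-splitAt (suc h) (suc h) x))
          (trans (cong (Fin.join (suc h) (suc h)) e) (Fin.join-splitAt (suc h) (suc h) y)))

      resolve : ∀ x y → x ≢ y → value x % p ≡ value y % p → ∃₂ λ s r → s ≤ h × r ≤ h × p ∣ s * s + c * (r * r) + 1
      resolve (inj₁ i) (inj₁ j) i≢j eq with <-cmp (toℕ i) (toℕ j)
      ... | tri< i<j _ _ = contradiction eq (no-u (bound j) i<j)
      ... | tri≈ _ e _ = contradiction (cong inj₁ (Fin.toℕ-injective e)) i≢j
      ... | tri> _ _ j<i = contradiction (sym eq) (no-u (bound i) j<i)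
      resolve (inj₂ i) (inj₂ j) i≢j eq with <-cmp (toℕ i) (toℕ j)
      ... | tri< i<j _ _ = contradiction eq (no-v (bound j) i<j)
      ... | tri≈ _ e _ = contradiction (cong inj₂ (Fin.toℕ-injective e)) i≢j
      ... | tri> _ _ j<i = contradiction (sym eq) (no-v (bound i) j<i)
      resolve (inj₁ i) (inj₂ j) _ eq = toℕ i , toℕ j , bound i , bound j , both (toℕ i) (toℕ j) eq
      resolve (inj₂ j) (inj₁ i) _ eq = toℕ i , toℕ j , bound i , bound j , both (toℕ i) (toℕ j) (sym eq)

    -- There are h + 1 squares and h + 1 values - (c j² + 1), together p + 1 items for p residues.
    -- Two items of one kind never agree, so the coincidence pairs a square with a negated value.
    -- The bound h on both numbers will make the multiple of p smaller than p².
    isotropic : ∃₂ λ s r → s ≤ h × r ≤ h × p ∣ s * s + c * (r * r) + 1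
    isotropic with Fin.pigeonhole more slot
      where
      more : p < suc h + suc h
      more = ≤-reflexive (e h)
        where
        e : ∀ h → suc (1 + 2 * h) ≡ suc h + suc h
        e = solve-∀
    ... | x , y , x<y , eq = resolve _ _ (split-distinct x y x<y) (values-agree x y eq)

-- Infinite descent for sums of two binary norms

module QuaternaryNorms where
  import Data.Nat.Divisibility as ℕ
  open import Data.Nat.Induction using (<-rec)
  open import Data.Nat.Primality using (Prime; prime⇒nonZero)
  open import Data.Integer hiding (suc; pred)
  open import Data.Integer.Properties
  open import Data.Integer.Tactic.RingSolver using (solve-∀)
  open Isotropy using (isotropic)
  open import Data.Nat.Primality.Factorisation using (factorise; PrimeFactorisation)
  open import Data.Nat.Primality using (prime⇒irreducible; prime⇒nonTrivial)
  open import Data.List using ([]; _∷_)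
  open import Data.Nat.ListAction using (product)
  open import Data.List.Relation.Unary.All using (All; []; _∷_)
  open Integers

  N : ℤ → ℤ → ℤ → ℤ
  N T x y = x * x + T * x * y + y * y

  F : ℤ → ℤ → ℤ → ℤ → ℤ → ℤ
  F T a b c d = N T a b + N T c d

  record Rep (T n : ℤ) : Set where
    constructor rep
    field
      a b c d : ℤ
      eq : F T a b c d ≡ n

  -- For T = 0 and T = 1 this is the norm of a quaternion order containing ℤ[i] resp. ℤ[ζ₃]
  -- over which it is a sum of two Hermitian squares; hence the composition law.
  F-mult : ∀ T a b c d e f g h →
    let N = λ x y → x * x + T * x * y + y * y in
    (N a b + N c d) * (N e f + N g h) ≡
    (N (a * e + T * a * f + b * f + (c * g + T * c * h + d * h)) (b * e - a * f + (d * g - c * h)) +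
     N (a * g - b * h - (c * e - d * f)) (a * h + b * g + T * b * h - (c * f + d * e + T * d * f)))
  F-mult = solve-∀

  rep-* : ∀ {T m n} → Rep T m → Rep T n → Rep T (m * n)
  rep-* {T} (rep a b c d refl) (rep e f g h refl) = rep
    (a * e + T * a * f + b * f + (c * g + T * c * h + d * h)) (b * e - a * f + (d * g - c * h))
    (a * g - b * h - (c * e - d * f)) (a * h + b * g + T * b * h - (c * f + d * e + T * d * f))
    (sym (F-mult T a b c d e f g h))

  F-scale : ∀ T m a b c d →
    let N = λ x y → x * x + T * x * y + y * y in
    N (m * a) (m * b) + N (m * c) (m * d) ≡ m * m * (N a b + N c d)
  F-scale = solve-∀

  -- Multiplying by the conjugate of a residue modulo m makes all coordinates divisible by m.
  descent-identity : ∀ T m m′ a b c d e f g h →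
    let N = λ x y → x * x + T * x * y + y * y in
    N e f + N g h ≡ m * m′ →
    (N (e + m * a) (f + m * b) + N (g + m * c) (h + m * d)) * (N e f + N g h) ≡
    m * m * (N (m′ + (a * e + T * a * f + b * f + (c * g + T * c * h + d * h)))
               (b * e - a * f + (d * g - c * h)) +
     N (a * g - b * h - (c * e - d * f)) (a * h + b * g + T * b * h - (c * f + d * e + T * d * f)))
  descent-identity T m m′ a b c d e f g h eq = begin
    _ ≡⟨ F-mult T (e + m * a) (f + m * b) (g + m * c) (h + m * d) e f g h ⟩
    F T x y z w ≡⟨ cong₂ (λ x y → F T x y z w) ex ey ⟩
    F T (m * (m′ + x′)) (m * y′) z w ≡⟨ cong₂ (F T (m * (m′ + x′)) (m * y′)) ez ew ⟩
    F T (m * (m′ + x′)) (m * y′) (m * z′) (m * w′) ≡⟨ F-scale T m (m′ + x′) y′ z′ w′ ⟩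
    _ ∎
    where
    open ≡-Reasoning
    x = (e + m * a) * e + T * (e + m * a) * f + (f + m * b) * f
      + ((g + m * c) * g + T * (g + m * c) * h + (h + m * d) * h)
    y = (f + m * b) * e - (e + m * a) * f + ((h + m * d) * g - (g + m * c) * h)
    z = (e + m * a) * g - (f + m * b) * h - ((g + m * c) * e - (h + m * d) * f)
    w = (e + m * a) * h + (f + m * b) * g + T * (f + m * b) * h
      - ((g + m * c) * f + (h + m * d) * e + T * (h + m * d) * f)
    x′ = a * e + T * a * f + b * f + (c * g + T * c * h + d * h)
    y′ = b * e - a * f + (d * g - c * h)
    z′ = a * g - b * h - (c * e - d * f)
    w′ = a * h + b * g + T * b * h - (c * f + d * e + T * d * f)
    lx : ∀ T m a b c d e f g h → (e + m * a) * e + T * (e + m * a) * f + (f + m * b) * f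
      + ((g + m * c) * g + T * (g + m * c) * h + (h + m * d) * h)
      ≡ ((e * e + T * e * f + f * f) + (g * g + T * g * h + h * h))
       + m * (a * e + T * a * f + b * f + (c * g + T * c * h + d * h))
    lx = solve-∀
    ex : x ≡ m * (m′ + x′)
    ex = trans (lx T m a b c d e f g h) (trans (cong (_+ m * x′) eq) (sym (*-distribˡ-+ m m′ x′)))
    ly : ∀ m a b c d e f g h → (f + m * b) * e - (e + m * a) * f + ((h + m * d) * g - (g + m * c) * h)
      ≡ m * (b * e - a * f + (d * g - c * h))
    ly = solve-∀
    ey : y ≡ m * y′
    ey = ly m a b c d e f g h
    lz : ∀ m a b c d e f g h → (e + m * a) * g - (f + m * b) * h - ((g + m * c) * e - (h + m * d) * f)
      ≡ m * (a * g - b * h - (c * e - d * f))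
    lz = solve-∀
    ez : z ≡ m * z′
    ez = lz m a b c d e f g h
    lw : ∀ T m a b c d e f g h → (e + m * a) * h + (f + m * b) * g + T * (f + m * b) * h
      - ((g + m * c) * f + (h + m * d) * e + T * (h + m * d) * f)
      ≡ m * (a * h + b * g + T * b * h - (c * f + d * e + T * d * f))
    lw = solve-∀
    ew : w ≡ m * w′
    ew = lw T m a b c d e f g h

  -- A residue β of α modulo m of norm below m², except that for T = 0
  -- all coordinates of α may be odd multiples of m / 2.
  data Reduced (T : ℤ) (m : ℕ) (a b c d : ℤ) : Set where
    small : ∀ e f g h κ λ′ μ ν → a ≡ e + + m * κ → b ≡ f + + m * λ′ → c ≡ g + + m * μ → d ≡ h + + m * ν →
      + 0 ≤ + m * + m - 1ℤ - F T e f g h → Reduced T m a b c d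
    half : ∀ M → F T a b c d ≡ + m * + m * M → Reduced T m a b c d

  record Form : Set where
    field
      T : ℤ
      N≥0 : ∀ x y → 0ℤ ≤ N T x y
      N≡0 : ∀ x y → N T x y ≡ 0ℤ → x ≡ 0ℤ × y ≡ 0ℤ
      reduce : ∀ m .{{_ : ℕ.NonZero m}} a b c d → Reduced T m a b c d

  module Descent (form : Form) where
    open Form form

    F≥0 : ∀ a b c d → 0ℤ ≤ F T a b c d
    F≥0 a b c d = 0≤m+n (N≥0 a b) (N≥0 c d)

    F≡0 : ∀ a b c d → F T a b c d ≡ 0ℤ → a ≡ 0ℤ × b ≡ 0ℤ × c ≡ 0ℤ × d ≡ 0ℤ
    F≡0 a b c d e =
      let p , q = 0≤+0≤≡0 (N≥0 a b) (N≥0 c d) e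
          a0 , b0 = N≡0 a b p
          c0 , d0 = N≡0 c d q
      in a0 , b0 , c0 , d0

    -- A residue modulo m keeps the norm modulo m; the expansion names the integer cofactor M′ in
    -- F(residue) = m M′ explicitly.
    congruent : ∀ T m M e f g h κ l μ ν →
      let N = λ x y → x * x + T * x * y + y * y in
      (N (e + m * κ) (f + m * l) + N (g + m * μ) (h + m * ν)) - m * M ≡
      (N e f + N g h) - m * (M - (+ 2 * (e * κ + f * l + g * μ + h * ν) + T * (e * l + f * κ + g * ν + h * μ)
         + m * (N κ l + N μ ν)))
    congruent = solve-∀

    private
      sub-eq : ∀ {i j} → i - j ≡ 0ℤ → i ≡ j
      sub-eq {i} {j} e = i-j≡0⇒i≡j i j e

    -- A vector of norm m p times the conjugate of its residue modulo m is divisible by m. The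
    -- quotient has norm m′ p, where m m′ is the norm of the residue, and the bound below m² forces
    -- m′ < m.
    descend : ∀ {p} → Prime p → ∀ m → 0 ℕ.< m → m ℕ.< p → Rep T (+ m * + p) → Rep T (+ p)
    descend {p} pr = <-rec _ step
      where
      instance _ = prime⇒nonZero pr
      m∤p : ∀ {m} → 1 ℕ.< m → m ℕ.< p → ∀ z → + p ≡ + m * z → ∀ {A : Set} → A
      m∤p {m} 1<m m<p z e =
        contradiction (ℕ.hasNonTrivialDivisor {{ℕ.n>1⇒nonTrivial 1<m}} m<p
          (ℕ.divides ∣ z ∣ (trans (cong ∣_∣ e) (trans (abs-* (+ m) z) (ℕ.*-comm m ∣ z ∣))))) (Prime.notComposite pr)
      step : ∀ m → (∀ {m′} → m′ ℕ.< m → 0 ℕ.< m′ → m′ ℕ.< p → Rep T (+ m′ * + p) → Rep T (+ p)) →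
        0 ℕ.< m → m ℕ.< p → Rep T (+ m * + p) → Rep T (+ p)
      step 1 _ _ _ r = subst (Rep T) (*-identityˡ (+ p)) r
      step m@(suc (suc _)) rec _ m<p (rep a b c d eq) with reduce m a b c d
      -- Here m p = m² M, so m would divide p although 1 < m < p.
      ... | half M e = m∤p {m} (s≤s (s≤s z≤n)) m<p M
             (*-cancelˡ-≡ (+ m) (+ p) (+ m * M) (trans (sym eq) (trans e (*-assoc (+ m) (+ m) M))))
      ... | small e f g h κ l μ ν refl refl refl refl bound =
        next (0≤⇒+ (*-cancelˡ-≤-pos 0ℤ M (+ m)
               (subst₂ _≤_ (sym (*-zeroʳ (+ m))) Fβ (F≥0 e f g h))))
        where
        M = + p - (+ 2 * (e * κ + f * l + g * μ + h * ν) + T * (e * l + f * κ + g * ν + h * μ)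
              + + m * (N T κ l + N T μ ν))
        Fβ : F T e f g h ≡ + m * M
        Fβ = sub-eq (trans (sym (congruent T (+ m) (+ p) e f g h κ l μ ν)) (i≡j⇒i-j≡0 eq))
        next : (∃ λ m′ → M ≡ + m′) → Rep T (+ p)
        -- A residue of norm 0 vanishes, so all coordinates are multiples of m and again m² divides
        -- m p.
        next (zero , M≡0) = m∤p {m} (s≤s (s≤s z≤n)) m<p (F T κ l μ ν)
            (*-cancelˡ-≡ (+ m) (+ p) _ (trans (sym eq) (trans collapse (*-assoc (+ m) (+ m) (F T κ l μ ν)))))
          where
          zeros = F≡0 e f g h (trans Fβ (trans (cong (+ m *_) M≡0) (*-zeroʳ (+ m))))
          drop : ∀ {x} y → x ≡ 0ℤ → x + y ≡ y
          drop y refl = +-identityˡ y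
          collapse : F T (e + + m * κ) (f + + m * l) (g + + m * μ) (h + + m * ν) ≡ + m * + m * F T κ l μ ν
          collapse = trans
            (cong₂ _+_ (cong₂ (N T) (drop _ (proj₁ zeros)) (drop _ (proj₁ (proj₂ zeros))))
                       (cong₂ (N T) (drop _ (proj₁ (proj₂ (proj₂ zeros)))) (drop _ (proj₂ (proj₂ (proj₂ zeros))))))
            (F-scale T (+ m) κ l μ ν)
        next (suc m′ , M≡) = rec m′<m (s≤s z≤n) (ℕ.<-trans m′<m m<p)
            (rep x y z w (*-cancelˡ-≡ (+ m * + m) (F T x y z w) (+ suc m′ * + p)
              (trans (sym (descent-identity T (+ m) (+ suc m′) κ l μ ν e f g h Fβ′))
                (trans (cong₂ _*_ eq Fβ′) (shuffle (+ m) (+ p) (+ suc m′))))))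
          where
          x = + suc m′ + (κ * e + T * κ * f + l * f + (μ * g + T * μ * h + ν * h))
          y = l * e - κ * f + (ν * g - μ * h)
          z = κ * g - l * h - (μ * e - ν * f)
          w = κ * h + l * g + T * l * h - (μ * f + ν * e + T * ν * f)
          Fβ′ : F T e f g h ≡ + m * + suc m′
          Fβ′ = trans Fβ (cong (+ m *_) M≡)
          shuffle : ∀ m p m′ → m * p * (m * m′) ≡ m * m * (m′ * p)
          shuffle = solve-∀
          cert : ∀ m F → m * m - 1ℤ - F ≡ m * m - (1ℤ + F)
          cert = solve-∀
          lt : 1ℤ + + m * + suc m′ ≤ + m * + m
          lt = 0≤i-j⇒j≤i (subst (0ℤ ≤_) (trans (cert (+ m) (F T e f g h)) (cong (λ z → + m * + m - (1ℤ + z)) Fβ′)) bound)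
          m′<m : suc m′ ℕ.< m
          m′<m = drop‿+<+ (*-cancelˡ-<-nonNeg (+ m) (suc[i]≤j⇒i<j lt))

  parity : ∀ n → ∃ λ h → n ≡ 2 ℕ.* h ⊎ n ≡ 1 ℕ.+ 2 ℕ.* h
  parity zero = 0 , inj₁ refl
  parity (suc n) with parity n
  ... | h , inj₁ e = h , inj₂ (cong suc e)
  ... | h , inj₂ e = suc h , inj₁ (trans (cong suc e) (sym (ℕ.*-suc 2 h)))

  module AllIntegers (form : Form) (c : ℕ)
    (small-primes : ∀ {p : ℕ} → Prime p → p ℕ.∣ 2 ℕ.* c → Rep (Form.T form) (+ p))
    (lift : ∀ (s r : ℕ) → Rep (Form.T form) (+ (s ℕ.* s ℕ.+ c ℕ.* (r ℕ.* r) ℕ.+ 1)))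
    (bound : ∀ (h : ℕ) → 0 ℕ.< h → h ℕ.* h ℕ.+ c ℕ.* (h ℕ.* h) ℕ.+ 1 ℕ.< (1 ℕ.+ 2 ℕ.* h) ℕ.* (1 ℕ.+ 2 ℕ.* h))
    where
    open Form form using (T)

    -- Primes dividing 2 c are given separately. For the others the pigeonhole argument yields a
    -- multiple M p of the shape s² + c r² + 1, with M < p because s and r are at most (p - 1) / 2,
    -- and descent removes M.
    prime-rep : ∀ {p} → Prime p → Rep T (+ p)
    prime-rep {p} pr with p ℕ.∣? (2 ℕ.* c)
    ... | yes p∣2c = small-primes pr p∣2c
    ... | no p∤2c with parity p
    ...   | h , inj₁ e with prime⇒irreducible pr (ℕ.divides h (trans e (ℕ.*-comm 2 h)))
    ...     | inj₂ refl = contradiction (ℕ.m∣m*n c) p∤2c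
    prime-rep {p} pr | no p∤2c | h , inj₂ refl
      with s , r , s≤h , r≤h , ℕ.divides M eq ← isotropic {h} pr c (λ p∣c → p∤2c (ℕ.∣n⇒∣m*n 2 p∣c))
      = Descent.descend form pr M M>0 M<p (subst (Rep T) (trans (cong +_ eq) (pos-* M p)) (lift s r))
      where
      h>0 : ∀ {h} → Prime (1 ℕ.+ 2 ℕ.* h) → 0 ℕ.< h
      h>0 {zero} pr = contradiction (ℕ.nonTrivial⇒n>1 1 {{prime⇒nonTrivial pr}}) (λ { (s≤s ()) })
      h>0 {suc h} _ = s≤s z≤n
      M>0 : 0 ℕ.< M
      M>0 = ℕ.n≢0⇒n>0 (λ { refl → contradiction (trans (ℕ.+-comm 1 _) eq) λ () })
      M<p : M ℕ.< p
      M<p = ℕ.*-cancelʳ-< p M p (subst (ℕ._< p ℕ.* p) eq (ℕ.≤-<-trans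
        (ℕ.+-monoˡ-≤ 1 (ℕ.+-mono-≤ (ℕ.*-mono-≤ s≤h s≤h) (ℕ.*-monoʳ-≤ c (ℕ.*-mono-≤ r≤h r≤h)))) (bound h (h>0 pr))))

    private
      products : ∀ ps → All Prime ps → Rep T (+ product ps)
      products [] [] = rep 1ℤ 0ℤ 0ℤ 0ℤ (one T)
        where
        one : ∀ T → (1ℤ * 1ℤ + T * 1ℤ * 0ℤ + 0ℤ * 0ℤ) + (0ℤ * 0ℤ + T * 0ℤ * 0ℤ + 0ℤ * 0ℤ) ≡ 1ℤ
        one = solve-∀
      products (p ∷ ps) (pr ∷ prs) = subst (Rep T) (sym (pos-* p (product ps))) (rep-* (prime-rep pr) (products ps prs))

    all-rep : ∀ n → Rep T (+ n)
    all-rep zero = rep 0ℤ 0ℤ 0ℤ 0ℤ (null T)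
      where
      null : ∀ T → (0ℤ * 0ℤ + T * 0ℤ * 0ℤ + 0ℤ * 0ℤ) + (0ℤ * 0ℤ + T * 0ℤ * 0ℤ + 0ℤ * 0ℤ) ≡ 0ℤ
      null = solve-∀
    all-rep n@(suc _) = subst (λ z → Rep T (+ z)) (sym isFactorisation) (products factors factorsPrime)
      where
      open PrimeFactorisation (factorise n)

-- Four squares, and two norms of Eisenstein integers

module SumsOfNorms where
  import Data.Nat.Divisibility as ℕ
  import Data.Nat.Tactic.RingSolver as ℕ
  open import Data.Nat.Primality using (Prime; prime⇒irreducible; prime⇒nonTrivial; euclidsLemma; prime?)
  open import Data.Integer hiding (suc; pred)
  open import Data.Integer.Properties
  open import Data.Integer.Tactic.RingSolver using (solve-∀)
  open import Relation.Nullary.Decidable using (from-yes)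
  open Integers
  open QuaternaryNorms

  private
    drop-0 : ∀ r → + 2 * r + 0ℤ ≡ + 2 * r
    drop-0 = solve-∀

    within : ∀ m x → 0ℤ ≤ + m - x → 0ℤ ≤ + m + x - 1ℤ → 0ℤ ≤ + m * + m - x * x
    within m x p q = square-bound (+ m) x p (subst (0ℤ ≤_) (e (+ m) x) (0≤m+n q (0≤+ 1)))
      where
      e : ∀ m x → m + x - 1ℤ + 1ℤ ≡ m + x
      e = solve-∀

    strictly : ∀ m .{{_ : ℕ.NonZero m}} x → x ≢ + m → 0ℤ ≤ + m - x → 0ℤ ≤ + m + x - 1ℤ → 0ℤ ≤ + m * + m - x * x - 1ℤ
    strictly (suc m) x ne p q with + suc m - x in eq
    ... | + 0 = contradiction (sym (i-j≡0⇒i≡j (+ suc m) x eq)) ne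
    ... | + suc k = subst (0ℤ ≤_) (trans (cong (λ z → (z - 1ℤ) * (+ suc m + x - 1ℤ) + (z - 1ℤ) + (+ suc m + x - 1ℤ)) (sym eq)) (e (+ suc m) x))
                      (0≤m+n (0≤m+n (0≤m*n (0≤+ k) q) (0≤+ k)) q)
      where
      e : ∀ m x → (m - x - 1ℤ) * (m + x - 1ℤ) + (m - x - 1ℤ) + (m + x - 1ℤ) ≡ m * m - x * x - 1ℤ
      e = solve-∀

  record Residue (m : ℕ) (a : ℤ) : Set where
    constructor residue
    field
      r κ : ℤ
      eq : a ≡ r + + m * κ
      bound : 0ℤ ≤ + m * + m - + 2 * r * (+ 2 * r)
      -- For T = 0 the bound F < m² fails only if all four coordinates have |2 r| = m; as the
      -- rounding excludes - m, equality occurs with one sign only.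
      sharp : + 2 * r ≡ + m ⊎ 0ℤ ≤ + m * + m - + 2 * r * (+ 2 * r) - 1ℤ

  residue-of : ∀ m .{{_ : ℕ.NonZero m}} a → Residue m a
  residue-of m a with r , κ , eq , hi , lo ← round m 0ℤ a = residue r κ eq (within m (+ 2 * r) hi′ lo′) alt
    where
    hi′ = subst (λ z → 0ℤ ≤ + m - z) (drop-0 r) hi
    lo′ = subst (λ z → 0ℤ ≤ + m + z - 1ℤ) (drop-0 r) lo
    alt : + 2 * r ≡ + m ⊎ 0ℤ ≤ + m * + m - + 2 * r * (+ 2 * r) - 1ℤ
    alt with + 2 * r ≟ + m
    ... | yes e = inj₁ e
    ... | no ne = inj₂ (strictly m (+ 2 * r) ne hi′ lo′)

  private
    four-sharp : ∀ m e f g h {A B C D} → 0ℤ ≤ A → 0ℤ ≤ B → 0ℤ ≤ C → 0ℤ ≤ D →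
      A + B + C + D + 1ℤ ≡ (m * m - + 2 * e * (+ 2 * e)) + (m * m - + 2 * f * (+ 2 * f))
        + (m * m - + 2 * g * (+ 2 * g)) + (m * m - + 2 * h * (+ 2 * h)) →
      0ℤ ≤ m * m - 1ℤ - F 0ℤ e f g h
    four-sharp m e f g h {A} {B} {C} {D} p q r s eq = 0≤-div 4 (m * m - 1ℤ - F 0ℤ e f g h) (subst (0ℤ ≤_) (trans (e₁ A B C D) (trans (cong (_- 1ℤ) eq) (e₂ m e f g h)))
        (0≤m+n (0≤m+n (0≤m+n p q) r) s))
      where
      e₁ : ∀ A B C D → A + B + C + D ≡ A + B + C + D + 1ℤ - 1ℤ
      e₁ = solve-∀
      e₂ : ∀ m e f g h → (m * m - + 2 * e * (+ 2 * e)) + (m * m - + 2 * f * (+ 2 * f))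
        + (m * m - + 2 * g * (+ 2 * g)) + (m * m - + 2 * h * (+ 2 * h)) - 1ℤ
        ≡ + 4 * (m * m - 1ℤ - ((e * e + 0ℤ * e * f + f * f) + (g * g + 0ℤ * g * h + h * h))) + + 3
      e₂ = solve-∀

    move₁ : ∀ A B C D → A - 1ℤ + B + C + D + 1ℤ ≡ A + B + C + D
    move₁ = solve-∀
    move₂ : ∀ A B C D → A + (B - 1ℤ) + C + D + 1ℤ ≡ A + B + C + D
    move₂ = solve-∀
    move₃ : ∀ A B C D → A + B + (C - 1ℤ) + D + 1ℤ ≡ A + B + C + D
    move₃ = solve-∀
    move₄ : ∀ A B C D → A + B + C + (D - 1ℤ) + 1ℤ ≡ A + B + C + D
    move₄ = solve-∀

    -- An odd multiple m / 2 + m κ has the square (m² / 4) (1 + 4 κ (κ + 1)), so four of them add up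
    -- to a multiple of m².
    halves : ∀ e f g h κ l μ ν m → + 2 * e ≡ m → + 2 * f ≡ m → + 2 * g ≡ m → + 2 * h ≡ m →
      F 0ℤ (e + m * κ) (f + m * l) (g + m * μ) (h + m * ν) ≡
      m * m * (1ℤ + (κ * (κ + 1ℤ) + l * (l + 1ℤ) + μ * (μ + 1ℤ) + ν * (ν + 1ℤ)))
    halves e f g h κ l μ ν m em ef eg eh = same em
      (*-cancelˡ-≡ (+ 2) f e (trans ef (sym em))) (*-cancelˡ-≡ (+ 2) g e (trans eg (sym em))) (*-cancelˡ-≡ (+ 2) h e (trans eh (sym em)))
      where
      id : ∀ e κ l μ ν → let m = + 2 * e in
        (((e + m * κ) * (e + m * κ) + 0ℤ * (e + m * κ) * (e + m * l) + (e + m * l) * (e + m * l)) +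
        ((e + m * μ) * (e + m * μ) + 0ℤ * (e + m * μ) * (e + m * ν) + (e + m * ν) * (e + m * ν))) ≡
        m * m * (1ℤ + (κ * (κ + 1ℤ) + l * (l + 1ℤ) + μ * (μ + 1ℤ) + ν * (ν + 1ℤ)))
      id = solve-∀
      same : ∀ {f g h m} → + 2 * e ≡ m → f ≡ e → g ≡ e → h ≡ e →
        F 0ℤ (e + m * κ) (f + m * l) (g + m * μ) (h + m * ν) ≡
        m * m * (1ℤ + (κ * (κ + 1ℤ) + l * (l + 1ℤ) + μ * (μ + 1ℤ) + ν * (ν + 1ℤ)))
      same refl refl refl refl = id e κ l μ ν

    reduce₀ : ∀ m .{{_ : ℕ.NonZero m}} a b c d → Reduced 0ℤ m a b c d
    reduce₀ m a b c d = reduce-residues (residue-of m a) (residue-of m b) (residue-of m c) (residue-of m d)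
      where
      reduce-residues : Residue m a → Residue m b → Residue m c → Residue m d → Reduced 0ℤ m a b c d
      reduce-residues (residue e κ ea p sp) (residue f l eb q sq) (residue g μ ec r sr) (residue h ν ed s ss) = go sp sq sr ss
        where
        A = + m * + m - + 2 * e * (+ 2 * e)
        B = + m * + m - + 2 * f * (+ 2 * f)
        C = + m * + m - + 2 * g * (+ 2 * g)
        D = + m * + m - + 2 * h * (+ 2 * h)
        done : 0ℤ ≤ + m * + m - 1ℤ - F 0ℤ e f g h → Reduced 0ℤ m a b c d
        done = small e f g h κ l μ ν ea eb ec ed
        go : + 2 * e ≡ + m ⊎ 0ℤ ≤ A - 1ℤ → + 2 * f ≡ + m ⊎ 0ℤ ≤ B - 1ℤ →
             + 2 * g ≡ + m ⊎ 0ℤ ≤ C - 1ℤ → + 2 * h ≡ + m ⊎ 0ℤ ≤ D - 1ℤ → Reduced 0ℤ m a b c d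
        go (inj₂ p′) _ _ _ = done (four-sharp (+ m) e f g h p′ q r s (move₁ A B C D))
        go (inj₁ _) (inj₂ q′) _ _ = done (four-sharp (+ m) e f g h p q′ r s (move₂ A B C D))
        go (inj₁ _) (inj₁ _) (inj₂ r′) _ = done (four-sharp (+ m) e f g h p q r′ s (move₃ A B C D))
        go (inj₁ _) (inj₁ _) (inj₁ _) (inj₂ s′) = done (four-sharp (+ m) e f g h p q r s′ (move₄ A B C D))
        go (inj₁ u) (inj₁ v) (inj₁ w) (inj₁ x) = half _ (trans (cong₂ _+_ (cong₂ (N 0ℤ) ea eb) (cong₂ (N 0ℤ) ec ed))
          (halves e f g h κ l μ ν (+ m) u v w x))

  gaussian : Form
  gaussian = record
    { T = 0ℤ
    ; N≥0 = λ x y → subst (0ℤ ≤_) (e x y) (0≤m+n (0≤n² x) (0≤n² y))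
    ; N≡0 = λ x y eq → let p , q = 0≤+0≤≡0 (0≤n² x) (0≤n² y) (trans (e x y) eq) in n²≡0⇒n≡0 x p , n²≡0⇒n≡0 y q
    ; reduce = reduce₀
    }
    where
    e : ∀ x y → x * x + y * y ≡ x * x + 0ℤ * x * y + y * y
    e = solve-∀

  private
    2m²≥1 : ∀ m .{{_ : ℕ.NonZero m}} → 0ℤ ≤ + 2 * (+ m * + m) - 1ℤ
    2m²≥1 (suc m) = 0≤+ _

    -- From 4 N(e , f) = (2 e + f)² + 3 f² with |2 e + f| ≤ m and |f| ≤ m / 2, each norm is at most
    -- 7 m² / 16, and two of them stay below m² without an exceptional case. The second coordinate
    -- is rounded first because its residue is the offset for rounding the first.
    reduce₁ : ∀ m .{{_ : ℕ.NonZero m}} a b c d → Reduced 1ℤ m a b c d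
    reduce₁ m a b c d = round-first (residue-of m b) (residue-of m d)
      where
      Rounded : ℤ → ℤ → Set
      Rounded o a = ∃₂ λ r κ → a ≡ r + + m * κ × 0ℤ ≤ + m - (+ 2 * r + o) × 0ℤ ≤ + m + (+ 2 * r + o) - 1ℤ
      round-first : Residue m b → Residue m d → Reduced 1ℤ m a b c d
      round-first (residue f l eb q _) (residue h ν ed s _) = combine (round m f a) (round m h c)
        where
        combine : Rounded f a → Rounded h c → Reduced 1ℤ m a b c d
        combine (e , κ , ea , hi , lo) (g , μ , ec , hi′ , lo′) =
          small e f g h κ l μ ν ea eb ec ed (0≤-div 16 (+ m * + m - 1ℤ - F 1ℤ e f g h) (subst (0ℤ ≤_) (id (+ m) e f g h)
            (0≤m+n (0≤m+n (0≤m+n (0≤m*n (0≤+ 4) (within m (+ 2 * e + f) hi lo)) (0≤m*n (0≤+ 3) q))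
                          (0≤m+n (0≤m*n (0≤+ 4) (within m (+ 2 * g + h) hi′ lo′)) (0≤m*n (0≤+ 3) s)))
                   (2m²≥1 m))))
          where
          id : ∀ m e f g h →
            + 4 * (m * m - (+ 2 * e + f) * (+ 2 * e + f)) + + 3 * (m * m - + 2 * f * (+ 2 * f))
            + (+ 4 * (m * m - (+ 2 * g + h) * (+ 2 * g + h)) + + 3 * (m * m - + 2 * h * (+ 2 * h)))
            + (+ 2 * (m * m) - 1ℤ) ≡
            + 16 * (m * m - 1ℤ - ((e * e + 1ℤ * e * f + f * f) + (g * g + 1ℤ * g * h + h * h))) + + 15
          id = solve-∀

  eisenstein : Form
  eisenstein = record
    { T = 1ℤ
    ; N≥0 = λ x y → 0≤-div 4 (N 1ℤ x y) (subst (0ℤ ≤_) (e₃ x y) (0≤m+n (4N≥0 x y) (0≤+ 3)))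
    ; N≡0 = λ x y eq →
        let p , q = 0≤+0≤≡0 (0≤n² (+ 2 * x + y)) (0≤m*n (0≤+ 3) (0≤n² y)) (trans (e x y) (cong (+ 4 *_) eq))
            y≡0 = n²≡0⇒n≡0 y (*-cancelˡ-≡ (+ 3) (y * y) 0ℤ q)
            2x≡0 = trans (sym (+-identityʳ (+ 2 * x))) (trans (cong (λ z → + 2 * x + z) (sym y≡0)) (n²≡0⇒n≡0 (+ 2 * x + y) p))
        in *-cancelˡ-≡ (+ 2) x 0ℤ 2x≡0 , y≡0
    ; reduce = reduce₁
    }
    where
    e : ∀ x y → (+ 2 * x + y) * (+ 2 * x + y) + + 3 * (y * y) ≡ + 4 * (x * x + 1ℤ * x * y + y * y)
    e = solve-∀
    e₃ : ∀ x y → (+ 2 * x + y) * (+ 2 * x + y) + + 3 * (y * y) + + 3 ≡ + 4 * (x * x + 1ℤ * x * y + y * y) + + 3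
    e₃ = solve-∀
    4N≥0 : ∀ x y → 0ℤ ≤ (+ 2 * x + y) * (+ 2 * x + y) + + 3 * (y * y)
    4N≥0 x y = 0≤m+n (0≤n² (+ 2 * x + y)) (0≤m*n (0≤+ 3) (0≤n² y))

  private
    p∣2⇒p≡2 : ∀ {p} → Prime p → p ℕ.∣ 2 → p ≡ 2
    p∣2⇒p≡2 pr p∣2 with prime⇒irreducible (from-yes (prime? 2)) p∣2
    ... | inj₁ refl = contradiction (ℕ.nonTrivial⇒n>1 1 {{prime⇒nonTrivial pr}}) (λ { (s≤s ()) })
    ... | inj₂ e = e
    p∣3⇒p≡3 : ∀ {p} → Prime p → p ℕ.∣ 3 → p ≡ 3
    p∣3⇒p≡3 pr p∣3 with prime⇒irreducible (from-yes (prime? 3)) p∣3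
    ... | inj₁ refl = contradiction (ℕ.nonTrivial⇒n>1 1 {{prime⇒nonTrivial pr}}) (λ { (s≤s ()) })
    ... | inj₂ e = e

    cast : ∀ s r c → + (s ℕ.* s ℕ.+ c ℕ.* (r ℕ.* r) ℕ.+ 1) ≡ + s * + s + + c * (+ r * + r) + 1ℤ
    cast s r c = trans (pos-+ _ 1) (cong (_+ 1ℤ) (trans (pos-+ (s ℕ.* s) _) (cong₂ _+_ (pos-* s s) (trans (pos-* c _) (cong (+ c *_) (pos-* r r))))))

  opaque
    four-squares : ∀ n → Rep 0ℤ (+ n)
    four-squares = AllIntegers.all-rep gaussian 1
      (λ pr p∣2 → subst (λ p → Rep 0ℤ (+ p)) (sym (p∣2⇒p≡2 pr p∣2)) (rep 1ℤ 1ℤ 0ℤ 0ℤ refl))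
      (λ s r → rep (+ s) (+ r) 1ℤ 0ℤ (trans (e (+ s) (+ r)) (sym (cast s r 1))))
      bound
      where
      e : ∀ s r → (s * s + 0ℤ * s * r + r * r) + (1ℤ * 1ℤ + 0ℤ * 1ℤ * 0ℤ + 0ℤ * 0ℤ) ≡ s * s + 1ℤ * (r * r) + 1ℤ
      e = solve-∀
      bound : ∀ h → 0 ℕ.< h → h ℕ.* h ℕ.+ 1 ℕ.* (h ℕ.* h) ℕ.+ 1 ℕ.< (1 ℕ.+ 2 ℕ.* h) ℕ.* (1 ℕ.+ 2 ℕ.* h)
      bound (suc k) _ = ℕ.≤-trans (ℕ.m≤m+n _ _) (ℕ.≤-reflexive (id k))
        where
        id : ∀ k → suc ((1 ℕ.+ k) ℕ.* (1 ℕ.+ k) ℕ.+ 1 ℕ.* ((1 ℕ.+ k) ℕ.* (1 ℕ.+ k)) ℕ.+ 1) ℕ.+ (5 ℕ.+ 8 ℕ.* k ℕ.+ 2 ℕ.* k ℕ.* k)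
          ≡ (1 ℕ.+ 2 ℕ.* (1 ℕ.+ k)) ℕ.* (1 ℕ.+ 2 ℕ.* (1 ℕ.+ k))
        id = ℕ.solve-∀

  opaque
    eisenstein-norms : ∀ n → Rep 1ℤ (+ n)
    eisenstein-norms = AllIntegers.all-rep eisenstein 3 small-primes
      -- The Eisenstein norm of (s - r , 2 r) is s² + 3 r², whence c = 3; the norm of 1 supplies the
      -- summand 1.
      (λ s r → rep (+ s - + r) (+ 2 * + r) 1ℤ 0ℤ (trans (e (+ s) (+ r)) (sym (cast s r 3))))
      bound
      where
      small-primes : ∀ {p} → Prime p → p ℕ.∣ 6 → Rep 1ℤ (+ p)
      small-primes pr p∣6 with euclidsLemma 2 3 pr p∣6
      ... | inj₁ p∣2 = subst (λ p → Rep 1ℤ (+ p)) (sym (p∣2⇒p≡2 pr p∣2)) (rep 1ℤ 0ℤ 1ℤ 0ℤ refl)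
      ... | inj₂ p∣3 = subst (λ p → Rep 1ℤ (+ p)) (sym (p∣3⇒p≡3 pr p∣3)) (rep 1ℤ 1ℤ 0ℤ 0ℤ refl)
      e : ∀ s r → ((s - r) * (s - r) + 1ℤ * (s - r) * (+ 2 * r) + + 2 * r * (+ 2 * r)) + (1ℤ * 1ℤ + 1ℤ * 1ℤ * 0ℤ + 0ℤ * 0ℤ) ≡ s * s + + 3 * (r * r) + 1ℤ
      e = solve-∀
      bound : ∀ h → 0 ℕ.< h → h ℕ.* h ℕ.+ 3 ℕ.* (h ℕ.* h) ℕ.+ 1 ℕ.< (1 ℕ.+ 2 ℕ.* h) ℕ.* (1 ℕ.+ 2 ℕ.* h)
      bound (suc k) _ = ℕ.≤-trans (ℕ.m≤m+n _ _) (ℕ.≤-reflexive (id k))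
        where
        id : ∀ k → suc ((1 ℕ.+ k) ℕ.* (1 ℕ.+ k) ℕ.+ 3 ℕ.* ((1 ℕ.+ k) ℕ.* (1 ℕ.+ k)) ℕ.+ 1) ℕ.+ (3 ℕ.+ 4 ℕ.* k)
          ≡ (1 ℕ.+ 2 ℕ.* (1 ℕ.+ k)) ℕ.* (1 ℕ.+ 2 ℕ.* (1 ℕ.+ k))
        id = ℕ.solve-∀

-- Deciding divisibility of polynomials by exhausting residues

module Residues where
  open import Data.Bool using (Bool; true; false; _∧_; T)
  open import Data.Bool.Properties using (T-∧)
  open import Data.Bool.ListAction using (any; all)
  open import Data.Nat using (NonZero; _≡ᵇ_)
  open import Data.Integer hiding (suc; pred; NonZero)
  open import Data.Integer.Properties 
  open import Data.Integer.DivMod using (_/ℕ_; _%ℕ_; n%ℕd<d; a≡a%ℕn+[a/ℕn]*n)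
  open import Data.Integer.Divisibility.Signed using (_∣_; divides)
  open import Data.Integer.Tactic.RingSolver using (solve-∀)
  open import Data.Fin using (Fin; zero; suc)
  open import Data.Vec using (Vec; []; _∷_; lookup; map)
  open import Data.Vec.Properties using (lookup-map)
  open import Data.List using (List; []; _∷_)
  open import Data.List.Relation.Unary.Any using (Any; here; there)
  open import Data.List.Relation.Unary.All using (All; []; _∷_)
  open import Function.Bundles using (Equivalence)

  infixl 6 _:+_ _:-_
  infixl 7 _:*_

  -- Polynomials are reified because each one is used twice: the Boolean test evaluates it at
  -- residues, the conclusion at arbitrary integers.
  data Expr : Set where
    var : Fin 4 → Expr
    con : ℤ → Expr
    _:+_ _:-_ _:*_ : Expr → Expr → Expr

  ⟦_⟧ : Expr → Vec ℤ 4 → ℤ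
  ⟦ var i ⟧ ρ = lookup ρ i
  ⟦ con z ⟧ ρ = z
  ⟦ e :+ f ⟧ ρ = ⟦ e ⟧ ρ + ⟦ f ⟧ ρ
  ⟦ e :- f ⟧ ρ = ⟦ e ⟧ ρ - ⟦ f ⟧ ρ
  ⟦ e :* f ⟧ ρ = ⟦ e ⟧ ρ * ⟦ f ⟧ ρ

  -- A list of lists of expressions is read as a disjunction of conjunctions of divisibilities by m.
  Holds : ℕ → List (List Expr) → Vec ℤ 4 → Set
  Holds m φ ρ = Any (All (λ e → + m ∣ ⟦ e ⟧ ρ)) φ

  below : ℕ → (ℕ → Bool) → Bool
  below zero p = true
  below (suc k) p = p k ∧ below k p

  below-sound : ∀ k p → T (below k p) → ∀ {i} → i ℕ.< k → T (p i)
  below-sound (suc k) p t {i} i<1+k with i ℕ.≟ k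
  ... | yes refl = proj₁ (Equivalence.to (T-∧ {p k}) t)
  ... | no i≢k = below-sound k p (proj₂ (Equivalence.to (T-∧ {p k}) t)) (ℕ.≤∧≢⇒< (ℕ.≤-pred i<1+k) i≢k)

  module _ (m : ℕ) .{{_ : NonZero m}} where

    holds : List (List Expr) → Vec ℤ 4 → Bool
    holds φ ρ = any (all (λ e → ⟦ e ⟧ ρ %ℕ m ≡ᵇ 0)) φ

    everywhere : List (List Expr) → Bool
    everywhere φ = below m λ i → below m λ j → below m λ k → below m λ l → holds φ (+ i ∷ + j ∷ + k ∷ + l ∷ [])

    Congruent : ℤ → ℤ → Set
    Congruent x y = ∃ λ k → x ≡ y + k * + m

    residue : ℤ → ℤ
    residue x = + (x %ℕ m)

    ⟦⟧-cong : ∀ e ρ → Congruent (⟦ e ⟧ ρ) (⟦ e ⟧ (map residue ρ))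
    ⟦⟧-cong (var i) ρ = lookup ρ i /ℕ m , trans (a≡a%ℕn+[a/ℕn]*n (lookup ρ i) m) (cong (_+ lookup ρ i /ℕ m * + m) (sym (lookup-map i residue ρ)))
    ⟦⟧-cong (con z) ρ = 0ℤ , sym (trans (cong (λ w → z + w) (*-zeroˡ (+ m))) (+-identityʳ z))
    ⟦⟧-cong (e :+ f) ρ with k , p ← ⟦⟧-cong e ρ | l , q ← ⟦⟧-cong f ρ = k + l , trans (cong₂ _+_ p q) (id (⟦ e ⟧ (map residue ρ)) (⟦ f ⟧ (map residue ρ)) k l (+ m))
      where
      id : ∀ x y k l m → x + k * m + (y + l * m) ≡ x + y + (k + l) * m
      id = solve-∀
    ⟦⟧-cong (e :- f) ρ with k , p ← ⟦⟧-cong e ρ | l , q ← ⟦⟧-cong f ρ = k - l , trans (cong₂ _-_ p q) (id (⟦ e ⟧ (map residue ρ)) (⟦ f ⟧ (map residue ρ)) k l (+ m))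
      where
      id : ∀ x y k l m → x + k * m - (y + l * m) ≡ x - y + (k - l) * m
      id = solve-∀
    ⟦⟧-cong (e :* f) ρ with k , p ← ⟦⟧-cong e ρ | l , q ← ⟦⟧-cong f ρ = ⟦ e ⟧ (map residue ρ) * l + k * ⟦ f ⟧ (map residue ρ) + k * l * + m ,
      trans (cong₂ _*_ p q) (id (⟦ e ⟧ (map residue ρ)) (⟦ f ⟧ (map residue ρ)) k l (+ m))
      where
      id : ∀ x y k l m → (x + k * m) * (y + l * m) ≡ x * y + (x * l + k * y + k * l * m) * m
      id = solve-∀

    sound-literal : ∀ e ρ → T (⟦ e ⟧ (map residue ρ) %ℕ m ≡ᵇ 0) → + m ∣ ⟦ e ⟧ ρ
    sound-literal e ρ t with ⟦⟧-cong e ρ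
    ... | k , eq = divides (y /ℕ m + k) (trans eq (trans (cong (_+ k * + m) y-multiple) (sym (*-distribʳ-+ (+ m) (y /ℕ m) k))))
      where
      y = ⟦ e ⟧ (map residue ρ)
      y-multiple : y ≡ y /ℕ m * + m
      y-multiple = trans (a≡a%ℕn+[a/ℕn]*n y m) (trans (cong (λ r → + r + y /ℕ m * + m) (ℕ.≡ᵇ⇒≡ _ 0 t)) (+-identityˡ _))

    sound-conj : ∀ es ρ → T (all (λ e → ⟦ e ⟧ (map residue ρ) %ℕ m ≡ᵇ 0) es) → All (λ e → + m ∣ ⟦ e ⟧ ρ) es
    sound-conj [] ρ t = []
    sound-conj (e ∷ es) ρ t = sound-literal e ρ (proj₁ (Equivalence.to (T-∧ {⟦ e ⟧ (map residue ρ) %ℕ m ≡ᵇ 0}) t)) ∷ sound-conj es ρ (proj₂ (Equivalence.to (T-∧ {⟦ e ⟧ (map residue ρ) %ℕ m ≡ᵇ 0}) t))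

    sound-disj : ∀ φ ρ → T (holds φ (map residue ρ)) → Holds m φ ρ
    sound-disj (es ∷ φ) ρ t with all (λ e → ⟦ e ⟧ (map residue ρ) %ℕ m ≡ᵇ 0) es in eq
    ... | true = here (sound-conj es ρ (subst T (sym eq) _))
    ... | false = there (sound-disj φ ρ t)

    -- Polynomials respect congruences modulo m, so the test of all m⁴ vectors of residues decides
    -- the matter for all integers.
    by-residues : ∀ φ → T (everywhere φ) → ∀ ρ → Holds m φ ρ
    by-residues φ t ρ@(a ∷ b ∷ c ∷ d ∷ []) = sound-disj φ ρ
      (below-sound m _ (below-sound m _ (below-sound m _ (below-sound m _ t (n%ℕd<d a m)) (n%ℕd<d b m)) (n%ℕd<d c m)) (n%ℕd<d d m))

-- Sums of values of a binary form; four squares with given parities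

module FormSums where
  open import Data.Integer hiding (suc; pred)
  open import Data.Integer.Properties
  open import Data.Integer.DivMod using (_/ℕ_; _%ℕ_; n%ℕd<d; a≡a%ℕn+[a/ℕn]*n)
  open import Data.Integer.Divisibility.Signed using (_∣_; divides; _∣?_; ∣m∣n⇒∣m-n)
  open import Data.Integer.Tactic.RingSolver using (solve-∀)
  open import Data.Vec using (Vec; []; _∷_)
  open import Relation.Nullary.Decidable using (False; toWitnessFalse)
  open QuaternaryNorms using (rep)
  open SumsOfNorms using (four-squares)

  form : ℤ → ℤ → ℤ → ℤ → ℤ → ℤ
  form a b c x y = a * (x * x) + b * (x * y) + c * (y * y)

  total : ∀ {m} → (ℤ → ℤ → ℤ) → Vec (ℤ × ℤ) m → ℤ
  total f [] = 0ℤ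
  total f ((x , y) ∷ v) = f x y + total f v

  SumOf : (ℤ → ℤ → ℤ) → ℕ → ℤ → Set
  SumOf f m r = ∃ λ (v : Vec (ℤ × ℤ) m) → total f v ≡ r

  prepend : ∀ {f m r s} x y → f x y ≡ s → SumOf f m r → SumOf f (suc m) (s + r)
  prepend x y refl (v , refl) = (x , y) ∷ v , refl

  pad : ∀ {a b c m r} → SumOf (form a b c) m r → SumOf (form a b c) (suc m) r
  pad {a} {b} {c} {r = r} s = subst (SumOf (form a b c) _) (+-identityˡ r) (prepend {f = form a b c} 0ℤ 0ℤ (e a b c) s)
    where
    e : ∀ a b c → a * (0ℤ * 0ℤ) + b * (0ℤ * 0ℤ) + c * (0ℤ * 0ℤ) ≡ 0ℤ
    e = solve-∀

  ∤-const : ∀ {m x y} k → + m ∣ x → + m ∣ y → x - y ≡ k → {False (+ m ∣? k)} → ∀ {A : Set} → A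
  ∤-const k p q refl {no-div} = contradiction (∣m∣n⇒∣m-n p q) (toWitnessFalse no-div)

  data Parity : ℤ → Set where
    even : ∀ e → Parity (+ 2 * e)
    odd : ∀ e → Parity (+ 2 * e + 1ℤ)

  parity-of : ∀ x → Parity x
  parity-of x = go (x %ℕ 2) (n%ℕd<d x 2) (a≡a%ℕn+[a/ℕn]*n x 2)
    where
    q = x /ℕ 2
    e₀ : ∀ q → 0ℤ + q * + 2 ≡ + 2 * q
    e₀ = solve-∀
    e₁ : ∀ q → 1ℤ + q * + 2 ≡ + 2 * q + 1ℤ
    e₁ = solve-∀
    go : ∀ r → r ℕ.< 2 → x ≡ + r + q * + 2 → Parity x
    go 0 _ eq = subst Parity (sym (trans eq (e₀ q))) (even q)
    go 1 _ eq = subst Parity (sym (trans eq (e₁ q))) (odd q)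
    go (suc (suc _)) (s≤s (s≤s ())) _

  squares : ℤ → ℤ → ℤ → ℤ → ℤ
  squares a b c d = a * a + b * b + c * c + d * d

  record Squares (δ₁ δ₂ δ₃ δ₄ : ℤ) (S : ℤ) : Set where
    constructor roots
    field
      e₁ e₂ e₃ e₄ : ℤ
      eq : squares (+ 2 * e₁ + δ₁) (+ 2 * e₂ + δ₂) (+ 2 * e₃ + δ₃) (+ 2 * e₄ + δ₄) ≡ S

  data Sorted (S : ℤ) : Set where
    odds₀ : Squares 0ℤ 0ℤ 0ℤ 0ℤ S → Sorted S
    odds₁ : Squares 1ℤ 0ℤ 0ℤ 0ℤ S → Sorted S
    odds₂ : Squares 1ℤ 1ℤ 0ℤ 0ℤ S → Sorted S
    odds₃ : Squares 1ℤ 1ℤ 1ℤ 0ℤ S → Sorted S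
    odds₄ : Squares 1ℤ 1ℤ 1ℤ 1ℤ S → Sorted S

  private
    s12 : ∀ {S} a b c d → squares a b c d ≡ S → squares b a c d ≡ S
    s12 a b c d = trans (e a b c d)
      where
      e : ∀ a b c d → b * b + a * a + c * c + d * d ≡ a * a + b * b + c * c + d * d
      e = solve-∀
    s23 : ∀ {S} a b c d → squares a b c d ≡ S → squares a c b d ≡ S
    s23 a b c d = trans (e a b c d)
      where
      e : ∀ a b c d → a * a + c * c + b * b + d * d ≡ a * a + b * b + c * c + d * d
      e = solve-∀
    s34 : ∀ {S} a b c d → squares a b c d ≡ S → squares a b d c ≡ S
    s34 a b c d = trans (e a b c d)
      where
      e : ∀ a b c d → a * a + b * b + d * d + c * c ≡ a * a + b * b + c * c + d * d
      e = solve-∀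

    build : ∀ δ₁ δ₂ δ₃ δ₄ e₁ e₂ e₃ e₄ {a b c d S} → a ≡ + 2 * e₁ + δ₁ → b ≡ + 2 * e₂ + δ₂ →
      c ≡ + 2 * e₃ + δ₃ → d ≡ + 2 * e₄ + δ₄ → squares a b c d ≡ S → Squares δ₁ δ₂ δ₃ δ₄ S
    build _ _ _ _ e₁ e₂ e₃ e₄ refl refl refl refl eq = roots e₁ e₂ e₃ e₄ eq

    ev : ∀ e → + 2 * e ≡ + 2 * e + 0ℤ
    ev e = sym (+-identityʳ (+ 2 * e))

    -- Moving the odd roots to the front leaves five of the sixteen parity patterns, so that two
    -- sums with equally many odd roots have them in the same places.
    sort : ∀ {S a b c d} → Parity a → Parity b → Parity c → Parity d → squares a b c d ≡ S → Sorted S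
    sort (odd e) (odd f) (odd g) (odd h) eq = odds₄ (build 1ℤ 1ℤ 1ℤ 1ℤ e f g h refl refl refl refl eq)
    sort (odd e) (odd f) (odd g) (even h) eq = odds₃ (build 1ℤ 1ℤ 1ℤ 0ℤ e f g h refl refl refl (ev h) eq)
    sort (odd e) (odd f) (even g) (odd h) eq = odds₃ (build 1ℤ 1ℤ 1ℤ 0ℤ e f h g refl refl refl (ev g) (s34 (+ 2 * e + 1ℤ) (+ 2 * f + 1ℤ) (+ 2 * g) (+ 2 * h + 1ℤ) eq))
    sort (odd e) (odd f) (even g) (even h) eq = odds₂ (build 1ℤ 1ℤ 0ℤ 0ℤ e f g h refl refl (ev g) (ev h) eq)
    sort (odd e) (even f) (odd g) (odd h) eq = odds₃ (build 1ℤ 1ℤ 1ℤ 0ℤ e g h f refl refl refl (ev f) (s34 (+ 2 * e + 1ℤ) (+ 2 * g + 1ℤ) (+ 2 * f) (+ 2 * h + 1ℤ) (s23 (+ 2 * e + 1ℤ) (+ 2 * f) (+ 2 * g + 1ℤ) (+ 2 * h + 1ℤ) eq)))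
    sort (odd e) (even f) (odd g) (even h) eq = odds₂ (build 1ℤ 1ℤ 0ℤ 0ℤ e g f h refl refl (ev f) (ev h) (s23 (+ 2 * e + 1ℤ) (+ 2 * f) (+ 2 * g + 1ℤ) (+ 2 * h) eq))
    sort (odd e) (even f) (even g) (odd h) eq = odds₂ (build 1ℤ 1ℤ 0ℤ 0ℤ e h f g refl refl (ev f) (ev g) (s23 (+ 2 * e + 1ℤ) (+ 2 * f) (+ 2 * h + 1ℤ) (+ 2 * g) (s34 (+ 2 * e + 1ℤ) (+ 2 * f) (+ 2 * g) (+ 2 * h + 1ℤ) eq)))
    sort (odd e) (even f) (even g) (even h) eq = odds₁ (build 1ℤ 0ℤ 0ℤ 0ℤ e f g h refl (ev f) (ev g) (ev h) eq)
    sort (even e) (odd f) (odd g) (odd h) eq = odds₃ (build 1ℤ 1ℤ 1ℤ 0ℤ f g h e refl refl refl (ev e) (s34 (+ 2 * f + 1ℤ) (+ 2 * g + 1ℤ) (+ 2 * e) (+ 2 * h + 1ℤ) (s23 (+ 2 * f + 1ℤ) (+ 2 * e) (+ 2 * g + 1ℤ) (+ 2 * h + 1ℤ) (s12 (+ 2 * e) (+ 2 * f + 1ℤ) (+ 2 * g + 1ℤ) (+ 2 * h + 1ℤ) eq))))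
    sort (even e) (odd f) (odd g) (even h) eq = odds₂ (build 1ℤ 1ℤ 0ℤ 0ℤ f g e h refl refl (ev e) (ev h) (s23 (+ 2 * f + 1ℤ) (+ 2 * e) (+ 2 * g + 1ℤ) (+ 2 * h) (s12 (+ 2 * e) (+ 2 * f + 1ℤ) (+ 2 * g + 1ℤ) (+ 2 * h) eq)))
    sort (even e) (odd f) (even g) (odd h) eq = odds₂ (build 1ℤ 1ℤ 0ℤ 0ℤ f h e g refl refl (ev e) (ev g) (s23 (+ 2 * f + 1ℤ) (+ 2 * e) (+ 2 * h + 1ℤ) (+ 2 * g) (s34 (+ 2 * f + 1ℤ) (+ 2 * e) (+ 2 * g) (+ 2 * h + 1ℤ) (s12 (+ 2 * e) (+ 2 * f + 1ℤ) (+ 2 * g) (+ 2 * h + 1ℤ) eq))))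
    sort (even e) (odd f) (even g) (even h) eq = odds₁ (build 1ℤ 0ℤ 0ℤ 0ℤ f e g h refl (ev e) (ev g) (ev h) (s12 (+ 2 * e) (+ 2 * f + 1ℤ) (+ 2 * g) (+ 2 * h) eq))
    sort (even e) (even f) (odd g) (odd h) eq = odds₂ (build 1ℤ 1ℤ 0ℤ 0ℤ g h e f refl refl (ev e) (ev f) (s23 (+ 2 * g + 1ℤ) (+ 2 * e) (+ 2 * h + 1ℤ) (+ 2 * f) (s12 (+ 2 * e) (+ 2 * g + 1ℤ) (+ 2 * h + 1ℤ) (+ 2 * f) (s34 (+ 2 * e) (+ 2 * g + 1ℤ) (+ 2 * f) (+ 2 * h + 1ℤ) (s23 (+ 2 * e) (+ 2 * f) (+ 2 * g + 1ℤ) (+ 2 * h + 1ℤ) eq)))))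
    sort (even e) (even f) (odd g) (even h) eq = odds₁ (build 1ℤ 0ℤ 0ℤ 0ℤ g e f h refl (ev e) (ev f) (ev h) (s12 (+ 2 * e) (+ 2 * g + 1ℤ) (+ 2 * f) (+ 2 * h) (s23 (+ 2 * e) (+ 2 * f) (+ 2 * g + 1ℤ) (+ 2 * h) eq)))
    sort (even e) (even f) (even g) (odd h) eq = odds₁ (build 1ℤ 0ℤ 0ℤ 0ℤ h e f g refl (ev e) (ev f) (ev g) (s12 (+ 2 * e) (+ 2 * h + 1ℤ) (+ 2 * f) (+ 2 * g) (s23 (+ 2 * e) (+ 2 * f) (+ 2 * h + 1ℤ) (+ 2 * g) (s34 (+ 2 * e) (+ 2 * f) (+ 2 * g) (+ 2 * h + 1ℤ) eq))))
    sort (even e) (even f) (even g) (even h) eq = odds₀ (build 0ℤ 0ℤ 0ℤ 0ℤ e f g h (ev e) (ev f) (ev g) (ev h) eq)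

    sorted : ∀ n → Sorted (+ n)
    sorted n with rep a b c d eq ← four-squares n =
      sort (parity-of a) (parity-of b) (parity-of c) (parity-of d) (trans (e a b c d) eq)
      where
      e : ∀ a b c d → a * a + b * b + c * c + d * d ≡ (a * a + 0ℤ * a * b + b * b) + (c * c + 0ℤ * c * d + d * d)
      e = solve-∀

    -- (2 e + δ)² - δ² = 4 e (e + δ), so only the parities survive modulo 4.
    mod-4 : ∀ {δ₁ δ₂ δ₃ δ₄ S} → Squares δ₁ δ₂ δ₃ δ₄ S → + 4 ∣ S - squares δ₁ δ₂ δ₃ δ₄
    mod-4 {δ₁} {δ₂} {δ₃} {δ₄} (roots e f g h refl) = divides
      (e * (e + δ₁) + f * (f + δ₂) + g * (g + δ₃) + h * (h + δ₄)) (id δ₁ δ₂ δ₃ δ₄ e f g h)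
      where
      id : ∀ p q r s e f g h →
        ((+ 2 * e + p) * (+ 2 * e + p) + (+ 2 * f + q) * (+ 2 * f + q) + (+ 2 * g + r) * (+ 2 * g + r) + (+ 2 * h + s) * (+ 2 * h + s))
        - (p * p + q * q + r * r + s * s) ≡ (e * (e + p) + f * (f + q) + g * (g + r) + h * (h + s)) * + 4
      id = solve-∀

    shift : ∀ s i → + 4 ∣ + (i ℕ.+ 4 ℕ.* s) - + i
    shift s i = divides (+ s) (trans (cong (_- + i) (trans (pos-+ i (4 ℕ.* s)) (cong (λ z → + i + z) (pos-* 4 s)))) (id (+ i) (+ s)))
      where
      id : ∀ i s → i + + 4 * s - i ≡ s * + 4
      id = solve-∀

    const : ∀ S i j → S - i - (S - j) ≡ j - i
    const = solve-∀

  -- A multiple of 4 may also be a sum of four odd squares, so its residue does not fix the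
  -- parities. Doubling the roots of a representation of s makes all of them even.
  four-squares₀ : ∀ s → Squares 0ℤ 0ℤ 0ℤ 0ℤ (+ (4 ℕ.* s))
  four-squares₀ s with rep a b c d eq ← four-squares s =
    roots a b c d (trans (e a b c d) (trans (cong (+ 4 *_) eq) (sym (pos-* 4 s))))
    where
    e : ∀ a b c d → (+ 2 * a + 0ℤ) * (+ 2 * a + 0ℤ) + (+ 2 * b + 0ℤ) * (+ 2 * b + 0ℤ) + (+ 2 * c + 0ℤ) * (+ 2 * c + 0ℤ)
      + (+ 2 * d + 0ℤ) * (+ 2 * d + 0ℤ) ≡ + 4 * ((a * a + 0ℤ * a * b + b * b) + (c * c + 0ℤ * c * d + d * d))
    e = solve-∀

  private
    select₁ : ∀ S → + 4 ∣ S - + 1 → Sorted S → Squares 1ℤ 0ℤ 0ℤ 0ℤ S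
    select₁ S d (odds₀ r) = ∤-const (+ 1 - + 0) (mod-4 r) d (const S (+ 0) (+ 1))
    select₁ S d (odds₁ r) = r
    select₁ S d (odds₂ r) = ∤-const (+ 1 - + 2) (mod-4 r) d (const S (+ 2) (+ 1))
    select₁ S d (odds₃ r) = ∤-const (+ 1 - + 3) (mod-4 r) d (const S (+ 3) (+ 1))
    select₁ S d (odds₄ r) = ∤-const (+ 1 - + 4) (mod-4 r) d (const S (+ 4) (+ 1))

  -- Modulo 4 a sum of squares counts its odd roots, and among the counts from 0 to 4 only one has
  -- the residue 1. The same argument serves for 2 and 3 below.
  four-squares₁ : ∀ s → Squares 1ℤ 0ℤ 0ℤ 0ℤ (+ (1 ℕ.+ 4 ℕ.* s))
  four-squares₁ s = select₁ (+ (1 ℕ.+ 4 ℕ.* s)) (shift s 1) (sorted (1 ℕ.+ 4 ℕ.* s))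

  private
    select₂ : ∀ S → + 4 ∣ S - + 2 → Sorted S → Squares 1ℤ 1ℤ 0ℤ 0ℤ S
    select₂ S d (odds₀ r) = ∤-const (+ 2 - + 0) (mod-4 r) d (const S (+ 0) (+ 2))
    select₂ S d (odds₁ r) = ∤-const (+ 2 - + 1) (mod-4 r) d (const S (+ 1) (+ 2))
    select₂ S d (odds₂ r) = r
    select₂ S d (odds₃ r) = ∤-const (+ 2 - + 3) (mod-4 r) d (const S (+ 3) (+ 2))
    select₂ S d (odds₄ r) = ∤-const (+ 2 - + 4) (mod-4 r) d (const S (+ 4) (+ 2))

  four-squares₂ : ∀ s → Squares 1ℤ 1ℤ 0ℤ 0ℤ (+ (2 ℕ.+ 4 ℕ.* s))
  four-squares₂ s = select₂ (+ (2 ℕ.+ 4 ℕ.* s)) (shift s 2) (sorted (2 ℕ.+ 4 ℕ.* s))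

  private
    select₃ : ∀ S → + 4 ∣ S - + 3 → Sorted S → Squares 1ℤ 1ℤ 1ℤ 0ℤ S
    select₃ S d (odds₀ r) = ∤-const (+ 3 - + 0) (mod-4 r) d (const S (+ 0) (+ 3))
    select₃ S d (odds₁ r) = ∤-const (+ 3 - + 1) (mod-4 r) d (const S (+ 1) (+ 3))
    select₃ S d (odds₂ r) = ∤-const (+ 3 - + 2) (mod-4 r) d (const S (+ 2) (+ 3))
    select₃ S d (odds₃ r) = r
    select₃ S d (odds₄ r) = ∤-const (+ 3 - + 4) (mod-4 r) d (const S (+ 4) (+ 3))

  four-squares₃ : ∀ s → Squares 1ℤ 1ℤ 1ℤ 0ℤ (+ (3 ℕ.+ 4 ℕ.* s))
  four-squares₃ s = select₃ (+ (3 ℕ.+ 4 ℕ.* s)) (shift s 3) (sorted (3 ℕ.+ 4 ℕ.* s))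

-- Four values of a form fill a numerical semigroup

module FourCopies where
  open import Data.Nat.DivMod using (_/_; _%_; m%n<n; m≡m%n+[m/n]*n)
  open import Data.Integer hiding (suc; pred; _/_; _%_)
  open import Data.Integer.Properties
  open import Data.Integer.Tactic.RingSolver using (solve-∀)
  open import Data.Vec using (Vec; []; _∷_; map)
  open QuaternaryNorms using (rep)
  open SumsOfNorms using (four-squares)
  open FormSums

  SumOf-map : ∀ {f g : ℤ → ℤ → ℤ} (M : ℤ × ℤ → ℤ × ℤ) → (∀ x y → f (proj₁ (M (x , y))) (proj₂ (M (x , y))) ≡ g x y) →
    ∀ {m r} → SumOf g m r → SumOf f m r
  SumOf-map {f} {g} M eq (v , refl) = map M v , go v
    where
    go : ∀ {m} (v : Vec (ℤ × ℤ) m) → total f (map M v) ≡ total g v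
    go [] = refl
    go ((x , y) ∷ v) = cong₂ _+_ (eq x y) (go v)

  diagonal-sum : ∀ A C s t → SumOf (form A 0ℤ C) 4 (A * + s + C * + t)
  diagonal-sum A C s t with rep a b c d eq ← four-squares s | rep e f g h eq′ ← four-squares t =
    (a , e) ∷ (b , f) ∷ (c , g) ∷ (d , h) ∷ [] ,
    trans (id A C a b c d e f g h) (cong₂ (λ x y → A * x + C * y) eq eq′)
    where
    id : ∀ A C a b c d e f g h →
      (A * (a * a) + 0ℤ * (a * e) + C * (e * e)) + ((A * (b * b) + 0ℤ * (b * f) + C * (f * f)) +
      ((A * (c * c) + 0ℤ * (c * g) + C * (g * g)) + ((A * (d * d) + 0ℤ * (d * h) + C * (h * h)) + 0ℤ))) ≡
      A * ((a * a + 0ℤ * a * b + b * b) + (c * c + 0ℤ * c * d + d * d)) +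
      C * ((e * e + 0ℤ * e * f + f * f) + (g * g + 0ℤ * g * h + h * h))
    id = solve-∀

  -- 4 (A j² + A j y + C y²) = A (2 j + y)² + (4 C - A) y², so two families of four squares
  -- with the same parities give a representation.
  balanced-sum : ∀ A C {δ₁ δ₂ δ₃ δ₄ S T} → Squares δ₁ δ₂ δ₃ δ₄ S → Squares δ₁ δ₂ δ₃ δ₄ T →
    ∃ λ r → SumOf (form A A C) 4 r × + 4 * r ≡ A * S + (+ 4 * C - A) * T
  balanced-sum A C {p} {q} {r} {s} (roots a b c d refl) (roots e f g h refl) = _ ,
    ((a - e , + 2 * e + p) ∷ (b - f , + 2 * f + q) ∷ (c - g , + 2 * g + r) ∷ (d - h , + 2 * h + s) ∷ [] , refl) ,
    trans (collect (Q a e p) (Q b f q) (Q c g r) (Q d h s))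
      (trans (cong₂ _+_ (cong₂ _+_ (cong₂ _+_ (id A C a e p) (id A C b f q)) (id A C c g r)) (id A C d h s))
        (gather A (+ 4 * C - A) (X a p) (X b q) (X c r) (X d s) (X e p) (X f q) (X g r) (X h s)))
    where
    Q : ℤ → ℤ → ℤ → ℤ
    Q a e p = form A A C (a - e) (+ 2 * e + p)
    X : ℤ → ℤ → ℤ
    X a p = (+ 2 * a + p) * (+ 2 * a + p)
    id : ∀ A C a e p → let j = a - e ; y = + 2 * e + p in
      + 4 * (A * (j * j) + A * (j * y) + C * (y * y)) ≡ A * ((+ 2 * a + p) * (+ 2 * a + p)) + (+ 4 * C - A) * (y * y)
    id = solve-∀
    collect : ∀ x y z w → + 4 * (x + (y + (z + (w + 0ℤ)))) ≡ + 4 * x + + 4 * y + + 4 * z + + 4 * w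
    collect = solve-∀
    gather : ∀ A E a b c d e f g h →
      (A * a + E * e) + (A * b + E * f) + (A * c + E * g) + (A * d + E * h) ≡ A * (a + b + c + d) + E * (e + f + g + h)
    gather = solve-∀

  -- With α = i + 4 q, the choices S = i + 4 (q + β) and T = i + 4 (q + γ) give A S + (4 C - A) T =
  -- 4 (α C + β A + γ (4 C - A)). Both are congruent to i modulo 4, so each can be written with
  -- exactly i odd roots.
  semigroup-sum : ∀ A C α β γ → SumOf (form A A C) 4 (+ α * C + + β * A + + γ * (+ 4 * C - A))
  semigroup-sum A C α β γ = go (α % 4) (m%n<n α 4) (m≡m%n+[m/n]*n α 4)
    where
    q = α / 4
    Goal = SumOf (form A A C) 4 (+ α * C + + β * A + + γ * (+ 4 * C - A))
    cast : ∀ i s β → + (i ℕ.+ 4 ℕ.* (s ℕ.+ β)) ≡ + i + + 4 * (+ s + + β)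
    cast i s β = trans (pos-+ i _) (cong (λ z → + i + z) (trans (pos-* 4 (s ℕ.+ β)) (cong (+ 4 *_) (pos-+ s β))))
    id : ∀ A C i s β γ → A * (i + + 4 * (s + β)) + (+ 4 * C - A) * (i + + 4 * (s + γ)) ≡
      + 4 * ((i + s * + 4) * C + β * A + γ * (+ 4 * C - A))
    id = solve-∀
    finish : ∀ i {δ₁ δ₂ δ₃ δ₄} → (∀ s → Squares δ₁ δ₂ δ₃ δ₄ (+ (i ℕ.+ 4 ℕ.* s))) → α ≡ i ℕ.+ q ℕ.* 4 → Goal
    finish i sq eq with r , sum , 4r ← balanced-sum A C (sq (q ℕ.+ β)) (sq (q ℕ.+ γ)) =
      subst (SumOf (form A A C) 4) (*-cancelˡ-≡ (+ 4) r target (trans 4r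
        (trans (cong₂ (λ S T → A * S + (+ 4 * C - A) * T) (cast i q β) (cast i q γ))
          (trans (id A C (+ i) (+ q) (+ β) (+ γ)) (cong (λ a → + 4 * (a * C + + β * A + + γ * (+ 4 * C - A))) (sym α-cast)))))) sum
      where
      target = + α * C + + β * A + + γ * (+ 4 * C - A)
      α-cast : + α ≡ + i + + q * + 4
      α-cast = trans (cong +_ eq) (trans (pos-+ i _) (cong (λ z → + i + z) (pos-* q 4)))
    go : ∀ i → i ℕ.< 4 → α ≡ i ℕ.+ q ℕ.* 4 → Goal
    go 0 _ = finish 0 four-squares₀
    go 1 _ = finish 1 four-squares₁
    go 2 _ = finish 2 four-squares₂
    go 3 _ = finish 3 four-squares₃
    go (suc (suc (suc (suc _)))) (s≤s (s≤s (s≤s (s≤s ()))))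

-- Three values suffice for d = 15 and d = 6

module ThreeCopies where
  open import Data.Integer hiding (suc; pred)
  open import Data.Integer.Properties
  open import Data.Integer.Divisibility.Signed using (_∣_; divides; _∣?_)
  open import Data.Integer.Tactic.RingSolver using (solve-∀)
  open import Data.Fin using (Fin; zero; suc)
  open import Data.Vec using (Vec; []; _∷_; lookup)
  open import Data.List as List using (List; []; _∷_; cartesianProduct)
  open import Data.List.Relation.Unary.Any using (here; there; satisfied)
  open import Data.List.Relation.Unary.Any.Properties using (map⁻)
  open import Data.List.Relation.Unary.All using (All; []; _∷_)
  open import Relation.Nullary.Decidable using (False; toWitnessFalse)
  open QuaternaryNorms using (N; F; Rep; rep)
  open SumsOfNorms using (eisenstein-norms)
  open Residues
  open FormSums

  module Variables where
    x₀ x₁ x₂ x₃ : Expr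
    x₀ = var zero
    x₁ = var (suc zero)
    x₂ = var (suc (suc zero))
    x₃ = var (suc (suc (suc zero)))
    0# = con 0ℤ
    1# = con 1ℤ
    2# = con (+ 2)

  open Variables

  -- Associates of an Eisenstein integer with coordinates the variables i and j.
  record Associate (i j : Fin 4) : Set where
    constructor associate
    field
      p q : Expr
      same : ∀ ρ → N 1ℤ (⟦ p ⟧ ρ) (⟦ q ⟧ ρ) ≡ N 1ℤ (lookup ρ i) (lookup ρ j)

  -- Reading (i , j) as i + j ζ with a primitive sixth root of unity ζ, the list multiplies by the
  -- six units. This varies the residues of the coordinates at a fixed norm.
  associates : ∀ i j → List (Associate i j)
  associates i j =
      associate (var i) (var j) (λ ρ → refl)
    ∷ associate (var j) (0# :- var i :- var j) (λ ρ → r₁ (lookup ρ i) (lookup ρ j))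
    ∷ associate (0# :- var i :- var j) (var i) (λ ρ → r₂ (lookup ρ i) (lookup ρ j))
    ∷ associate (0# :- var i) (0# :- var j) (λ ρ → r₃ (lookup ρ i) (lookup ρ j))
    ∷ associate (0# :- var j) (var i :+ var j) (λ ρ → r₄ (lookup ρ i) (lookup ρ j))
    ∷ associate (var i :+ var j) (0# :- var i) (λ ρ → r₅ (lookup ρ i) (lookup ρ j))
    ∷ []
    where
    r₁ : ∀ a b → b * b + 1ℤ * b * (0ℤ - a - b) + (0ℤ - a - b) * (0ℤ - a - b) ≡ a * a + 1ℤ * a * b + b * b
    r₁ = solve-∀
    r₂ : ∀ a b → (0ℤ - a - b) * (0ℤ - a - b) + 1ℤ * (0ℤ - a - b) * a + a * a ≡ a * a + 1ℤ * a * b + b * b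
    r₂ = solve-∀
    r₃ : ∀ a b → (0ℤ - a) * (0ℤ - a) + 1ℤ * (0ℤ - a) * (0ℤ - b) + (0ℤ - b) * (0ℤ - b) ≡ a * a + 1ℤ * a * b + b * b
    r₃ = solve-∀
    r₄ : ∀ a b → (0ℤ - b) * (0ℤ - b) + 1ℤ * (0ℤ - b) * (a + b) + (a + b) * (a + b) ≡ a * a + 1ℤ * a * b + b * b
    r₄ = solve-∀
    r₅ : ∀ a b → (a + b) * (a + b) + 1ℤ * (a + b) * (0ℤ - a) + (0ℤ - a) * (0ℤ - a) ≡ a * a + 1ℤ * a * b + b * b
    r₅ = solve-∀

  AssociatePair : Set
  AssociatePair = Associate zero (suc zero) × Associate (suc (suc zero)) (suc (suc (suc zero)))

  pairs : List AssociatePair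
  pairs = cartesianProduct (associates zero (suc zero)) (associates (suc (suc zero)) (suc (suc (suc zero))))

  norms : Expr
  norms = x₀ :* x₀ :+ x₀ :* x₁ :+ x₁ :* x₁ :+ (x₂ :* x₂ :+ x₂ :* x₃ :+ x₃ :* x₃)

  ⟦norms⟧ : ∀ a b c d → ⟦ norms ⟧ (a ∷ b ∷ c ∷ d ∷ []) ≡ F 1ℤ a b c d
  ⟦norms⟧ = e
    where
    e : ∀ a b c d → a * a + a * b + b * b + (c * c + c * d + d * d) ≡ (a * a + 1ℤ * a * b + b * b) + (c * c + 1ℤ * c * d + d * d)
    e = solve-∀

  -- Every n is a sum of two Eisenstein norms; unless n is congruent to one of two residues k, l
  -- modulo m, the summands have associates satisfying the given divisibilities.
  module Search (m : ℕ) .{{_ : ℕ.NonZero m}} (k l : ℤ) (cond : AssociatePair → List Expr) where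
    search-space : List (List Expr)
    search-space = (norms :- con k ∷ []) ∷ (norms :- con l ∷ []) ∷ List.map cond pairs

    Found : ℤ → Set
    Found n = ∃₂ λ (pr : AssociatePair) ρ →
      let associate p q _ , associate p′ q′ _ = pr in
      F 1ℤ (⟦ p ⟧ ρ) (⟦ q ⟧ ρ) (⟦ p′ ⟧ ρ) (⟦ q′ ⟧ ρ) ≡ n × All (λ e → + m ∣ ⟦ e ⟧ ρ) (cond pr)

    search : (∀ ρ → Holds m search-space ρ) → ∀ n → (+ m ∣ + n - k) ⊎ (+ m ∣ + n - l) ⊎ Found (+ n)
    search sound n = from (eisenstein-norms n)
      where
      module _ (a b c d : ℤ) (eq : F 1ℤ a b c d ≡ + n) where
        ρ : Vec ℤ 4
        ρ = a ∷ b ∷ c ∷ d ∷ []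
        value : ⟦ norms ⟧ ρ ≡ + n
        value = trans (⟦norms⟧ a b c d) eq
        found : (∃ λ pr → All (λ e → + m ∣ ⟦ e ⟧ ρ) (cond pr)) → Found (+ n)
        found (pr , divs) = pr , ρ , trans (cong₂ _+_ (Associate.same (proj₁ pr) ρ) (Associate.same (proj₂ pr) ρ)) eq , divs
        go : Holds m search-space ρ → (+ m ∣ + n - k) ⊎ (+ m ∣ + n - l) ⊎ Found (+ n)
        go (here (d ∷ [])) = inj₁ (subst (λ z → + m ∣ z - k) value d)
        go (there (here (d ∷ []))) = inj₂ (inj₁ (subst (λ z → + m ∣ z - l) value d))
        go (there (there any)) = inj₂ (inj₂ (found (satisfied (map⁻ {f = cond} {xs = pairs} any))))
      from : Rep 1ℤ (+ n) → (+ m ∣ + n - k) ⊎ (+ m ∣ + n - l) ⊎ Found (+ n)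
      from (rep a b c d eq) = go a b c d eq (sound (a ∷ b ∷ c ∷ d ∷ []))

  module Exclusion where
    absurd : ∀ m k → + m ∣ k → {False (+ m ∣? k)} → ∀ {A : Set} → A
    absurd m k p {f} = contradiction p (toWitnessFalse f)

    -- Here j is a value of the form taken off from a number in the bad class k; the rest n cannot
    -- fall into the bad class i, for then m would divide j - k + i.
    clash : ∀ j k i {m} n → + m ∣ + (j ℕ.+ n) - k → + m ∣ + n - i → {False (+ m ∣? (+ j - k + i))} → ∀ {A : Set} → A
    clash j k i n p q {f} = ∤-const (+ j - k + i) p q (trans (cong (λ z → z - k - (+ n - i)) (pos-+ j n)) (e (+ j) (+ n) k i)) {f}
      where
      e : ∀ j n k i → j + n - k - (n - i) ≡ j - k + i
      e = solve-∀

    solve-residue : ∀ q q′ m → q′ + + 2 * q ≡ m * + 5 → q′ ≡ + 5 * m - + 2 * q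
    solve-residue q q′ m eq = trans (e q q′) (cong (_- + 2 * q) (trans eq (*-comm m (+ 5))))
      where
      e : ∀ q q′ → q′ ≡ q′ + + 2 * q - + 2 * q
      e = solve-∀

  open Exclusion

  module Disc15 where
    -- If w + 2 y = 5 m, then y² + w² = 5 (m² + (2 m - y)²), with the same parities on both sides;
    -- this turns 3 (y² + w²) into 15 times (and, for the other form, a sum of two squares into 5 times)
    -- a sum of two squares.
    principal-condition other-condition : AssociatePair → List Expr
    principal-condition (associate p q _ , associate p′ q′ _) = q′ :+ 2# :* q ∷ []
    other-condition (associate p q _ , associate p′ q′ _) = (2# :* p′ :+ q′) :+ 2# :* (2# :* p :+ q) ∷ []

    module Principal = Search 5 (+ 2) (+ 3) principal-condition
    module Other = Search 5 (+ 1) (+ 4) other-condition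

    opaque
      principal : ∀ ρ → Holds 5 Principal.search-space ρ
      principal = by-residues 5 Principal.search-space _
      other : ∀ ρ → Holds 5 Other.search-space ρ
      other = by-residues 5 Other.search-space _

    -- In 4 (x² + x y + 4 y²) = (2 x + y)² + 15 y² the witnesses make the linear parts 2 a + b and 2
    -- c + w, as in four times the Eisenstein norms of (a , b) and (c , w), while 3 (b² + w²) = 15
    -- ((2 m - b)² + m²).
    principal-two : ∀ {n} → Principal.Found n → SumOf (form 1ℤ 1ℤ (+ 4)) 2 n
    principal-two {n} ((associate p q _ , associate p′ q′ _) , ρ , eq , divides m dvd ∷ []) =
      (a + b - m , + 2 * m - b) ∷ (c + + 2 * m - b , m) ∷ [] ,
      trans (id a b c m) (trans (cong (λ z → F 1ℤ a b c z) (sym (solve-residue b (⟦ q′ ⟧ ρ) m dvd))) eq)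
      where
      a = ⟦ p ⟧ ρ
      b = ⟦ q ⟧ ρ
      c = ⟦ p′ ⟧ ρ
      id : ∀ a b c m → let x = a + b - m ; y = + 2 * m - b ; z = c + + 2 * m - b ; w = + 5 * m - + 2 * b in
        1ℤ * (x * x) + 1ℤ * (x * y) + + 4 * (y * y) + (1ℤ * (z * z) + 1ℤ * (z * m) + + 4 * (m * m) + 0ℤ) ≡
        (a * a + 1ℤ * a * b + b * b) + (c * c + 1ℤ * c * w + w * w)
      id = solve-∀

    -- Now 4 (2 x² + 3 x y + 3 y²) = 3 (x + 2 y)² + 5 x². The terms 3 b² and 3 d² of the Eisenstein
    -- norms are kept, and the squares of 2 a + b and 2 c + d turn into 5 times a sum of two
    -- squares.
    other-two : ∀ {n} → Other.Found n → SumOf (form (+ 2) (+ 3) (+ 3)) 2 n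
    other-two {n} ((associate p q _ , associate p′ q′ _) , ρ , eq , divides m dvd ∷ []) =
      (+ 2 * m - + 2 * a - b , a + b - m) ∷ (m , + 2 * m - + 2 * a - b - c) ∷ [] ,
      trans (id a b c m) (trans (cong (λ z → F 1ℤ a b c z) (sym d≡)) eq)
      where
      a = ⟦ p ⟧ ρ
      b = ⟦ q ⟧ ρ
      c = ⟦ p′ ⟧ ρ
      d = ⟦ q′ ⟧ ρ
      id : ∀ a b c m → let x = + 2 * m - + 2 * a - b ; y = a + b - m ; z = m ; w = + 2 * m - + 2 * a - b - c
                           d = + 5 * m - + 2 * (+ 2 * a + b) - + 2 * c in
        + 2 * (x * x) + + 3 * (x * y) + + 3 * (y * y) + (+ 2 * (z * z) + + 3 * (z * w) + + 3 * (w * w) + 0ℤ) ≡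
        (a * a + 1ℤ * a * b + b * b) + (c * c + 1ℤ * c * d + d * d)
      id = solve-∀
      e : ∀ c d → d ≡ + 2 * c + d - + 2 * c
      e = solve-∀
      d≡ : d ≡ + 5 * m - + 2 * (+ 2 * a + b) - + 2 * c
      d≡ = trans (e c d) (cong (_- + 2 * c) (solve-residue (+ 2 * a + b) (+ 2 * c + d) m dvd))

    -- The residues 2 and 3 modulo 5 escape the search; taking off the values 1 and 4 moves them to
    -- the good residues 1 and 4. Only 3 is too small for this, and it is 1 + 1 + 1.
    principal-sum : ∀ n → SumOf (form 1ℤ 1ℤ (+ 4)) 3 (+ n)
    principal-sum n = [ shift₁ n , [ shift₄ n , (λ found → pad {1ℤ} {1ℤ} {+ 4} (principal-two found)) ]′ ]′ (Principal.search principal n)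
      where
      shift₁ : ∀ n → + 5 ∣ + n - + 2 → SumOf (form 1ℤ 1ℤ (+ 4)) 3 (+ n)
      shift₁ 0 d = absurd 5 (+ 0 - + 2) d
      shift₁ (suc n) d =
        [ (λ d′ → clash 1 (+ 2) (+ 2) n d d′)
        , [ (λ d′ → clash 1 (+ 2) (+ 3) n d d′)
          , (λ found → prepend {f = form 1ℤ 1ℤ (+ 4)} 1ℤ 0ℤ refl (principal-two found)) ]′ ]′ (Principal.search principal n)
      shift₄ : ∀ n → + 5 ∣ + n - + 3 → SumOf (form 1ℤ 1ℤ (+ 4)) 3 (+ n)
      shift₄ 0 d = absurd 5 (+ 0 - + 3) d
      shift₄ 1 d = absurd 5 (+ 1 - + 3) d
      shift₄ 2 d = absurd 5 (+ 2 - + 3) d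
      shift₄ 3 d = (1ℤ , 0ℤ) ∷ (1ℤ , 0ℤ) ∷ (1ℤ , 0ℤ) ∷ [] , refl
      shift₄ (suc (suc (suc (suc n)))) d =
        [ (λ d′ → clash 4 (+ 3) (+ 2) n d d′)
        , [ (λ d′ → clash 4 (+ 3) (+ 3) n d d′)
          , (λ found → prepend {f = form 1ℤ 1ℤ (+ 4)} (+ 2) 0ℤ refl (principal-two found)) ]′ ]′ (Principal.search principal n)

    -- The bad residues 1 and 4 modulo 5 are moved to 3 and 2 by the values 3 and 2 of the form. The
    -- bound keeps out 1, which lies in a bad class and is below both values.
    other-sum : ∀ n → 2 ℕ.≤ n → SumOf (form (+ 2) (+ 3) (+ 3)) 3 (+ n)
    other-sum n 2≤n = [ shift₃ n 2≤n , [ shift₂ n 2≤n , (λ found → pad {+ 2} {+ 3} {+ 3} (other-two found)) ]′ ]′ (Other.search other n)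
      where
      shift₂ : ∀ n → 2 ℕ.≤ n → + 5 ∣ + n - + 4 → SumOf (form (+ 2) (+ 3) (+ 3)) 3 (+ n)
      shift₂ 1 (s≤s ()) _
      shift₂ (suc (suc n)) _ d =
        [ (λ d′ → clash 2 (+ 4) (+ 1) n d d′)
        , [ (λ d′ → clash 2 (+ 4) (+ 4) n d d′)
          , (λ found → prepend {f = form (+ 2) (+ 3) (+ 3)} 1ℤ 0ℤ refl (other-two found)) ]′ ]′ (Other.search other n)
      shift₃ : ∀ n → 2 ℕ.≤ n → + 5 ∣ + n - + 1 → SumOf (form (+ 2) (+ 3) (+ 3)) 3 (+ n)
      shift₃ 1 (s≤s ()) _
      shift₃ 2 _ d = absurd 5 (+ 2 - + 1) d
      shift₃ (suc (suc (suc n))) _ d =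
        [ (λ d′ → clash 3 (+ 1) (+ 1) n d d′)
        , [ (λ d′ → clash 3 (+ 1) (+ 4) n d d′)
          , (λ found → prepend {f = form (+ 2) (+ 3) (+ 3)} 0ℤ 1ℤ refl (other-two found)) ]′ ]′ (Other.search other n)

  module Disc24 where
    -- An even coordinate q = 2 y turns p² + p q + q² into (p + y)² + 3 y²; the last divisibility makes
    -- two of the resulting squares add up to twice a sum of two squares.
    principal-condition other-condition : AssociatePair → List Expr
    principal-condition (associate p q _ , associate p′ q′ _) = 2# :* q ∷ 2# :* q′ ∷ q′ :- q ∷ []
    other-condition (associate p q _ , associate p′ q′ _) =
      2# :* q ∷ 2# :* q′ ∷ (2# :* p′ :+ q′) :- (2# :* p :+ q) ∷ []

    module Principal = Search 4 (+ 0) (+ 3) principal-condition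
    module Other = Search 4 (+ 0) (+ 1) other-condition

    opaque
      principal : ∀ ρ → Holds 4 Principal.search-space ρ
      principal = by-residues 4 Principal.search-space _
      other : ∀ ρ → Holds 4 Other.search-space ρ
      other = by-residues 4 Other.search-space _

    private
      halve : ∀ x k → + 2 * x ≡ k * + 4 → x ≡ + 2 * k
      halve x k eq = *-cancelˡ-≡ (+ 2) x (+ 2 * k) (trans eq (e k))
        where
        e : ∀ k → k * + 4 ≡ + 2 * (+ 2 * k)
        e = solve-∀
      add-back : ∀ x y m → y - x ≡ m * + 4 → y ≡ x + + 4 * m
      add-back x y m eq = trans (e x y) (cong (λ z → x + z) (trans eq (*-comm m (+ 4))))
        where
        e : ∀ x y → y ≡ x + (y - x)
        e = solve-∀

    -- The second coordinates are 2 y and 2 (y + 2 m), and 3 (y² + (y + 2 m)²) = 6 ((y + m)² + m²).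
    principal-two : ∀ {n} → Principal.Found n → SumOf (form 1ℤ 0ℤ (+ 6)) 2 n
    principal-two {n} ((associate p q _ , associate p′ q′ _) , ρ , eq , divides y dvd ∷ _ ∷ divides m dvd′ ∷ []) =
      (a + y , y + m) ∷ (c + y + + 2 * m , m) ∷ [] ,
      trans (id a c y m) (trans (cong₂ (λ z w → F 1ℤ a z c w) (sym q≡) (sym (trans (add-back (⟦ q ⟧ ρ) (⟦ q′ ⟧ ρ) m dvd′) (cong (_+ + 4 * m) q≡)))) eq)
      where
      a = ⟦ p ⟧ ρ
      c = ⟦ p′ ⟧ ρ
      q≡ : ⟦ q ⟧ ρ ≡ + 2 * y
      q≡ = halve (⟦ q ⟧ ρ) y dvd
      id : ∀ a c y m → let x = a + y ; z = c + y + + 2 * m ; b = + 2 * y ; d = + 2 * y + + 4 * m in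
        1ℤ * (x * x) + 0ℤ * (x * (y + m)) + + 6 * ((y + m) * (y + m)) + (1ℤ * (z * z) + 0ℤ * (z * m) + + 6 * (m * m) + 0ℤ) ≡
        (a * a + 1ℤ * a * b + b * b) + (c * c + 1ℤ * c * d + d * d)
      id = solve-∀

    -- Here the other two squares combine: c + w = a + y + 2 m, so (a + y)² + (c + w)² = 2 ((a + y +
    -- m)² + m²), while 3 y² + 3 w² is kept.
    other-two : ∀ {n} → Other.Found n → SumOf (form (+ 2) 0ℤ (+ 3)) 2 n
    other-two {n} ((associate p q _ , associate p′ q′ _) , ρ , eq , divides y dvd ∷ divides w dvd″ ∷ divides m dvd′ ∷ []) =
      (a + y + m , y) ∷ (m , w) ∷ [] ,
      trans (id a y w m) (trans (cong (λ z → F 1ℤ a (+ 2 * y) z (+ 2 * w)) (sym c≡))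
        (trans (cong₂ (λ z w → F 1ℤ a z c w) (sym q≡) (sym q′≡)) eq))
      where
      a = ⟦ p ⟧ ρ
      c = ⟦ p′ ⟧ ρ
      q≡ : ⟦ q ⟧ ρ ≡ + 2 * y
      q≡ = halve (⟦ q ⟧ ρ) y dvd
      q′≡ : ⟦ q′ ⟧ ρ ≡ + 2 * w
      q′≡ = halve (⟦ q′ ⟧ ρ) w dvd″
      e : ∀ a c y w → + 2 * c + + 2 * w - (+ 2 * a + + 2 * y) ≡ + 2 * (c - (a + y - w))
      e = solve-∀
      f : ∀ c t → c ≡ c - t + t
      f = solve-∀
      g : ∀ m a y w → + 2 * m + (a + y - w) ≡ a + y + + 2 * m - w
      g = solve-∀
      c≡ : c ≡ a + y + + 2 * m - w
      c≡ = trans (f c (a + y - w)) (trans (cong (_+ (a + y - w)) (halve (c - (a + y - w)) m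
        (trans (sym (e a c y w)) (trans (cong₂ (λ u v → + 2 * c + u - (+ 2 * a + v)) (sym q′≡) (sym q≡)) dvd′)))) (g m a y w))
      id : ∀ a y w m → let x = a + y + m ; b = + 2 * y ; c = a + y + + 2 * m - w ; d = + 2 * w in
        + 2 * (x * x) + 0ℤ * (x * y) + + 3 * (y * y) + (+ 2 * (m * m) + 0ℤ * (m * w) + + 3 * (w * w) + 0ℤ) ≡
        (a * a + 1ℤ * a * b + b * b) + (c * c + 1ℤ * c * d + d * d)
      id = solve-∀

    -- Taking off 6 or 1 moves the bad residues 0 and 3 modulo 4 to 2; the multiples 0 and 4, being
    -- below 6, are written down directly.
    principal-sum : ∀ n → SumOf (form 1ℤ 0ℤ (+ 6)) 3 (+ n)
    principal-sum n = [ shift₆ n , [ shift₁ n , (λ found → pad {1ℤ} {0ℤ} {+ 6} (principal-two found)) ]′ ]′ (Principal.search principal n)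
      where
      shift₁ : ∀ n → + 4 ∣ + n - + 3 → SumOf (form 1ℤ 0ℤ (+ 6)) 3 (+ n)
      shift₁ 0 d = absurd 4 (+ 0 - + 3) d
      shift₁ (suc n) d =
        [ (λ d′ → clash 1 (+ 3) (+ 0) n d d′)
        , [ (λ d′ → clash 1 (+ 3) (+ 3) n d d′)
          , (λ found → prepend {f = form 1ℤ 0ℤ (+ 6)} 1ℤ 0ℤ refl (principal-two found)) ]′ ]′ (Principal.search principal n)
      shift₆ : ∀ n → + 4 ∣ + n - + 0 → SumOf (form 1ℤ 0ℤ (+ 6)) 3 (+ n)
      shift₆ 0 d = (0ℤ , 0ℤ) ∷ (0ℤ , 0ℤ) ∷ (0ℤ , 0ℤ) ∷ [] , refl
      shift₆ 1 d = absurd 4 (+ 1 - + 0) d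
      shift₆ 2 d = absurd 4 (+ 2 - + 0) d
      shift₆ 3 d = absurd 4 (+ 3 - + 0) d
      shift₆ 4 d = (+ 2 , 0ℤ) ∷ (0ℤ , 0ℤ) ∷ (0ℤ , 0ℤ) ∷ [] , refl
      shift₆ 5 d = absurd 4 (+ 5 - + 0) d
      shift₆ (suc (suc (suc (suc (suc (suc n)))))) d =
        [ (λ d′ → clash 6 (+ 0) (+ 0) n d d′)
        , [ (λ d′ → clash 6 (+ 0) (+ 3) n d d′)
          , (λ found → prepend {f = form 1ℤ 0ℤ (+ 6)} 0ℤ 1ℤ refl (principal-two found)) ]′ ]′ (Principal.search principal n)

    -- Taking off 2 or 3 moves the bad residues 0 and 1 modulo 4 to 2.
    other-sum : ∀ n → 2 ℕ.≤ n → SumOf (form (+ 2) 0ℤ (+ 3)) 3 (+ n)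
    other-sum n 2≤n = [ shift₂ n 2≤n , [ shift₃ n 2≤n , (λ found → pad {+ 2} {0ℤ} {+ 3} (other-two found)) ]′ ]′ (Other.search other n)
      where
      shift₂ : ∀ n → 2 ℕ.≤ n → + 4 ∣ + n - + 0 → SumOf (form (+ 2) 0ℤ (+ 3)) 3 (+ n)
      shift₂ 1 (s≤s ()) _
      shift₂ (suc (suc n)) _ d =
        [ (λ d′ → clash 2 (+ 0) (+ 0) n d d′)
        , [ (λ d′ → clash 2 (+ 0) (+ 1) n d d′)
          , (λ found → prepend {f = form (+ 2) 0ℤ (+ 3)} 1ℤ 0ℤ refl (other-two found)) ]′ ]′ (Other.search other n)
      shift₃ : ∀ n → 2 ℕ.≤ n → + 4 ∣ + n - + 1 → SumOf (form (+ 2) 0ℤ (+ 3)) 3 (+ n)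
      shift₃ 1 (s≤s ()) _
      shift₃ 2 _ d = absurd 4 (+ 2 - + 1) d
      shift₃ (suc (suc (suc n))) _ d =
        [ (λ d′ → clash 3 (+ 1) (+ 0) n d d′)
        , [ (λ d′ → clash 3 (+ 1) (+ 1) n d d′)
          , (λ found → prepend {f = form (+ 2) 0ℤ (+ 3)} 0ℤ 1ℤ refl (other-two found)) ]′ ]′ (Other.search other n)

-- Three values suffice for d = 5

module Disc20 where
  open import Data.Nat.Tactic.RingSolver using () renaming (solve-∀ to ℕ-solve)
  open import Relation.Nullary.Decidable using (False)
  open import Data.Integer hiding (suc; pred)
  open import Data.Integer.Properties
  open import Data.Integer.Divisibility.Signed using (_∣_; divides; _∣?_)
  open import Data.Integer.Tactic.RingSolver using (solve-∀)
  open import Data.Fin using (zero; suc)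
  open import Data.Vec using (Vec; []; _∷_)
  open import Data.List as List using (List; []; _∷_; _++_)
  open import Data.List.Relation.Unary.Any using (here; there; satisfied)
  open import Data.List.Relation.Unary.Any.Properties using (map⁻; ++⁻)
  open import Data.List.Relation.Unary.All using (All; []; _∷_)
  open QuaternaryNorms using (Rep; rep; parity)
  open SumsOfNorms using (four-squares)
  open Residues
  open FormSums
  open ThreeCopies

  open Variables
  open Exclusion

  module Principal where
    record Rearrangement : Set where
      constructor rearranged
      field
        a b c d : Expr
        same : ∀ ρ → squares (⟦ a ⟧ ρ) (⟦ b ⟧ ρ) (⟦ c ⟧ ρ) (⟦ d ⟧ ρ) ≡ squares (⟦ x₀ ⟧ ρ) (⟦ x₁ ⟧ ρ) (⟦ x₂ ⟧ ρ) (⟦ x₃ ⟧ ρ)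

    negated : Rearrangement → Rearrangement
    negated (rearranged a b c d same) = rearranged a (0# :- b) c d
      (λ ρ → trans (e (⟦ a ⟧ ρ) (⟦ b ⟧ ρ) (⟦ c ⟧ ρ) (⟦ d ⟧ ρ)) (same ρ))
      where
      e : ∀ a b c d → a * a + (0ℤ - b) * (0ℤ - b) + c * c + d * d ≡ a * a + b * b + c * c + d * d
      e = solve-∀

    first-two : List Rearrangement
    first-two = rearranged x₀ x₁ x₂ x₃ (λ ρ → refl)
      ∷ rearranged x₀ x₂ x₁ x₃ (λ { (a ∷ b ∷ c ∷ d ∷ []) → e₁ a b c d })
      ∷ rearranged x₀ x₃ x₁ x₂ (λ { (a ∷ b ∷ c ∷ d ∷ []) → e₂ a b c d })
      ∷ rearranged x₁ x₂ x₀ x₃ (λ { (a ∷ b ∷ c ∷ d ∷ []) → e₃ a b c d })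
      ∷ rearranged x₁ x₃ x₀ x₂ (λ { (a ∷ b ∷ c ∷ d ∷ []) → e₄ a b c d })
      ∷ rearranged x₂ x₃ x₀ x₁ (λ { (a ∷ b ∷ c ∷ d ∷ []) → e₅ a b c d })
      ∷ []
      where
      e₁ : ∀ a b c d → a * a + c * c + b * b + d * d ≡ a * a + b * b + c * c + d * d
      e₁ = solve-∀
      e₂ : ∀ a b c d → a * a + d * d + b * b + c * c ≡ a * a + b * b + c * c + d * d
      e₂ = solve-∀
      e₃ : ∀ a b c d → b * b + c * c + a * a + d * d ≡ a * a + b * b + c * c + d * d
      e₃ = solve-∀
      e₄ : ∀ a b c d → b * b + d * d + a * a + c * c ≡ a * a + b * b + c * c + d * d
      e₄ = solve-∀
      e₅ : ∀ a b c d → c * c + d * d + a * a + b * b ≡ a * a + b * b + c * c + d * d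
      e₅ = solve-∀

    -- `first-two` lists unordered pairs: exchanging the two entries turns b ≡ - 2 a into b ≡ 2 a
    -- modulo 5, which is the negated choice.
    choices : List Rearrangement
    choices = first-two ++ List.map negated first-two

    singles : List Rearrangement
    singles = rearranged x₀ x₁ x₂ x₃ (λ ρ → refl)
      ∷ rearranged x₁ x₀ x₂ x₃ (λ { (a ∷ b ∷ c ∷ d ∷ []) → e₁ a b c d })
      ∷ rearranged x₂ x₀ x₁ x₃ (λ { (a ∷ b ∷ c ∷ d ∷ []) → e₂ a b c d })
      ∷ rearranged x₃ x₀ x₁ x₂ (λ { (a ∷ b ∷ c ∷ d ∷ []) → e₃ a b c d })
      ∷ []
      where
      e₁ : ∀ a b c d → b * b + a * a + c * c + d * d ≡ a * a + b * b + c * c + d * d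
      e₁ = solve-∀
      e₂ : ∀ a b c d → c * c + a * a + b * b + d * d ≡ a * a + b * b + c * c + d * d
      e₂ = solve-∀
      e₃ : ∀ a b c d → d * d + a * a + b * b + c * c ≡ a * a + b * b + c * c + d * d
      e₃ = solve-∀

    sum-expr : Expr
    sum-expr = x₀ :* x₀ :+ x₁ :* x₁ :+ x₂ :* x₂ :+ x₃ :* x₃

    pair-condition single-condition : Rearrangement → List Expr
    pair-condition r = b :+ 2# :* a ∷ []
      where
      open Rearrangement r
    single-condition r = Rearrangement.a r ∷ []

    excluded : ℤ → List Expr
    excluded k = sum-expr :- con k ∷ []

    pairs-space all-space : List (List Expr)
    pairs-space = excluded (+ 1) ∷ excluded (+ 2) ∷ excluded (+ 3) ∷ excluded (+ 4) ∷ List.map pair-condition choices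
    all-space = excluded (+ 1) ∷ excluded (+ 4) ∷ (List.map pair-condition choices ++ List.map single-condition singles)

    opaque
      pairs-sound : ∀ ρ → Holds 5 pairs-space ρ
      pairs-sound = by-residues 5 pairs-space _
      all-sound : ∀ ρ → Holds 5 all-space ρ
      all-sound = by-residues 5 all-space _

    module _ {n : ℤ} (a b c d : ℤ) (eq : squares a b c d ≡ n) where
      private
        ρ : Vec ℤ 4
        ρ = a ∷ b ∷ c ∷ d ∷ []

      -- If the second entry is 5 m - 2 x, its square and x² add up to 5 (m² + (2 m - x)²); the two
      -- remaining squares are the first terms of two copies.
      from-pair : (∃ λ r → All (λ e → + 5 ∣ ⟦ e ⟧ ρ) (pair-condition r)) → SumOf (form 1ℤ 0ℤ (+ 5)) 2 n
      from-pair (r@(rearranged p q s t same) , divides m dvd ∷ []) =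
        (z , m) ∷ (w , + 2 * m - x) ∷ [] ,
        trans (id x z w m) (trans (cong (λ y → squares x y z w) (sym (solve-residue x (⟦ q ⟧ ρ) m dvd))) (trans (same ρ) eq))
        where
        x = ⟦ p ⟧ ρ
        z = ⟦ s ⟧ ρ
        w = ⟦ t ⟧ ρ
        id : ∀ x z w m → let y = + 2 * m - x ; q = + 5 * m - + 2 * x in
          1ℤ * (z * z) + 0ℤ * (z * m) + + 5 * (m * m) + (1ℤ * (w * w) + 0ℤ * (w * y) + + 5 * (y * y) + 0ℤ) ≡
          x * x + q * q + z * z + w * w
        id = solve-∀

      -- 25 m² = 5 (m² + (2 m)²) spreads over two copies, and the three remaining squares are the
      -- first terms of three.
      from-single : (∃ λ r → All (λ e → + 5 ∣ ⟦ e ⟧ ρ) (single-condition r)) → SumOf (form 1ℤ 0ℤ (+ 5)) 3 n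
      from-single (r@(rearranged p q s t same) , divides m dvd ∷ []) =
        (y , m) ∷ (z , + 2 * m) ∷ (w , 0ℤ) ∷ [] ,
        trans (id y z w m) (trans (cong (λ x → squares x y z w) (sym dvd)) (trans (same ρ) eq))
        where
        y = ⟦ q ⟧ ρ
        z = ⟦ s ⟧ ρ
        w = ⟦ t ⟧ ρ
        id : ∀ y z w m →
          1ℤ * (y * y) + 0ℤ * (y * m) + + 5 * (m * m) + (1ℤ * (z * z) + 0ℤ * (z * (+ 2 * m)) + + 5 * (+ 2 * m * (+ 2 * m))
            + (1ℤ * (w * w) + 0ℤ * (w * 0ℤ) + + 5 * (0ℤ * 0ℤ) + 0ℤ)) ≡
          m * + 5 * (m * + 5) + y * y + z * z + w * w
        id = solve-∀

      excluded⁻ : ∀ k → + 5 ∣ ⟦ sum-expr :- con k ⟧ ρ → + 5 ∣ n - k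
      excluded⁻ k = subst (λ z → + 5 ∣ z - k) eq

      by-pairs : + 5 ∣ n - 0ℤ → Holds 5 pairs-space ρ → SumOf (form 1ℤ 0ℤ (+ 5)) 2 n
      by-pairs d₀ (here (d ∷ [])) = ∤-const (+ 1) d₀ (excluded⁻ (+ 1) d) (e n)
        where
        e : ∀ n → n - 0ℤ - (n - + 1) ≡ + 1
        e = solve-∀
      by-pairs d₀ (there (here (d ∷ []))) = ∤-const (+ 2) d₀ (excluded⁻ (+ 2) d) (e n)
        where
        e : ∀ n → n - 0ℤ - (n - + 2) ≡ + 2
        e = solve-∀
      by-pairs d₀ (there (there (here (d ∷ [])))) = ∤-const (+ 3) d₀ (excluded⁻ (+ 3) d) (e n)
        where
        e : ∀ n → n - 0ℤ - (n - + 3) ≡ + 3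
        e = solve-∀
      by-pairs d₀ (there (there (there (here (d ∷ []))))) = ∤-const (+ 4) d₀ (excluded⁻ (+ 4) d) (e n)
        where
        e : ∀ n → n - 0ℤ - (n - + 4) ≡ + 4
        e = solve-∀
      by-pairs _ (there (there (there (there any)))) = from-pair (satisfied (map⁻ {f = pair-condition} {xs = choices} any))

      by-all : Holds 5 all-space ρ → (+ 5 ∣ n - + 1) ⊎ (+ 5 ∣ n - + 4) ⊎ SumOf (form 1ℤ 0ℤ (+ 5)) 3 n
      by-all (here (d ∷ [])) = inj₁ (excluded⁻ (+ 1) d)
      by-all (there (here (d ∷ []))) = inj₂ (inj₁ (excluded⁻ (+ 4) d))
      by-all (there (there any)) = inj₂ (inj₂ ([
          (λ p → pad {1ℤ} {0ℤ} {+ 5} (from-pair (satisfied (map⁻ {f = pair-condition} {xs = choices} p))))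
        , (λ s → from-single (satisfied (map⁻ {f = single-condition} {xs = singles} s))) ]′
        (++⁻ (List.map pair-condition choices) any)))

    private
      as-squares : ∀ {n} → Rep 0ℤ n → ∃ λ a → ∃ λ b → ∃ λ c → ∃ λ d → squares a b c d ≡ n
      as-squares (rep a b c d eq) = a , b , c , d , trans (e a b c d) eq
        where
        e : ∀ a b c d → a * a + b * b + c * c + d * d ≡ (a * a + 0ℤ * a * b + b * b) + (c * c + 0ℤ * c * d + d * d)
        e = solve-∀

    pair-sum : ∀ n → + 5 ∣ + n - 0ℤ → SumOf (form 1ℤ 0ℤ (+ 5)) 2 (+ n)
    pair-sum n d₀ = let a , b , c , d , eq = as-squares (four-squares n) in
      by-pairs a b c d eq d₀ (pairs-sound (a ∷ b ∷ c ∷ d ∷ []))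

    -- The residues 1 and 4 modulo 5 become 0 after taking off the value 1 or 4, and multiples of 5
    -- are already sums of two values.
    principal-sum : ∀ n → SumOf (form 1ℤ 0ℤ (+ 5)) 3 (+ n)
    principal-sum n = let a , b , c , d , eq = as-squares (four-squares n) in
      [ shift₁ n , [ shift₄ n , (λ s → s) ]′ ]′ (by-all a b c d eq (all-sound (a ∷ b ∷ c ∷ d ∷ [])))
      where
      move : ∀ j n → + 5 ∣ + (j ℕ.+ n) - + j → + 5 ∣ + n - 0ℤ
      move j n = subst (+ 5 ∣_) (trans (cong (_- + j) (pos-+ j n)) (e (+ j) (+ n)))
        where
        e : ∀ j n → j + n - j ≡ n - 0ℤ
        e = solve-∀
      shift₁ : ∀ n → + 5 ∣ + n - + 1 → SumOf (form 1ℤ 0ℤ (+ 5)) 3 (+ n)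
      shift₁ 0 d = absurd 5 (+ 0 - + 1) d
      shift₁ (suc n) d = prepend {f = form 1ℤ 0ℤ (+ 5)} 1ℤ 0ℤ refl (pair-sum n (move 1 n d))
      shift₄ : ∀ n → + 5 ∣ + n - + 4 → SumOf (form 1ℤ 0ℤ (+ 5)) 3 (+ n)
      shift₄ 0 d = absurd 5 (+ 0 - + 4) d
      shift₄ 1 d = absurd 5 (+ 1 - + 4) d
      shift₄ 2 d = absurd 5 (+ 2 - + 4) d
      shift₄ 3 d = absurd 5 (+ 3 - + 4) d
      shift₄ (suc (suc (suc (suc n)))) d = prepend {f = form 1ℤ 0ℤ (+ 5)} (+ 2) 0ℤ refl (pair-sum n (move 4 n d))

  module Other where
    -- If R + 2 P = 5 m, then P² + R² = 5 (m² + (2 m - P)²), where the parities match those of the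
    -- remaining squares (R + 2 l)² and (P + 2 κ)².
    record Arrangement : Set where
      constructor arranged
      field
        P R κ l : Expr
        same : ∀ ρ → let p = ⟦ P ⟧ ρ ; r = ⟦ R ⟧ ρ ; k = ⟦ κ ⟧ ρ ; j = ⟦ l ⟧ ρ ; a = ⟦ x₀ ⟧ ρ ; b = ⟦ x₁ ⟧ ρ ; c = ⟦ x₂ ⟧ ρ ; d = ⟦ x₃ ⟧ ρ in
          squares p r (p + + 2 * k) (r + + 2 * j) ≡ squares (+ 2 * a + 1ℤ) (+ 2 * b + 1ℤ) (+ 2 * c + 0ℤ) (+ 2 * d + 0ℤ)

    swap₁ swap₂ negate : Arrangement → Arrangement
    swap₁ (arranged P R κ l same) = arranged (P :+ 2# :* κ) R (0# :- κ) l
      (λ ρ → trans (e (⟦ P ⟧ ρ) (⟦ R ⟧ ρ) (⟦ κ ⟧ ρ) (⟦ l ⟧ ρ)) (same ρ))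
      where
      e : ∀ p r k j → (p + + 2 * k) * (p + + 2 * k) + r * r + (p + + 2 * k + + 2 * (0ℤ - k)) * (p + + 2 * k + + 2 * (0ℤ - k)) + (r + + 2 * j) * (r + + 2 * j)
        ≡ p * p + r * r + (p + + 2 * k) * (p + + 2 * k) + (r + + 2 * j) * (r + + 2 * j)
      e = solve-∀
    swap₂ (arranged P R κ l same) = arranged P (R :+ 2# :* l) κ (0# :- l)
      (λ ρ → trans (e (⟦ P ⟧ ρ) (⟦ R ⟧ ρ) (⟦ κ ⟧ ρ) (⟦ l ⟧ ρ)) (same ρ))
      where
      e : ∀ p r k j → p * p + (r + + 2 * j) * (r + + 2 * j) + (p + + 2 * k) * (p + + 2 * k) + (r + + 2 * j + + 2 * (0ℤ - j)) * (r + + 2 * j + + 2 * (0ℤ - j))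
        ≡ p * p + r * r + (p + + 2 * k) * (p + + 2 * k) + (r + + 2 * j) * (r + + 2 * j)
      e = solve-∀
    negate (arranged P R κ l same) = arranged P (0# :- R) κ (0# :- l)
      (λ ρ → trans (e (⟦ P ⟧ ρ) (⟦ R ⟧ ρ) (⟦ κ ⟧ ρ) (⟦ l ⟧ ρ)) (same ρ))
      where
      e : ∀ p r k j → p * p + (0ℤ - r) * (0ℤ - r) + (p + + 2 * k) * (p + + 2 * k) + (0ℤ - r + + 2 * (0ℤ - j)) * (0ℤ - r + + 2 * (0ℤ - j))
        ≡ p * p + r * r + (p + + 2 * k) * (p + + 2 * k) + (r + + 2 * j) * (r + + 2 * j)
      e = solve-∀

    variants : (Arrangement → Arrangement) → List Arrangement → List Arrangement
    variants f as = as ++ List.map f as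

    -- The second and third arrangement are the half-sum reflection x ↦ s - x with 2s = Σx,
    -- the third after changing the sign of the first root.
    arrangements : List Arrangement
    arrangements = variants negate (variants swap₂ (variants swap₁
      ( arranged (2# :* x₀ :+ 1#) (2# :* x₂ :+ 0#) (x₁ :- x₀) (x₃ :- x₂) (λ { (a ∷ b ∷ c ∷ d ∷ []) → e₁ a b c d })
      ∷ arranged (x₁ :+ x₂ :+ x₃ :- x₀) (x₀ :+ x₁ :+ 1# :+ x₃ :- x₂) (x₀ :- x₁) (x₂ :- x₃) (λ { (a ∷ b ∷ c ∷ d ∷ []) → e₂ a b c d })
      ∷ arranged (x₁ :+ x₂ :+ x₃ :+ x₀ :+ 1#) (x₁ :+ x₃ :- x₀ :- x₂) (0# :- x₀ :- 1# :- x₁) (x₂ :- x₃) (λ { (a ∷ b ∷ c ∷ d ∷ []) → e₃ a b c d })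
      ∷ [])))
      where
      e₁ : ∀ a b c d → let p = + 2 * a + 1ℤ ; r = + 2 * c + 0ℤ ; k = b - a ; j = d - c in
        p * p + r * r + (p + + 2 * k) * (p + + 2 * k) + (r + + 2 * j) * (r + + 2 * j) ≡
        (+ 2 * a + 1ℤ) * (+ 2 * a + 1ℤ) + (+ 2 * b + 1ℤ) * (+ 2 * b + 1ℤ) + (+ 2 * c + 0ℤ) * (+ 2 * c + 0ℤ) + (+ 2 * d + 0ℤ) * (+ 2 * d + 0ℤ)
      e₁ = solve-∀
      e₂ : ∀ a b c d → let p = b + c + d - a ; r = a + b + 1ℤ + d - c ; k = a - b ; j = c - d in
        p * p + r * r + (p + + 2 * k) * (p + + 2 * k) + (r + + 2 * j) * (r + + 2 * j) ≡
        (+ 2 * a + 1ℤ) * (+ 2 * a + 1ℤ) + (+ 2 * b + 1ℤ) * (+ 2 * b + 1ℤ) + (+ 2 * c + 0ℤ) * (+ 2 * c + 0ℤ) + (+ 2 * d + 0ℤ) * (+ 2 * d + 0ℤ)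
      e₂ = solve-∀
      e₃ : ∀ a b c d → let p = b + c + d + a + 1ℤ ; r = b + d - a - c ; k = 0ℤ - a - 1ℤ - b ; j = c - d in
        p * p + r * r + (p + + 2 * k) * (p + + 2 * k) + (r + + 2 * j) * (r + + 2 * j) ≡
        (+ 2 * a + 1ℤ) * (+ 2 * a + 1ℤ) + (+ 2 * b + 1ℤ) * (+ 2 * b + 1ℤ) + (+ 2 * c + 0ℤ) * (+ 2 * c + 0ℤ) + (+ 2 * d + 0ℤ) * (+ 2 * d + 0ℤ)
      e₃ = solve-∀

    double : Expr
    double = (2# :* x₀ :+ 1#) :* (2# :* x₀ :+ 1#) :+ (2# :* x₁ :+ 1#) :* (2# :* x₁ :+ 1#)
      :+ (2# :* x₂ :+ 0#) :* (2# :* x₂ :+ 0#) :+ (2# :* x₃ :+ 0#) :* (2# :* x₃ :+ 0#)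

    condition : Arrangement → List Expr
    condition r = R :+ 2# :* P ∷ []
      where
      open Arrangement r

    space : List (List Expr)
    space = (double :- con (+ 2) ∷ []) ∷ (double :- con (+ 3) ∷ []) ∷ List.map condition arrangements

    opaque
      sound : ∀ ρ → Holds 5 space ρ
      sound = by-residues 5 space _

    module _ {n : ℤ} (a b c d : ℤ) (eq : squares (+ 2 * a + 1ℤ) (+ 2 * b + 1ℤ) (+ 2 * c + 0ℤ) (+ 2 * d + 0ℤ) ≡ + 2 * n) where
      private
        ρ : Vec ℤ 4
        ρ = a ∷ b ∷ c ∷ d ∷ []

      -- 2 (2 x² + 2 x y + 3 y²) = (2 x + y)² + 5 y². The values 2 m - p and m of y absorb p² + r²,
      -- and since they have the parities of p and r, the equations 2 x + y = p + 2 k and 2 x + y =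
      -- r + 2 j have integral solutions x.
      from-arrangement : (∃ λ r → All (λ e → + 5 ∣ ⟦ e ⟧ ρ) (condition r)) → SumOf (form (+ 2) (+ 2) (+ 3)) 2 n
      from-arrangement (arranged P R κ l same , divides m dvd ∷ []) =
        (p + k - m , + 2 * m - p) ∷ (+ 2 * m - p + j , m) ∷ [] ,
        *-cancelˡ-≡ (+ 2) (total (form (+ 2) (+ 2) (+ 3)) ((p + k - m , + 2 * m - p) ∷ (+ 2 * m - p + j , m) ∷ [])) n (trans (id p k j m)
          (trans (cong (λ r → squares p r (p + + 2 * k) (r + + 2 * j)) (sym (solve-residue p (⟦ R ⟧ ρ) m dvd))) (trans (same ρ) eq)))
        where
        p = ⟦ P ⟧ ρ
        k = ⟦ κ ⟧ ρ
        j = ⟦ l ⟧ ρ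
        id : ∀ p k j m → let x = p + k - m ; y = + 2 * m - p ; z = + 2 * m - p + j ; r = + 5 * m - + 2 * p in
          + 2 * (+ 2 * (x * x) + + 2 * (x * y) + + 3 * (y * y) + (+ 2 * (z * z) + + 2 * (z * m) + + 3 * (m * m) + 0ℤ)) ≡
          p * p + r * r + (p + + 2 * k) * (p + + 2 * k) + (r + + 2 * j) * (r + + 2 * j)
        id = solve-∀

      by-search : Holds 5 space ρ → (+ 5 ∣ + 2 * n - + 2) ⊎ (+ 5 ∣ + 2 * n - + 3) ⊎ SumOf (form (+ 2) (+ 2) (+ 3)) 2 n
      by-search (here (d ∷ [])) = inj₁ (subst (λ z → + 5 ∣ z - + 2) eq d)
      by-search (there (here (d ∷ []))) = inj₂ (inj₁ (subst (λ z → + 5 ∣ z - + 3) eq d))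
      by-search (there (there any)) = inj₂ (inj₂ (from-arrangement (satisfied (map⁻ {f = condition} {xs = arrangements} any))))

    odd-number : ℕ → ℤ
    odd-number h = + (1 ℕ.+ 2 ℕ.* h)

    search : ∀ h → (+ 5 ∣ + 2 * odd-number h - + 2) ⊎ (+ 5 ∣ + 2 * odd-number h - + 3) ⊎ SumOf (form (+ 2) (+ 2) (+ 3)) 2 (odd-number h)
    search h = from (four-squares₂ h)
      where
      twice : + (2 ℕ.+ 4 ℕ.* h) ≡ + 2 * odd-number h
      twice = trans (cong +_ (e h)) (pos-* 2 (1 ℕ.+ 2 ℕ.* h))
        where
        e : ∀ h → 2 ℕ.+ 4 ℕ.* h ≡ 2 ℕ.* (1 ℕ.+ 2 ℕ.* h)
        e = ℕ-solve
      from : Squares 1ℤ 1ℤ 0ℤ 0ℤ (+ (2 ℕ.+ 4 ℕ.* h)) → (+ 5 ∣ + 2 * odd-number h - + 2) ⊎ (+ 5 ∣ + 2 * odd-number h - + 3) ⊎ SumOf (form (+ 2) (+ 2) (+ 3)) 2 (odd-number h)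
      from (roots a b c d eq) = by-search {odd-number h} a b c d (trans eq twice) (sound (a ∷ b ∷ c ∷ d ∷ []))

    odd-number-cast : ∀ h → odd-number h ≡ 1ℤ + + 2 * + h
    odd-number-cast h = cong (λ z → 1ℤ + z) (pos-* 2 h)

    shift-clash : ∀ j k i h → + 5 ∣ + 2 * odd-number (j ℕ.+ h) - k → + 5 ∣ + 2 * odd-number h - i →
      {False (+ 5 ∣? (+ 4 * + j - k + i))} → ∀ {A : Set} → A
    shift-clash j k i h p q {f} = ∤-const (+ 4 * + j - k + i) p q
      (trans (cong₂ (λ x y → + 2 * x - k - (+ 2 * y - i)) (trans (odd-number-cast (j ℕ.+ h)) (cong (λ z → 1ℤ + + 2 * z) (pos-+ j h))) (odd-number-cast h))
        (e (+ j) k i (+ h))) {f}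
      where
      e : ∀ j k i h → + 2 * (1ℤ + + 2 * (j + h)) - k - (+ 2 * (1ℤ + + 2 * h) - i) ≡ + 4 * j - k + i
      e = solve-∀

    -- For odd n the bad residues of 2 n modulo 5 are 2 and 3. Taking off an even value keeps n odd:
    -- the value 2 moves 2 n from 3 to 4, but would move it from 2 to 3, so there the value 8 is
    -- used, which leads to 1.
    odd-sum : ∀ h → 0 ℕ.< h → SumOf (form (+ 2) (+ 2) (+ 3)) 3 (odd-number h)
    odd-sum h 0<h = [ shift₈ h 0<h , [ shift₂ h 0<h , (λ s → pad {+ 2} {+ 2} {+ 3} s) ]′ ]′ (search h)
      where
      Goal : ℕ → Set
      Goal h = SumOf (form (+ 2) (+ 2) (+ 3)) 3 (odd-number h)
      shift₂ : ∀ h → 0 ℕ.< h → + 5 ∣ + 2 * odd-number h - + 3 → Goal h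
      shift₂ (suc h) _ d =
        [ (λ d′ → shift-clash 1 (+ 3) (+ 2) h d d′)
        , [ (λ d′ → shift-clash 1 (+ 3) (+ 3) h d d′)
          , (λ s → subst (SumOf (form (+ 2) (+ 2) (+ 3)) 3) (sum-eq h) (prepend {f = form (+ 2) (+ 2) (+ 3)} 1ℤ 0ℤ refl s)) ]′ ]′ (search h)
        where
        sum-eq : ∀ h → + 2 + odd-number h ≡ odd-number (suc h)
        sum-eq h = cong (λ z → + z) (e h)
          where
          e : ∀ h → 2 ℕ.+ (1 ℕ.+ 2 ℕ.* h) ≡ 1 ℕ.+ 2 ℕ.* (1 ℕ.+ h)
          e = ℕ-solve
      shift₈ : ∀ h → 0 ℕ.< h → + 5 ∣ + 2 * odd-number h - + 2 → Goal h
      shift₈ 1 _ d = absurd 5 (+ 2 * odd-number 1 - + 2) d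
      shift₈ 2 _ d = absurd 5 (+ 2 * odd-number 2 - + 2) d
      shift₈ 3 _ d = absurd 5 (+ 2 * odd-number 3 - + 2) d
      shift₈ (suc (suc (suc (suc h)))) _ d =
        [ (λ d′ → shift-clash 4 (+ 2) (+ 2) h d d′)
        , [ (λ d′ → shift-clash 4 (+ 2) (+ 3) h d d′)
          , (λ s → subst (SumOf (form (+ 2) (+ 2) (+ 3)) 3) (sum-eq h) (prepend {f = form (+ 2) (+ 2) (+ 3)} (+ 2) 0ℤ refl s)) ]′ ]′ (search h)
        where
        sum-eq : ∀ h → + 8 + odd-number h ≡ odd-number (4 ℕ.+ h)
        sum-eq h = cong (λ z → + z) (e h)
          where
          e : ∀ h → 8 ℕ.+ (1 ℕ.+ 2 ℕ.* h) ≡ 1 ℕ.+ 2 ℕ.* (4 ℕ.+ h)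
          e = ℕ-solve

    -- The other form takes the value 2 (x² + 5 y²) at (x - y , 2 y), so even numbers reduce to the
    -- principal form.
    even-sum : ∀ h → SumOf (form (+ 2) (+ 2) (+ 3)) 3 (+ (2 ℕ.* h))
    even-sum h = subst (SumOf (form (+ 2) (+ 2) (+ 3)) 3) (sym (pos-* 2 h)) (double-sum (Principal.principal-sum h))
      where
      e : ∀ x y → + 2 * ((x - y) * (x - y)) + + 2 * ((x - y) * (+ 2 * y)) + + 3 * (+ 2 * y * (+ 2 * y)) ≡
        + 2 * (1ℤ * (x * x) + 0ℤ * (x * y) + + 5 * (y * y))
      e = solve-∀
      double-sum : ∀ {m r} → SumOf (form 1ℤ 0ℤ (+ 5)) m r → SumOf (form (+ 2) (+ 2) (+ 3)) m (+ 2 * r)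
      double-sum ([] , refl) = [] , refl
      double-sum ((x , y) ∷ v , refl) = subst (SumOf (form (+ 2) (+ 2) (+ 3)) _)
        (sym (*-distribˡ-+ (+ 2) (form 1ℤ 0ℤ (+ 5) x y) (total (form 1ℤ 0ℤ (+ 5)) v)))
        (prepend {f = form (+ 2) (+ 2) (+ 3)} (x - y) (+ 2 * y) (e x y) (double-sum (v , refl)))

    other-sum : ∀ n → 2 ℕ.≤ n → SumOf (form (+ 2) (+ 2) (+ 3)) 3 (+ n)
    other-sum n 2≤n with parity n
    ... | h , inj₁ e = subst (λ z → SumOf (form (+ 2) (+ 2) (+ 3)) 3 (+ z)) (sym e) (even-sum h)
    ... | zero , inj₂ refl with s≤s () ← 2≤n
    ... | suc h , inj₂ e = subst (λ z → SumOf (form (+ 2) (+ 2) (+ 3)) 3 (+ z)) (sym e) (odd-sum (suc h) (s≤s z≤n))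

-- The two norm forms in each case, and R_d as a numerical semigroup

module CaseForms where
  open import Data.Bool using (Bool; true; false; _∧_; _∨_; not; T)
  open import Data.Bool.ListAction using (all; any)
  open import Data.Bool.Properties using (T-∧; T-∨)
  open import Data.Nat using (_≤ᵇ_; _≡ᵇ_)
  open import Data.Nat.Induction using (<-rec)
  open import Data.Integer hiding (suc; pred; _≤ᵇ_)
  open import Data.Integer.Properties
  open import Data.Integer.Tactic.RingSolver using (solve-∀)
  open import Data.Nat.Tactic.RingSolver using () renaming (solve-∀ to ℕ-solve)
  open import Data.Unit using (tt)
  open import Data.Vec using (Vec; []; _∷_)
  open import Data.List using (List; []; _∷_)
  open import Data.List.Relation.Unary.Any using (here; there)
  open import Data.List.Membership.Propositional using (_∈_)
  open import Function.Bundles using (Equivalence)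
  open Integers
  open QuaternaryNorms using (rep)
  open SumsOfNorms using (four-squares)
  open Residues using (below; below-sound)
  open FormSums
  open FourCopies

  cases : List Case
  cases = c5 ∷ c6 ∷ c10 ∷ c13 ∷ c15 ∷ c22 ∷ c35 ∷ c37 ∷ c51 ∷ c58 ∷ c91 ∷ c115 ∷ c123 ∷ c187 ∷ c235 ∷ c267 ∷ c403 ∷ c427 ∷ []

  private
    position : ∀ c → c ∈ cases
    position c5 = here refl
    position c6 = there (here refl)
    position c10 = there (there (here refl))
    position c13 = there (there (there (here refl)))
    position c15 = there (there (there (there (here refl))))
    position c22 = there (there (there (there (there (here refl)))))
    position c35 = there (there (there (there (there (there (here refl))))))
    position c37 = there (there (there (there (there (there (there (here refl)))))))
    position c51 = there (there (there (there (there (there (there (there (here refl))))))))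
    position c58 = there (there (there (there (there (there (there (there (there (here refl)))))))))
    position c91 = there (there (there (there (there (there (there (there (there (there (here refl))))))))))
    position c115 = there (there (there (there (there (there (there (there (there (there (there (here refl)))))))))))
    position c123 = there (there (there (there (there (there (there (there (there (there (there (there (here refl))))))))))))
    position c187 = there (there (there (there (there (there (there (there (there (there (there (there (there (here refl)))))))))))))
    position c235 = there (there (there (there (there (there (there (there (there (there (there (there (there (there (here refl))))))))))))))
    position c267 = there (there (there (there (there (there (there (there (there (there (there (there (there (there (there (here refl)))))))))))))))
    position c403 = there (there (there (there (there (there (there (there (there (there (there (there (there (there (there (there (here refl))))))))))))))))
    position c427 = there (there (there (there (there (there (there (there (there (there (there (there (there (there (there (there (there (here refl)))))))))))))))))

  every-case : (P : Case → Bool) → T (all P cases) → ∀ c → T (P c)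
  every-case P t c = go cases t (position c)
    where
    go : ∀ cs → T (all P cs) → c ∈ cs → T (P c)
    go (c ∷ cs) t (here refl) = proj₁ (Equivalence.to (T-∧ {P c}) t)
    go (c ∷ cs) t (there i) = go cs (proj₂ (Equivalence.to (T-∧ {P c}) t)) i

  -- ω² = t ω - n
  tℤ nℤ : Case → ℤ
  tℤ c5 = + 0
  tℤ c6 = + 0
  tℤ c10 = + 0
  tℤ c13 = + 0
  tℤ c15 = + 1
  tℤ c22 = + 0
  tℤ c35 = + 1
  tℤ c37 = + 0
  tℤ c51 = + 1
  tℤ c58 = + 0
  tℤ c91 = + 1
  tℤ c115 = + 1
  tℤ c123 = + 1
  tℤ c187 = + 1
  tℤ c235 = + 1
  tℤ c267 = + 1
  tℤ c403 = + 1
  tℤ c427 = + 1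
  nℤ c5 = + 5
  nℤ c6 = + 6
  nℤ c10 = + 10
  nℤ c13 = + 13
  nℤ c15 = + 4
  nℤ c22 = + 22
  nℤ c35 = + 9
  nℤ c37 = + 37
  nℤ c51 = + 13
  nℤ c58 = + 58
  nℤ c91 = + 23
  nℤ c115 = + 29
  nℤ c123 = + 31
  nℤ c187 = + 47
  nℤ c235 = + 59
  nℤ c267 = + 67
  nℤ c403 = + 101
  nℤ c427 = + 107

  -- N(β) / k for β = βa + ω
  cofactor : Case → ℤ
  cofactor c5 = + 3
  cofactor c6 = + 3
  cofactor c10 = + 5
  cofactor c13 = + 7
  cofactor c15 = + 3
  cofactor c22 = + 11
  cofactor c35 = + 3
  cofactor c37 = + 19
  cofactor c51 = + 3
  cofactor c58 = + 29
  cofactor c91 = + 5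
  cofactor c115 = + 7
  cofactor c123 = + 11
  cofactor c187 = + 7
  cofactor c235 = + 13
  cofactor c267 = + 23
  cofactor c403 = + 13
  cofactor c427 = + 17

  principal other : Case → ℤ → ℤ → ℤ
  principal c = form 1ℤ (tℤ c) (nℤ c)
  other c = form (+ kOf c) (+ 2 * βa c + tℤ c) (cofactor c)

  -- The form other c is equivalent to A j² + B j y + C y² with B = A or B = 0. Its values generate
  -- the semigroup spanned by C, A and E, where E = 4 C - A if B = A, and E = A if B = 0.
  genA genC genE : Case → ℕ
  genA c5 = 2
  genA c6 = 2
  genA c10 = 2
  genA c13 = 2
  genA c15 = 3
  genA c22 = 2
  genA c35 = 5
  genA c37 = 2
  genA c51 = 3
  genA c58 = 2
  genA c91 = 7
  genA c115 = 5
  genA c123 = 3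
  genA c187 = 11
  genA c235 = 5
  genA c267 = 3
  genA c403 = 13
  genA c427 = 7
  genC c5 = 3
  genC c6 = 3
  genC c10 = 5
  genC c13 = 7
  genC c15 = 2
  genC c22 = 11
  genC c35 = 3
  genC c37 = 19
  genC c51 = 5
  genC c58 = 29
  genC c91 = 5
  genC c115 = 7
  genC c123 = 11
  genC c187 = 7
  genC c235 = 13
  genC c267 = 23
  genC c403 = 11
  genC c427 = 17
  genE c5 = 10
  genE c6 = 2
  genE c10 = 2
  genE c13 = 26
  genE c15 = 5
  genE c22 = 2
  genE c35 = 7
  genE c37 = 74
  genE c51 = 17
  genE c58 = 2
  genE c91 = 13
  genE c115 = 23
  genE c123 = 41
  genE c187 = 17
  genE c235 = 47
  genE c267 = 89
  genE c403 = 31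
  genE c427 = 61

  InSemigroup : Case → ℕ → Set
  InSemigroup c r = ∃ λ a → ∃₂ λ b e → r ≡ a ℕ.* genC c ℕ.+ b ℕ.* genA c ℕ.+ e ℕ.* genE c

  private
    diagonal-values : ∀ A C x y → ∃₂ λ a b → form (+ A) 0ℤ (+ C) x y ≡ + (a ℕ.* C ℕ.+ b ℕ.* A ℕ.+ 0 ℕ.* A)
    diagonal-values A C x y with 0≤⇒+ (0≤n² x) | 0≤⇒+ (0≤n² y)
    ... | b , ex | a , ey = a , b , trans (e (+ A) (+ C) x y) (trans (cong₂ (λ u v → u * + C + v * + A) ey ex) (sym cast))
      where
      e : ∀ A C x y → A * (x * x) + 0ℤ * (x * y) + C * (y * y) ≡ y * y * C + x * x * A
      e = solve-∀
      cast : + (a ℕ.* C ℕ.+ b ℕ.* A ℕ.+ 0 ℕ.* A) ≡ + a * + C + + b * + A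
      cast = trans (cong +_ (ℕ.+-identityʳ (a ℕ.* C ℕ.+ b ℕ.* A))) (trans (pos-+ (a ℕ.* C) (b ℕ.* A)) (cong₂ _+_ (pos-* a C) (pos-* b A)))

    combination : ∀ a b e C A E → + (a ℕ.* C ℕ.+ b ℕ.* A ℕ.+ e ℕ.* E) ≡ + a * + C + + b * + A + + e * + E
    combination a b e C A E = trans (pos-+ (a ℕ.* C ℕ.+ b ℕ.* A) (e ℕ.* E))
      (cong₂ _+_ (trans (pos-+ (a ℕ.* C) (b ℕ.* A)) (cong₂ _+_ (pos-* a C) (pos-* b A))) (pos-* e E))

    -- With X = 2 x + y, the form is C y² + A p if p = (X² - y²) / 4 ≥ 0, and C X² - E p otherwise.
    balanced-values : ∀ A C E → + E ≡ + 4 * + C - + A → ∀ x y →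
      ∃ λ a → ∃₂ λ b e → form (+ A) (+ A) (+ C) x y ≡ + (a ℕ.* C ℕ.+ b ℕ.* A ℕ.+ e ℕ.* E)
    balanced-values A C E eE x y = go (x * (x + y)) refl
      where
      go : ∀ p → x * (x + y) ≡ p → ∃ λ a → ∃₂ λ b e → form (+ A) (+ A) (+ C) x y ≡ + (a ℕ.* C ℕ.+ b ℕ.* A ℕ.+ e ℕ.* E)
      go (+ b) ep = let a , ea = 0≤⇒+ (0≤n² y) in a , b , 0 ,
        trans (i (+ A) (+ C) x y (+ E)) (trans (cong₂ (λ u v → u * + C + v * + A + 0ℤ * + E) ea ep) (sym (combination a b 0 C A E)))
        where
        i : ∀ A C x y E → A * (x * x) + A * (x * y) + C * (y * y) ≡ y * y * C + x * (x + y) * A + 0ℤ * E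
        i = solve-∀
      go p@(-[1+ k ]) ep = let a , ea = 0≤⇒+ (0≤n² (+ 2 * x + y)) in a , 0 , suc k ,
        trans (i (+ A) (+ C) x y) (trans (cong₂ (λ u v → u * + C + 0ℤ * + A + v * (+ 4 * + C - + A)) ea (cong (-_) ep))
          (trans (cong (λ w → + a * + C + 0ℤ * + A + + suc k * w) (sym eE)) (sym (combination a 0 (suc k) C A E))))
        where
        i : ∀ A C x y → A * (x * x) + A * (x * y) + C * (y * y) ≡ (+ 2 * x + y) * (+ 2 * x + y) * C + 0ℤ * A + (- (x * (x + y))) * (+ 4 * C - A)
        i = solve-∀

    swap : ∀ a b c x y → form a b c y x ≡ form c b a x y
    swap = e
      where
      e : ∀ a b c x y → a * (y * y) + b * (y * x) + c * (x * x) ≡ c * (x * x) + b * (x * y) + a * (y * y)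
      e = solve-∀
    reflect : ∀ a b c x y → form a b c x (- y) ≡ form a (- b) c x y
    reflect = e
      where
      e : ∀ a b c x y → a * (x * x) + b * (x * - y) + c * (- y * - y) ≡ a * (x * x) + - b * (x * y) + c * (y * y)
      e = solve-∀
    -- For d = 187 the form with coefficients 7, - 3, 7 takes the value 11 at (1 , 1); with this
    -- vector as a basis vector it acquires the balanced coefficients 11, 11, 7.
    shear : ∀ x y → form (+ 7) (- + 3) (+ 7) (y + x) x ≡ form (+ 11) (+ 11) (+ 7) x y
    shear = e
      where
      e : ∀ x y → + 7 * ((y + x) * (y + x)) + - + 3 * ((y + x) * x) + + 7 * (x * x) ≡ + 11 * (x * x) + + 11 * (x * y) + + 7 * (y * y)
      e = solve-∀
    unshear : ∀ x y → form (+ 7) (- + 3) (+ 7) x y ≡ form (+ 11) (+ 11) (+ 7) y (x - y)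
    unshear = e
      where
      e : ∀ x y → + 7 * (x * x) + - + 3 * (x * y) + + 7 * (y * y) ≡ + 11 * (y * y) + + 11 * (y * (x - y)) + + 7 * ((x - y) * (x - y))
      e = solve-∀

    lift : ∀ {c z w} → ∃₂ (λ a b → z ≡ + (a ℕ.* genC c ℕ.+ b ℕ.* genA c ℕ.+ 0 ℕ.* genE c)) → w ≡ z → ∃ λ r → InSemigroup c r × w ≡ + r
    lift (a , b , e) e′ = _ , (a , b , 0 , refl) , trans e′ e
    lift′ : ∀ {c z w} → (∃ λ a → ∃₂ λ b e → z ≡ + (a ℕ.* genC c ℕ.+ b ℕ.* genA c ℕ.+ e ℕ.* genE c)) → w ≡ z → ∃ λ r → InSemigroup c r × w ≡ + r
    lift′ (a , b , e , eq) e′ = _ , (a , b , e , refl) , trans e′ eq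

  other-values : ∀ c x y → ∃ λ r → InSemigroup c r × other c x y ≡ + r
  other-values c5 x y = lift′ {c5} (balanced-values 2 3 10 refl x y) refl
  other-values c6 x y = lift {c6} (diagonal-values 2 3 x y) refl
  other-values c10 x y = lift {c10} (diagonal-values 2 5 x y) refl
  other-values c13 x y = lift′ {c13} (balanced-values 2 7 26 refl x y) refl
  other-values c15 x y = lift′ {c15} (balanced-values 3 2 5 refl y x) (sym (swap (+ 3) (+ 3) (+ 2) x y))
  other-values c22 x y = lift {c22} (diagonal-values 2 11 x y) refl
  other-values c35 x y = lift′ {c35} (balanced-values 5 3 7 refl x y) refl
  other-values c37 x y = lift′ {c37} (balanced-values 2 19 74 refl x y) refl
  other-values c51 x y = lift′ {c51} (balanced-values 3 5 17 refl y x) (sym (swap (+ 3) (+ 3) (+ 5) x y))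
  other-values c58 x y = lift {c58} (diagonal-values 2 29 x y) refl
  other-values c91 x y = lift′ {c91} (balanced-values 7 5 13 refl x y) refl
  other-values c115 x y = lift′ {c115} (balanced-values 5 7 23 refl x (- y)) (sym (reflect (+ 5) (+ 5) (+ 7) x y))
  other-values c123 x y = lift′ {c123} (balanced-values 3 11 41 refl x y) refl
  other-values c187 x y = lift′ {c187} (balanced-values 11 7 17 refl y (x - y)) (unshear x y)
  other-values c235 x y = lift′ {c235} (balanced-values 5 13 47 refl x y) refl
  other-values c267 x y = lift′ {c267} (balanced-values 3 23 89 refl x y) refl
  other-values c403 x y = lift′ {c403} (balanced-values 13 11 31 refl y x) (sym (swap (+ 13) (+ 13) (+ 11) x y))
  other-values c427 x y = lift′ {c427} (balanced-values 7 17 61 refl x y) refl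

  elemᵇ : ℕ → List ℕ → Bool
  elemᵇ r = any (r ≡ᵇ_)

  -- `memberᵇ` adjoins 0, the neutral element of the semigroup, which R_d omits.
  inRᵇ memberᵇ : Case → ℕ → Bool
  inRᵇ c r = (lowerOf c ≤ᵇ r) ∧ not (elemᵇ r (exclOf c))
  memberᵇ c r = (r ≡ᵇ 0) ∨ inRᵇ c r

  private
    T-not : ∀ {b} → (T b → T false) → T (not b)
    T-not {true} f = f tt
    T-not {false} f = tt

    not-T : ∀ {b} → T (not b) → ¬ T b
    not-T {false} _ ()

    ∈⇒elemᵇ : ∀ {r xs} → r ∈ xs → T (elemᵇ r xs)
    ∈⇒elemᵇ {r} (here refl) = Equivalence.from (T-∨ {r ≡ᵇ r}) (inj₁ (ℕ.≡⇒≡ᵇ r r refl))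
    ∈⇒elemᵇ {r} {x ∷ xs} (there i) = Equivalence.from (T-∨ {r ≡ᵇ x}) (inj₂ (∈⇒elemᵇ i))

    elemᵇ⇒∈ : ∀ {r} xs → T (elemᵇ r xs) → r ∈ xs
    elemᵇ⇒∈ {r} (x ∷ xs) t = [ (λ e → here (ℕ.≡ᵇ⇒≡ r x e)) , (λ t → there (elemᵇ⇒∈ xs t)) ]′ (Equivalence.to (T-∨ {r ≡ᵇ x}) t)

    elemᵇ-bound : ∀ B {r} xs → T (all (_≤ᵇ B) xs) → B ℕ.< r → ¬ T (elemᵇ r xs)
    elemᵇ-bound B {r} (x ∷ xs) t B<r = λ u → [ (λ e → contradiction (ℕ.≤ᵇ⇒≤ x B (proj₁ split)) (ℕ.<⇒≱ (subst (B ℕ.<_) (ℕ.≡ᵇ⇒≡ r x e) B<r)))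
        , elemᵇ-bound B xs (proj₂ split) B<r ]′ (Equivalence.to (T-∨ {r ≡ᵇ x}) u)
      where
      split = Equivalence.to (T-∧ {x ≤ᵇ B}) t

  inRᵇ⇒InR : ∀ c r → T (inRᵇ c r) → InR c r
  inRᵇ⇒InR c r t = ℕ.≤ᵇ⇒≤ (lowerOf c) r (proj₁ split) , λ i → not-T (proj₂ split) (∈⇒elemᵇ i)
    where split = Equivalence.to (T-∧ {lowerOf c ≤ᵇ r}) t

  InR⇒inRᵇ : ∀ c r → InR c r → T (inRᵇ c r)
  InR⇒inRᵇ c r (low , out) = Equivalence.from (T-∧ {lowerOf c ≤ᵇ r}) (ℕ.≤⇒≤ᵇ low , T-not (λ t → contradiction (elemᵇ⇒∈ (exclOf c) t) out))

  private
    -- 88, excluded for d = 427, is the largest excluded number of all cases.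
    large : ∀ c r → 88 ℕ.< r → T (inRᵇ c r)
    large c r 88<r = Equivalence.from (T-∧ {lowerOf c ≤ᵇ r})
      ( ℕ.≤⇒≤ᵇ (ℕ.≤-trans (ℕ.≤ᵇ⇒≤ (lowerOf c) 88 (every-case (λ c → lowerOf c ≤ᵇ 88) tt c)) (ℕ.<⇒≤ 88<r))
      , T-not (λ t → contradiction t (elemᵇ-bound 88 (exclOf c) (every-case (λ c → all (_≤ᵇ 88) (exclOf c)) tt c) 88<r)))

    _implies_ : Bool → Bool → Bool
    b implies b′ = not b ∨ b′

    implies-elim : ∀ {b b′} → T (b implies b′) → T b → T b′
    implies-elim {true} t _ = t

    closed : (Case → ℕ) → Case → Bool
    closed gen c = below 89 λ r → memberᵇ c r implies memberᵇ c (r ℕ.+ gen c)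

    -- Closure is evaluated for r up to 88; beyond that the sum exceeds 88 and belongs to R_d
    -- anyway.
    close : ∀ gen c → T (closed gen c) → ∀ r → T (memberᵇ c r) → T (memberᵇ c (r ℕ.+ gen c))
    close gen c t r mem with r ℕ.<? 89
    ... | yes r<89 = implies-elim {memberᵇ c r} (below-sound 89 (λ r → memberᵇ c r implies memberᵇ c (r ℕ.+ gen c)) t r<89) mem
    ... | no r≮89 = Equivalence.from (T-∨ {r ℕ.+ gen c ≡ᵇ 0}) (inj₂ (large c (r ℕ.+ gen c) (ℕ.≤-trans (ℕ.≮⇒≥ r≮89) (ℕ.m≤m+n r (gen c)))))

    close-multiple : ∀ gen c → T (closed gen c) → ∀ k r → T (memberᵇ c r) → T (memberᵇ c (r ℕ.+ k ℕ.* gen c))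
    close-multiple gen c t zero r mem = subst (λ z → T (memberᵇ c z)) (sym (ℕ.+-identityʳ r)) mem
    close-multiple gen c t (suc k) r mem = subst (λ z → T (memberᵇ c z)) (ℕ.+-assoc r (gen c) (k ℕ.* gen c))
      (close-multiple gen c t k (r ℕ.+ gen c) (close gen c t r mem))

    close-semigroup : ∀ c {s} r → InSemigroup c s → T (memberᵇ c r) → T (memberᵇ c (s ℕ.+ r))
    close-semigroup c r (a , b , e , refl) mem = subst (λ z → T (memberᵇ c z)) (shuffle r _ _ _)
      (close-multiple genE c (every-case (closed genE) tt c) e _
        (close-multiple genA c (every-case (closed genA) tt c) b _
          (close-multiple genC c (every-case (closed genC) tt c) a r mem)))
      where
      shuffle : ∀ r x y z → r ℕ.+ x ℕ.+ y ℕ.+ z ≡ x ℕ.+ y ℕ.+ z ℕ.+ r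
      shuffle = ℕ-solve

    total-member : ∀ c {m} (v : Vec (ℤ × ℤ) m) → ∃ λ r → total (other c) v ≡ + r × T (memberᵇ c r)
    total-member c [] = 0 , refl , tt
    total-member c ((x , y) ∷ v) =
      let s , in-s , es = other-values c x y
          r , er , mem = total-member c v
      in s ℕ.+ r , cong₂ _+_ es er , close-semigroup c r in-s mem

  -- Every value of the form lies in the semigroup, and R_d with 0 adjoined contains 0 and is closed
  -- under adding each generator, hence under adding values.
  other-sum⇒InR : ∀ c {m r} → 1 ℕ.≤ r → SumOf (other c) m (+ r) → InR c r
  other-sum⇒InR c {r = r} 1≤r (v , eq) = let r′ , e , mem = total-member c v in
    inRᵇ⇒InR c r ([ (λ z → contradiction (ℕ.≡ᵇ⇒≡ r 0 z) (ℕ.>⇒≢ 1≤r)) , (λ t → t) ]′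
      (Equivalence.to (T-∨ {r ≡ᵇ 0}) (subst (λ z → T (memberᵇ c z)) (+-injective (trans (sym e) eq)) mem)))

  private
    removable : Case → ℕ → (Case → ℕ) → Bool
    removable c r gen = (gen c ≤ᵇ r) ∧ memberᵇ c (r ℕ.∸ gen c)

    reducible : Case → Bool
    reducible c = below 120 λ r → inRᵇ c r implies (removable c r genC ∨ removable c r genA ∨ removable c r genE)

    -- The table ends at 120 because no `genC` exceeds 29: from there on, taking off `genC` leaves a
    -- number above 88.
    remove : ∀ c r → T (inRᵇ c r) → T (removable c r genC) ⊎ T (removable c r genA) ⊎ T (removable c r genE)
    remove c r t with r ℕ.<? 120
    ... | yes r<120 = [ inj₁ , (λ u → inj₂ (Equivalence.to (T-∨ {removable c r genA}) u)) ]′ (Equivalence.to (T-∨ {removable c r genC})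
          (implies-elim {inRᵇ c r} (below-sound 120 (λ r → inRᵇ c r implies (removable c r genC ∨ removable c r genA ∨ removable c r genE))
            (every-case reducible tt c) r<120) t))
    ... | no r≮120 = inj₁ (Equivalence.from (T-∧ {genC c ≤ᵇ r})
          ( ℕ.≤⇒≤ᵇ (ℕ.≤-trans genC≤ (ℕ.≤-trans (ℕ.m≤m+n 29 91) (ℕ.≮⇒≥ r≮120)))
          , Equivalence.from (T-∨ {r ℕ.∸ genC c ≡ᵇ 0}) (inj₂ (large c _ (ℕ.∸-mono (ℕ.≮⇒≥ r≮120) (ℕ.≤-trans genC≤ (ℕ.m≤m+n 29 2)))))))
      where
      genC≤ : genC c ℕ.≤ 29
      genC≤ = ℕ.≤ᵇ⇒≤ (genC c) 29 (every-case (λ c → genC c ≤ᵇ 29) tt c)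

  -- Every nonzero member stays a member after some generator is taken off, and the descent ends at
  -- 0.
  member⇒semigroup : ∀ c r → T (memberᵇ c r) → InSemigroup c r
  member⇒semigroup c = <-rec _ step
    where
    nonzero : (Case → ℕ) → Case → Bool
    nonzero gen c = 1 ≤ᵇ gen c
    step : ∀ r → (∀ {s} → s ℕ.< r → T (memberᵇ c s) → InSemigroup c s) → T (memberᵇ c r) → InSemigroup c r
    step r rec t = [ (λ z → 0 , 0 , 0 , ℕ.≡ᵇ⇒≡ r 0 z) , (λ u → [ via-C , [ via-A , via-E ]′ ]′ (remove c r u)) ]′ (Equivalence.to (T-∨ {r ≡ᵇ 0}) t)
      where
      smaller : ∀ gen → T (nonzero gen c) → T (removable c r gen) → InSemigroup c (r ℕ.∸ gen c) × (r ≡ gen c ℕ.+ (r ℕ.∸ gen c))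
      smaller gen pos t′ = let le , mem = Equivalence.to (T-∧ {gen c ≤ᵇ r}) t′ ; g≤r = ℕ.≤ᵇ⇒≤ (gen c) r le ; 0<g = ℕ.≤ᵇ⇒≤ 1 (gen c) pos in
        rec (ℕ.∸-monoʳ-< {r} {gen c} {0} 0<g g≤r) mem , sym (ℕ.m+[n∸m]≡n g≤r)
      via-C : T (removable c r genC) → InSemigroup c r
      via-C t′ = let (a , b , e , eq) , r≡ = smaller genC (every-case (nonzero genC) tt c) t′ in
        suc a , b , e , trans r≡ (trans (cong (genC c ℕ.+_) eq) (i (genC c) (a ℕ.* genC c) (b ℕ.* genA c) (e ℕ.* genE c)))
        where
        i : ∀ g x y z → g ℕ.+ (x ℕ.+ y ℕ.+ z) ≡ g ℕ.+ x ℕ.+ y ℕ.+ z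
        i = ℕ-solve
      via-A : T (removable c r genA) → InSemigroup c r
      via-A t′ = let (a , b , e , eq) , r≡ = smaller genA (every-case (nonzero genA) tt c) t′ in
        a , suc b , e , trans r≡ (trans (cong (genA c ℕ.+_) eq) (i (genA c) (a ℕ.* genC c) (b ℕ.* genA c) (e ℕ.* genE c)))
        where
        i : ∀ g x y z → g ℕ.+ (x ℕ.+ y ℕ.+ z) ≡ x ℕ.+ (g ℕ.+ y) ℕ.+ z
        i = ℕ-solve
      via-E : T (removable c r genE) → InSemigroup c r
      via-E t′ = let (a , b , e , eq) , r≡ = smaller genE (every-case (nonzero genE) tt c) t′ in
        a , b , suc e , trans r≡ (trans (cong (genE c ℕ.+_) eq) (i (genE c) (a ℕ.* genC c) (b ℕ.* genA c) (e ℕ.* genE c)))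
        where
        i : ∀ g x y z → g ℕ.+ (x ℕ.+ y ℕ.+ z) ≡ x ℕ.+ y ℕ.+ (g ℕ.+ z)
        i = ℕ-solve

  InR⇒semigroup : ∀ c r → InR c r → InSemigroup c r
  InR⇒semigroup c r p = member⇒semigroup c r (Equivalence.from (T-∨ {r ≡ᵇ 0}) (inj₂ (InR⇒inRᵇ c r p)))

  private
    balanced : ∀ A C E → + E ≡ + 4 * + C - + A → ∀ {r} → (∃ λ a → ∃₂ λ b e → r ≡ a ℕ.* C ℕ.+ b ℕ.* A ℕ.+ e ℕ.* E) → SumOf (form (+ A) (+ A) (+ C)) 4 (+ r)
    balanced A C E eE (a , b , e , refl) = subst (SumOf (form (+ A) (+ A) (+ C)) 4)
      (trans (cong (λ z → + a * + C + + b * + A + + e * z) (sym eE)) (sym (combination a b e C A E))) (semigroup-sum (+ A) (+ C) a b e)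

    diagonal : ∀ A C {r} → (∃ λ a → ∃₂ λ b e → r ≡ a ℕ.* C ℕ.+ b ℕ.* A ℕ.+ e ℕ.* A) → SumOf (form (+ A) 0ℤ (+ C)) 4 (+ r)
    diagonal A C (a , b , e , refl) = subst (SumOf (form (+ A) 0ℤ (+ C)) 4)
      (trans (i (+ A) (+ C) (+ a) (+ b) (+ e)) (sym (combination a b e C A A)))
      (subst (λ z → SumOf (form (+ A) 0ℤ (+ C)) 4 (+ A * z + + C * + a)) (pos-+ b e) (diagonal-sum (+ A) (+ C) (b ℕ.+ e) a))
      where
      i : ∀ A C a b e → A * (b + e) + C * a ≡ a * C + b * A + e * A
      i = solve-∀

  other-sum : ∀ c r → InR c r → SumOf (other c) (gOf c) (+ r)
  other-sum c5 r (2≤r , _) = Disc20.Other.other-sum r 2≤r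
  other-sum c6 r (2≤r , _) = ThreeCopies.Disc24.other-sum r 2≤r
  other-sum c10 r p = diagonal 2 5 (InR⇒semigroup c10 r p)
  other-sum c13 r p = balanced 2 7 26 refl (InR⇒semigroup c13 r p)
  other-sum c15 r (2≤r , _) = ThreeCopies.Disc15.other-sum r 2≤r
  other-sum c22 r p = diagonal 2 11 (InR⇒semigroup c22 r p)
  other-sum c35 r p = balanced 5 3 7 refl (InR⇒semigroup c35 r p)
  other-sum c37 r p = balanced 2 19 74 refl (InR⇒semigroup c37 r p)
  other-sum c51 r p = SumOf-map (λ (x , y) → y , x) (swap (+ 5) (+ 3) (+ 3)) (balanced 3 5 17 refl (InR⇒semigroup c51 r p))
  other-sum c58 r p = diagonal 2 29 (InR⇒semigroup c58 r p)
  other-sum c91 r p = balanced 7 5 13 refl (InR⇒semigroup c91 r p)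
  other-sum c115 r p = SumOf-map (λ (x , y) → x , - y) (reflect (+ 5) (- + 5) (+ 7)) (balanced 5 7 23 refl (InR⇒semigroup c115 r p))
  other-sum c123 r p = balanced 3 11 41 refl (InR⇒semigroup c123 r p)
  other-sum c187 r p = SumOf-map (λ (x , y) → y + x , x) shear (balanced 11 7 17 refl (InR⇒semigroup c187 r p))
  other-sum c235 r p = balanced 5 13 47 refl (InR⇒semigroup c235 r p)
  other-sum c267 r p = balanced 3 23 89 refl (InR⇒semigroup c267 r p)
  other-sum c403 r p = SumOf-map (λ (x , y) → y , x) (swap (+ 11) (+ 13) (+ 13)) (balanced 13 11 31 refl (InR⇒semigroup c403 r p))
  other-sum c427 r p = balanced 7 17 61 refl (InR⇒semigroup c427 r p)

  private
    from-four-squares : ∀ b c r → SumOf (form 1ℤ b c) 4 (+ r)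
    from-four-squares b c r = go (four-squares r)
      where
      i : ∀ b c x y z w → 1ℤ * (x * x) + b * (x * 0ℤ) + c * (0ℤ * 0ℤ) + (1ℤ * (y * y) + b * (y * 0ℤ) + c * (0ℤ * 0ℤ)
        + (1ℤ * (z * z) + b * (z * 0ℤ) + c * (0ℤ * 0ℤ) + (1ℤ * (w * w) + b * (w * 0ℤ) + c * (0ℤ * 0ℤ) + 0ℤ))) ≡
        (x * x + 0ℤ * x * y + y * y) + (z * z + 0ℤ * z * w + w * w)
      i = solve-∀
      go : QuaternaryNorms.Rep 0ℤ (+ r) → SumOf (form 1ℤ b c) 4 (+ r)
      go (rep x y z w eq) = (x , 0ℤ) ∷ (y , 0ℤ) ∷ (z , 0ℤ) ∷ (w , 0ℤ) ∷ [] , trans (i b c x y z w) eq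

  principal-sum : ∀ c r → SumOf (principal c) (gOf c) (+ r)
  principal-sum c5 = Disc20.Principal.principal-sum
  principal-sum c6 = ThreeCopies.Disc24.principal-sum
  principal-sum c15 = ThreeCopies.Disc15.principal-sum
  principal-sum c10 = from-four-squares (tℤ c10) (nℤ c10)
  principal-sum c13 = from-four-squares (tℤ c13) (nℤ c13)
  principal-sum c22 = from-four-squares (tℤ c22) (nℤ c22)
  principal-sum c35 = from-four-squares (tℤ c35) (nℤ c35)
  principal-sum c37 = from-four-squares (tℤ c37) (nℤ c37)
  principal-sum c51 = from-four-squares (tℤ c51) (nℤ c51)
  principal-sum c58 = from-four-squares (tℤ c58) (nℤ c58)
  principal-sum c91 = from-four-squares (tℤ c91) (nℤ c91)
  principal-sum c115 = from-four-squares (tℤ c115) (nℤ c115)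
  principal-sum c123 = from-four-squares (tℤ c123) (nℤ c123)
  principal-sum c187 = from-four-squares (tℤ c187) (nℤ c187)
  principal-sum c235 = from-four-squares (tℤ c235) (nℤ c235)
  principal-sum c267 = from-four-squares (tℤ c267) (nℤ c267)
  principal-sum c403 = from-four-squares (tℤ c403) (nℤ c403)
  principal-sum c427 = from-four-squares (tℤ c427) (nℤ c427)

-- Numbers that are not sums of few norms

module LowerBound where
  open import Data.Bool using (false; _∨_; not; T; if_then_else_)
  open import Data.Nat using (_≡ᵇ_)
  open import Data.Integer hiding (suc; pred)
  open import Data.Integer.Properties
  open import Data.Integer.Tactic.RingSolver using (solve-∀)
  open import Data.Unit using (tt)
  open import Data.Vec using (Vec; []; _∷_)
  open Integers
  open Residues using (below; below-sound)
  open FormSums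
  open CaseForms

  -- not a sum of fewer than gOf c squares, and too small for other norms to matter
  critical : Case → ℕ
  critical c = if gOf c ≡ᵇ 3 then 3 else 7

  -- The absolute value of the discriminant of E: d if d ≡ 3 modulo 4, and 4 d otherwise.
  disc : Case → ℤ
  disc c = + 4 * nℤ c - tℤ c * tℤ c

  disc-bound : ∀ c → 0ℤ ≤ disc c - + (1 ℕ.+ 4 ℕ.* critical c)
  disc-bound c = ≤ᵇ⇒≤ (every-case (λ c → 0ℤ ≤ᵇ disc c - + (1 ℕ.+ 4 ℕ.* critical c)) tt c)

  complete-square : ∀ t n x y → + 4 * (1ℤ * (x * x) + t * (x * y) + n * (y * y)) ≡
    (+ 2 * x + t * y) * (+ 2 * x + t * y) + (+ 4 * n - t * t) * (y * y)
  complete-square = solve-∀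

  disc≥0 : ∀ c → 0ℤ ≤ disc c
  disc≥0 c = subst (0ℤ ≤_) (e (disc c) (+ (1 ℕ.+ 4 ℕ.* critical c))) (0≤m+n (disc-bound c) (0≤+ (1 ℕ.+ 4 ℕ.* critical c)))
    where
    e : ∀ d k → d - k + k ≡ d
    e = solve-∀

  disc≢0 : ∀ c → disc c ≢ 0ℤ
  disc≢0 c e with subst (λ z → 0ℤ ≤ z - + (1 ℕ.+ 4 ℕ.* critical c)) e (disc-bound c)
  ... | ()

  private
    form≡0 : ∀ t n x y → 0ℤ ≤ + 4 * n - t * t → + 4 * n - t * t ≢ 0ℤ → form 1ℤ t n x y ≡ 0ℤ → x ≡ 0ℤ × y ≡ 0ℤ
    form≡0 t n x y D≥0 D≢0 eq = *-cancelˡ-≡ (+ 2) x 0ℤ 2x≡0 , y≡0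
      where
      S = + 2 * x + t * y
      D = + 4 * n - t * t
      sum≡0 : S * S + D * (y * y) ≡ 0ℤ
      sum≡0 = trans (sym (complete-square t n x y)) (cong (+ 4 *_) eq)
      split : S * S ≡ 0ℤ × D * (y * y) ≡ 0ℤ
      split = 0≤+0≤≡0 (0≤n² S) (0≤m*n D≥0 (0≤n² y)) sum≡0
      y≡0 : y ≡ 0ℤ
      y≡0 = [ (λ D≡0 → contradiction D≡0 D≢0) , n²≡0⇒n≡0 y ]′ (i*j≡0⇒i≡0∨j≡0 D (proj₂ split))
      e : ∀ x t → + 2 * x ≡ + 2 * x + t * 0ℤ
      e = solve-∀
      2x≡0 : + 2 * x ≡ 0ℤ
      2x≡0 = trans (e x t) (trans (cong (λ y → + 2 * x + t * y) (sym y≡0)) (n²≡0⇒n≡0 S (proj₁ split)))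

  principal≡0 : ∀ c x y → principal c x y ≡ 0ℤ → x ≡ 0ℤ × y ≡ 0ℤ
  principal≡0 c x y = form≡0 (tℤ c) (nℤ c) x y (disc≥0 c) (disc≢0 c)

  principal≥0 : ∀ c x y → 0ℤ ≤ principal c x y
  principal≥0 c x y = 0≤-div 4 (principal c x y) (0≤m+n (subst (0ℤ ≤_) (sym (complete-square (tℤ c) (nℤ c) x y))
    (0≤m+n (0≤n² (+ 2 * x + tℤ c * y)) (0≤m*n (disc≥0 c) (0≤n² y)))) (0≤+ 3))

  private
    total≥0 : ∀ c {m} (v : Vec (ℤ × ℤ) m) → 0ℤ ≤ total (principal c) v
    total≥0 c [] = 0≤+ 0
    total≥0 c ((x , y) ∷ v) = 0≤m+n (principal≥0 c x y) (total≥0 c v)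

    -- Four times the norm is (2 x + t y)² + `disc c` y², and `disc c` exceeds 4 `critical c`. So y
    -- vanishes and the norm is x².
    small-value : ∀ c x y p → principal c x y ≡ + p → p ℕ.≤ critical c → ∃ λ s → p ≡ s ℕ.* s
    small-value c x y p eq p≤ with 0≤⇒+ (0≤n² y)
    ... | zero , y²≡0 = ∣ x ∣ , trans (cong ∣_∣ (trans (sym eq) (trans (e₁ (tℤ c) (nℤ c) x y)
            (trans (cong (λ z → x * x + tℤ c * (x * z) + nℤ c * (z * z)) (n²≡0⇒n≡0 y y²≡0)) (e₂ (tℤ c) (nℤ c) x))))) (abs-* x x)
      where
      e₁ : ∀ t n x y → 1ℤ * (x * x) + t * (x * y) + n * (y * y) ≡ x * x + t * (x * y) + n * (y * y)
      e₁ = solve-∀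
      e₂ : ∀ t n x → x * x + t * (x * 0ℤ) + n * (0ℤ * 0ℤ) ≡ x * x
      e₂ = solve-∀
    ... | suc k , y² = contradiction p≤ (ℕ.<⇒≱ (ℕ.*-cancelˡ-< 4 (critical c) p (drop‿+≤+ bound)))
      where
      e : ∀ P M D k → (P - D * (1ℤ + k)) + D * k + (D - M) ≡ P - M
      e = solve-∀
      e′ : ∀ s t → s + t - t ≡ s
      e′ = solve-∀
      M = + (1 ℕ.+ 4 ℕ.* critical c)
      S = (+ 2 * x + tℤ c * y) * (+ 2 * x + tℤ c * y)
      4p : + (4 ℕ.* p) - disc c * (1ℤ + + k) ≡ S
      4p = trans (cong₂ (λ u v → u - disc c * v) (trans (pos-* 4 p) (trans (cong (+ 4 *_) (sym eq)) (complete-square (tℤ c) (nℤ c) x y))) (sym y²))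
        (e′ S (disc c * (y * y)))
      bound : M ≤ + (4 ℕ.* p)
      bound = 0≤i-j⇒j≤i (subst (0ℤ ≤_) (e (+ (4 ℕ.* p)) M (disc c) (+ k))
        (0≤m+n (0≤m+n (subst (0ℤ ≤_) (sym 4p) (0≤n² (+ 2 * x + tℤ c * y))) (0≤m*n (disc≥0 c) (0≤+ k))) (disc-bound c)))

    sum-squares : ∀ {m} → Vec ℕ m → ℕ
    sum-squares [] = 0
    sum-squares (s ∷ v) = s ℕ.* s ℕ.+ sum-squares v

    squares-only : ∀ c {m} (v : Vec (ℤ × ℤ) m) r → r ℕ.≤ critical c → total (principal c) v ≡ + r → ∃ λ (w : Vec ℕ m) → sum-squares w ≡ r
    squares-only c [] r _ eq = [] , +-injective eq
    squares-only c ((x , y) ∷ v) r r≤ eq with 0≤⇒+ (principal≥0 c x y) | 0≤⇒+ (total≥0 c v)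
    ... | p , ep | r′ , er with +-injective (trans (sym (cong₂ _+_ ep er)) eq)
    ...   | refl with small-value c x y p ep (ℕ.≤-trans (ℕ.m≤m+n p r′) r≤) | squares-only c v r′ (ℕ.≤-trans (ℕ.m≤n+m r′ p) r≤) er
    ...     | s , refl | w , refl = s ∷ w , refl

    root-bound : ∀ k {s n} → n ℕ.< k ℕ.* k → s ℕ.* s ℕ.≤ n → s ℕ.< k
    root-bound k {s} n<k² s²≤n with s ℕ.<? k
    ... | yes s<k = s<k
    ... | no s≮k = contradiction (ℕ.≤-trans (ℕ.*-mono-≤ (ℕ.≮⇒≥ s≮k) (ℕ.≮⇒≥ s≮k)) s²≤n) (ℕ.<⇒≱ n<k²)

    not-T : ∀ {b} → T (not b) → ¬ T b
    not-T {false} _ ()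

    no-three : ∀ a b c → ¬ a ℕ.* a ℕ.+ (b ℕ.* b ℕ.+ (c ℕ.* c ℕ.+ 0)) ≡ 7
    no-three a b c eq = not-T (below-sound 3 (λ c → not (a ℕ.* a ℕ.+ (b ℕ.* b ℕ.+ (c ℕ.* c ℕ.+ 0)) ≡ᵇ 7)) (below-sound 3 (λ b → below 3 λ c → not (a ℕ.* a ℕ.+ (b ℕ.* b ℕ.+ (c ℕ.* c ℕ.+ 0)) ≡ᵇ 7)) (below-sound 3 (λ a → below 3 λ b → below 3 λ c →
        not (a ℕ.* a ℕ.+ (b ℕ.* b ℕ.+ (c ℕ.* c ℕ.+ 0)) ≡ᵇ 7)) tt
        (bound a (ℕ.m≤m+n (a ℕ.* a) _))) (bound b (ℕ.≤-trans (ℕ.m≤m+n (b ℕ.* b) _) (ℕ.m≤n+m _ (a ℕ.* a)))))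
        (bound c (ℕ.≤-trans (ℕ.m≤m+n (c ℕ.* c) 0) (ℕ.≤-trans (ℕ.m≤n+m _ (b ℕ.* b)) (ℕ.m≤n+m _ (a ℕ.* a))))))
      (ℕ.≡⇒≡ᵇ (a ℕ.* a ℕ.+ (b ℕ.* b ℕ.+ (c ℕ.* c ℕ.+ 0))) 7 eq)
      where
      bound : ∀ s → s ℕ.* s ℕ.≤ a ℕ.* a ℕ.+ (b ℕ.* b ℕ.+ (c ℕ.* c ℕ.+ 0)) → s ℕ.< 3
      bound s le = root-bound 3 (ℕ.≤ᵇ⇒≤ 8 9 tt) (subst (s ℕ.* s ℕ.≤_) eq le)

    no-two : ∀ a b → ¬ a ℕ.* a ℕ.+ (b ℕ.* b ℕ.+ 0) ≡ 3
    no-two a b eq = not-T (below-sound 2 (λ b → not (a ℕ.* a ℕ.+ (b ℕ.* b ℕ.+ 0) ≡ᵇ 3)) (below-sound 2 (λ a → below 2 λ b → not (a ℕ.* a ℕ.+ (b ℕ.* b ℕ.+ 0) ≡ᵇ 3)) tt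
        (bound a (ℕ.m≤m+n (a ℕ.* a) _))) (bound b (ℕ.≤-trans (ℕ.m≤m+n (b ℕ.* b) 0) (ℕ.m≤n+m _ (a ℕ.* a)))))
      (ℕ.≡⇒≡ᵇ (a ℕ.* a ℕ.+ (b ℕ.* b ℕ.+ 0)) 3 eq)
      where
      bound : ∀ s → s ℕ.* s ℕ.≤ a ℕ.* a ℕ.+ (b ℕ.* b ℕ.+ 0) → s ℕ.< 2
      bound s le = root-bound 2 (ℕ.≤ᵇ⇒≤ 4 4 tt) (subst (s ℕ.* s ℕ.≤_) eq le)

    few-squares : ∀ g → T ((g ≡ᵇ 3) ∨ (g ≡ᵇ 4)) → ∀ {m} → m ℕ.< g → (w : Vec ℕ m) → ¬ sum-squares w ≡ (if g ≡ᵇ 3 then 3 else 7)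
    few-squares 3 _ _ [] ()
    few-squares 3 _ _ (a ∷ []) = no-two 0 a
    few-squares 3 _ _ (a ∷ b ∷ []) = no-two a b
    few-squares 3 _ (s≤s (s≤s (s≤s ()))) (_ ∷ _ ∷ _ ∷ _)
    few-squares 4 _ _ [] ()
    few-squares 4 _ _ (a ∷ []) = no-three 0 0 a
    few-squares 4 _ _ (a ∷ b ∷ []) = no-three 0 a b
    few-squares 4 _ _ (a ∷ b ∷ c ∷ []) = no-three a b c
    few-squares 4 _ (s≤s (s≤s (s≤s (s≤s ())))) (_ ∷ _ ∷ _ ∷ _ ∷ _)

  critical-needs-gOf : ∀ c {m} → m ℕ.< gOf c → ¬ SumOf (principal c) m (+ critical c)
  critical-needs-gOf c m<g (v , eq) = let w , eq′ = squares-only c v (critical c) ℕ.≤-refl eq in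
    few-squares (gOf c) (every-case (λ c → (gOf c ≡ᵇ 3) ∨ (gOf c ≡ᵇ 4)) tt c) m<g w eq′

-- Integers inside the rationals

module Rationals where
  import Data.Nat.Coprimality as ℕ
  open import Data.Integer as ℤ using (ℤ; +_)
  import Data.Integer.Properties as ℤ
  open import Data.Rational
  open import Data.Rational.Properties
  open import Data.Rational.Unnormalised as ℚᵘ using (ℚᵘ; mkℚᵘ; *≡*)
  import Data.Rational.Unnormalised.Properties as ℚᵘ
  open import Level using (0ℓ)
  open import Relation.Nullary.Decidable using (dec⇒maybe)
  open import Tactic.RingSolver using (solve-∀)
  open import Tactic.RingSolver.Core.AlmostCommutativeRing using (AlmostCommutativeRing; fromCommutativeRing)

  ring : AlmostCommutativeRing 0ℓ 0ℓ
  ring = fromCommutativeRing +-*-commutativeRing (λ x → dec⇒maybe (0ℚ ≟ x))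

  ι : ℤ → ℚ
  ι z = z / 1

  private
    -- An explicit fraction in lowest terms: in contrast to `z / 1` it involves no gcd, so sums and
    -- products of such fractions unfold.
    integer : ℤ → ℚ
    integer z = mkℚ z 0 (ℕ.sym (ℕ.1-coprimeTo _))

    ι≡ : ∀ z → ι z ≡ integer z
    ι≡ z = ↥p/↧p≡p (integer z)

  ι-injective : ∀ {a b} → ι a ≡ ι b → a ≡ b
  ι-injective {a} {b} e = cong ↥_ (trans (sym (ι≡ a)) (trans e (ι≡ b)))

  ι-+ : ∀ a b → ι (a ℤ.+ b) ≡ ι a + ι b
  ι-+ a b = trans (cong (_/ 1) (sym (cong₂ ℤ._+_ (ℤ.*-identityʳ a) (ℤ.*-identityʳ b)))) (sym (cong₂ _+_ (ι≡ a) (ι≡ b)))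

  ι-* : ∀ a b → ι (a ℤ.* b) ≡ ι a * ι b
  ι-* a b = sym (cong₂ _*_ (ι≡ a) (ι≡ b))

  ι-neg : ∀ a → ι (ℤ.- a) ≡ - ι a
  ι-neg a = trans (e (ι a) (ι (ℤ.- a))) (trans (cong (_+ - ι a) (trans (sym (ι-+ a (ℤ.- a))) (cong ι (ℤ.+-inverseʳ a)))) (+-identityˡ (- ι a)))
    where
    e : ∀ x y → y ≡ x + y + - x
    e = solve-∀ ring

  ι-/ : ∀ r k .{{_ : ℕ.NonZero k}} → ι (+ k) * (r / k) ≡ ι r
  ι-/ r k@(suc k-1) = toℚᵘ-injective (begin
    toℚᵘ (ι (+ k) * (r / k))          ≈⟨ toℚᵘ-homo-* (ι (+ k)) (r / k) ⟩
    toℚᵘ (ι (+ k)) ℚᵘ.* toℚᵘ (r / k)  ≈⟨ ℚᵘ.*-cong (toℚᵘ-fromℚᵘ (mkℚᵘ (+ k) 0)) (toℚᵘ-fromℚᵘ (mkℚᵘ r k-1)) ⟩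
    mkℚᵘ (+ k) 0 ℚᵘ.* mkℚᵘ r k-1      ≈⟨ *≡* (trans (ℤ.*-identityʳ (+ k ℤ.* r)) (trans (ℤ.*-comm (+ k) r) (cong (λ z → r ℤ.* + z) (sym (ℕ.*-identityˡ k))))) ⟩
    mkℚᵘ r 0                          ≈⟨ toℚᵘ-fromℚᵘ (mkℚᵘ r 0) ⟨
    toℚᵘ (ι r) ∎)
    where
    open ℚᵘ.≃-Reasoning

  clear-denominator : ∀ q → ∃₂ λ D z → D ≢ 0 × ι (+ D) * q ≡ ι z
  clear-denominator q@(mkℚ z d _) = suc d , z , (λ ()) , trans (cong (ι (+ suc d) *_) (sym (↥p/↧p≡p q))) (ι-/ z (suc d))

  *-cancel : ∀ p {x y} → p ≢ 0ℚ → p * x ≡ p * y → x ≡ y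
  *-cancel p {x} {y} p≢0 e = trans (sym (drop x)) (trans (cong (1/ p *_) e) (drop y))
    where
    instance _ = ≢-nonZero p≢0
    drop : ∀ x → 1/ p * (p * x) ≡ x
    drop x = trans (sym (*-assoc (1/ p) p x)) (trans (cong (_* x) (*-inverseˡ p)) (*-identityˡ x))

  ι≢0 : ∀ {a} → a ≢ + 0 → ι a ≢ 0ℚ
  ι≢0 a≢0 e = a≢0 (ι-injective e)

  reciprocal : ∀ p → p ≢ 0ℚ → ∃ λ q → p * q ≡ 1ℚ
  reciprocal p p≢0 = 1/ p , *-inverseʳ p
    where
    instance _ = ≢-nonZero p≢0

-- Arithmetic of E and of its ring of integers

module QuadraticField where
  open import Data.Integer as ℤ using (ℤ; +_)
  import Data.Integer.Properties as ℤ
  open import Data.Rational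
  open import Data.Rational.Properties
  open import Tactic.RingSolver using (solve-∀)
  open Rationals
  open CaseForms
  open LowerBound using (principal≡0)

  t≡ι : ∀ c → Field.t (dOf c) ≡ ι (tℤ c)
  t≡ι c5 = refl
  t≡ι c6 = refl
  t≡ι c10 = refl
  t≡ι c13 = refl
  t≡ι c15 = refl
  t≡ι c22 = refl
  t≡ι c35 = refl
  t≡ι c37 = refl
  t≡ι c51 = refl
  t≡ι c58 = refl
  t≡ι c91 = refl
  t≡ι c115 = refl
  t≡ι c123 = refl
  t≡ι c187 = refl
  t≡ι c235 = refl
  t≡ι c267 = refl
  t≡ι c403 = refl
  t≡ι c427 = refl

  n≡ι : ∀ c → Field.n (dOf c) ≡ ι (nℤ c)
  n≡ι c5 = refl
  n≡ι c6 = refl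
  n≡ι c10 = refl
  n≡ι c13 = refl
  n≡ι c15 = refl
  n≡ι c22 = refl
  n≡ι c35 = refl
  n≡ι c37 = refl
  n≡ι c51 = refl
  n≡ι c58 = refl
  n≡ι c91 = refl
  n≡ι c115 = refl
  n≡ι c123 = refl
  n≡ι c187 = refl
  n≡ι c235 = refl
  n≡ι c267 = refl
  n≡ι c403 = refl
  n≡ι c427 = refl

  module Order (c : Case) where
    open Field (dOf c)

    ⊕-identityʳ : ∀ x → x ⊕ 0E ≡ x
    ⊕-identityʳ (a , b) = cong₂ _,_ (+-identityʳ a) (+-identityʳ b)

    ⊕-identityˡ : ∀ x → 0E ⊕ x ≡ x
    ⊕-identityˡ (a , b) = cong₂ _,_ (+-identityˡ a) (+-identityˡ b)

    interchange : ∀ x y z w → (x ⊕ y) ⊕ (z ⊕ w) ≡ (x ⊕ z) ⊕ (y ⊕ w)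
    interchange (a , b) (a′ , b′) (c , d) (c′ , d′) = cong₂ _,_ (e a a′ c c′) (e b b′ d d′)
      where
      e : ∀ x y z w → x + y + (z + w) ≡ x + z + (y + w)
      e = solve-∀ ring

    ⊗-comm : ∀ x y → x ⊗ y ≡ y ⊗ x
    ⊗-comm (a , b) (a′ , b′) = cong₂ _,_ (e₁ n a b a′ b′) (e₂ t a b a′ b′)
      where
      e₁ : ∀ n a b c d → a * c + - (n * (b * d)) ≡ c * a + - (n * (d * b))
      e₁ = solve-∀ ring
      e₂ : ∀ t a b c d → a * d + b * c + t * (b * d) ≡ c * b + d * a + t * (d * b)
      e₂ = solve-∀ ring

    ⊗-assoc : ∀ x y z → (x ⊗ y) ⊗ z ≡ x ⊗ (y ⊗ z)
    ⊗-assoc (a , b) (c , d) (e , f) = cong₂ _,_ (e₁ t n a b c d e f) (e₂ t n a b c d e f)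
      where
      e₁ : ∀ t n a b c d e f → (a * c + - (n * (b * d))) * e + - (n * ((a * d + b * c + t * (b * d)) * f))
        ≡ a * (c * e + - (n * (d * f))) + - (n * (b * (c * f + d * e + t * (d * f))))
      e₁ = solve-∀ ring
      e₂ : ∀ t n a b c d e f → (a * c + - (n * (b * d))) * f + (a * d + b * c + t * (b * d)) * e + t * ((a * d + b * c + t * (b * d)) * f)
        ≡ a * (c * f + d * e + t * (d * f)) + b * (c * e + - (n * (d * f))) + t * (b * (c * f + d * e + t * (d * f)))
      e₂ = solve-∀ ring

    ⊗-distribˡ-⊕ : ∀ x y z → x ⊗ (y ⊕ z) ≡ x ⊗ y ⊕ x ⊗ z
    ⊗-distribˡ-⊕ (a , b) (c , d) (e , f) = cong₂ _,_ (e₁ n a b c d e f) (e₂ t a b c d e f)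
      where
      e₁ : ∀ n a b c d e f → a * (c + e) + - (n * (b * (d + f))) ≡ a * c + - (n * (b * d)) + (a * e + - (n * (b * f)))
      e₁ = solve-∀ ring
      e₂ : ∀ t a b c d e f → a * (d + f) + b * (c + e) + t * (b * (d + f)) ≡ a * d + b * c + t * (b * d) + (a * f + b * e + t * (b * f))
      e₂ = solve-∀ ring

    ⊗-distribʳ-⊕ : ∀ x y z → (y ⊕ z) ⊗ x ≡ y ⊗ x ⊕ z ⊗ x
    ⊗-distribʳ-⊕ x y z = trans (⊗-comm (y ⊕ z) x) (trans (⊗-distribˡ-⊕ x y z) (cong₂ _⊕_ (⊗-comm x y) (⊗-comm x z)))

    ⊗-identityˡ : ∀ x → 1E ⊗ x ≡ x
    ⊗-identityˡ (a , b) = cong₂ _,_ (e₁ n a b) (e₂ t a b)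
      where
      e₁ : ∀ n a b → 1ℚ * a + - (n * (0ℚ * b)) ≡ a
      e₁ = solve-∀ ring
      e₂ : ∀ t a b → 1ℚ * b + 0ℚ * a + t * (0ℚ * b) ≡ b
      e₂ = solve-∀ ring

    ⊗-identityʳ : ∀ x → x ⊗ 1E ≡ x
    ⊗-identityʳ x = trans (⊗-comm x 1E) (⊗-identityˡ x)

    ⊗-zeroʳ : ∀ x → x ⊗ 0E ≡ 0E
    ⊗-zeroʳ (a , b) = cong₂ _,_ (e₁ n a b) (e₂ t a b)
      where
      e₁ : ∀ n a b → a * 0ℚ + - (n * (b * 0ℚ)) ≡ 0ℚ
      e₁ = solve-∀ ring
      e₂ : ∀ t a b → a * 0ℚ + b * 0ℚ + t * (b * 0ℚ) ≡ 0ℚ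
      e₂ = solve-∀ ring

    ⊗-zeroˡ : ∀ x → 0E ⊗ x ≡ 0E
    ⊗-zeroˡ x = trans (⊗-comm 0E x) (⊗-zeroʳ x)

    ⊗-swap : ∀ x y z → x ⊗ (y ⊗ z) ≡ y ⊗ (x ⊗ z)
    ⊗-swap x y z = trans (sym (⊗-assoc x y z)) (trans (cong (_⊗ z) (⊗-comm x y)) (⊗-assoc y x z))

    ⊗-interchange : ∀ x y z w → (x ⊗ y) ⊗ (z ⊗ w) ≡ (x ⊗ z) ⊗ (y ⊗ w)
    ⊗-interchange x y z w = trans (⊗-assoc x y (z ⊗ w)) (trans (cong (x ⊗_) (⊗-swap y z w)) (sym (⊗-assoc x z (y ⊗ w))))

    conj-⊗ : ∀ x y → conj (x ⊗ y) ≡ conj x ⊗ conj y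
    conj-⊗ (a , b) (c , d) = cong₂ _,_ (e₁ t n a b c d) (e₂ t a b c d)
      where
      e₁ : ∀ t n a b c d → a * c + - (n * (b * d)) + t * (a * d + b * c + t * (b * d)) ≡ (a + t * b) * (c + t * d) + - (n * (- b * - d))
      e₁ = solve-∀ ring
      e₂ : ∀ t a b c d → - (a * d + b * c + t * (b * d)) ≡ (a + t * b) * - d + - b * (c + t * d) + t * (- b * - d)
      e₂ = solve-∀ ring

    norm : E → ℚ
    norm (a , b) = a * a + t * (a * b) + n * (b * b)

    ⊗-conj : ∀ x → x ⊗ conj x ≡ (norm x , 0ℚ)
    ⊗-conj (a , b) = cong₂ _,_ (e₁ t n a b) (e₂ t a b)
      where
      e₁ : ∀ t n a b → a * (a + t * b) + - (n * (b * - b)) ≡ a * a + t * (a * b) + n * (b * b)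
      e₁ = solve-∀ ring
      e₂ : ∀ t a b → a * - b + b * (a + t * b) + t * (b * - b) ≡ 0ℚ
      e₂ = solve-∀ ring

    scalar-⊗ : ∀ p q → (p , 0ℚ) ⊗ (q , 0ℚ) ≡ (p * q , 0ℚ)
    scalar-⊗ p q = cong₂ _,_ (e₁ n p q) (e₂ t p q)
      where
      e₁ : ∀ n p q → p * q + - (n * (0ℚ * 0ℚ)) ≡ p * q
      e₁ = solve-∀ ring
      e₂ : ∀ t p q → p * 0ℚ + 0ℚ * q + t * (0ℚ * 0ℚ) ≡ 0ℚ
      e₂ = solve-∀ ring

    scale : ∀ p a b → (p , 0ℚ) ⊗ (a , b) ≡ (p * a , p * b)
    scale p a b = cong₂ _,_ (e₁ n p a b) (e₂ t p a b)
      where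
      e₁ : ∀ n p a b → p * a + - (n * (0ℚ * b)) ≡ p * a
      e₁ = solve-∀ ring
      e₂ : ∀ t p a b → p * b + 0ℚ * a + t * (0ℚ * b) ≡ p * b
      e₂ = solve-∀ ring

    norm-⊗ : ∀ x y → norm (x ⊗ y) ≡ norm x * norm y
    norm-⊗ x y = cong proj₁ (trans (sym (⊗-conj (x ⊗ y))) (trans (cong ((x ⊗ y) ⊗_) (conj-⊗ x y))
      (trans (⊗-interchange x y (conj x) (conj y)) (trans (cong₂ _⊗_ (⊗-conj x) (⊗-conj y)) (scalar-⊗ (norm x) (norm y))))))

    el-⊕ : ∀ a b c d → el (a ℤ.+ c) (b ℤ.+ d) ≡ el a b ⊕ el c d
    el-⊕ a b c d = cong₂ _,_ (ι-+ a c) (ι-+ b d)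

    el-⊗ : ∀ a b e f → el a b ⊗ el e f ≡ el (a ℤ.* e ℤ.- nℤ c ℤ.* (b ℤ.* f)) (a ℤ.* f ℤ.+ b ℤ.* e ℤ.+ tℤ c ℤ.* (b ℤ.* f))
    el-⊗ a b e f = cong₂ _,_
      (sym (trans (ι-+ (a ℤ.* e) (ℤ.- (nℤ c ℤ.* (b ℤ.* f)))) (cong₂ _+_ (ι-* a e) (trans (ι-neg (nℤ c ℤ.* (b ℤ.* f))) (cong -_
        (trans (ι-* (nℤ c) (b ℤ.* f)) (cong₂ _*_ (sym (n≡ι c)) (ι-* b f))))))))
      (sym (trans (ι-+ (a ℤ.* f ℤ.+ b ℤ.* e) (tℤ c ℤ.* (b ℤ.* f))) (cong₂ _+_
        (trans (ι-+ (a ℤ.* f) (b ℤ.* e)) (cong₂ _+_ (ι-* a f) (ι-* b e)))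
        (trans (ι-* (tℤ c) (b ℤ.* f)) (cong₂ _*_ (sym (t≡ι c)) (ι-* b f))))))

    conj-el : ∀ a b → conj (el a b) ≡ el (a ℤ.+ tℤ c ℤ.* b) (ℤ.- b)
    conj-el a b = cong₂ _,_ (sym (trans (ι-+ a (tℤ c ℤ.* b)) (cong (λ z → ι a + z) (trans (ι-* (tℤ c) b) (cong (_* ι b) (sym (t≡ι c)))))))
      (sym (ι-neg b))

    norm-el : ∀ a b → norm (el a b) ≡ ι (principal c a b)
    norm-el a b = sym (trans (ι-+ (ℤ.1ℤ ℤ.* (a ℤ.* a) ℤ.+ tℤ c ℤ.* (a ℤ.* b)) (nℤ c ℤ.* (b ℤ.* b))) (cong₂ _+_
        (trans (ι-+ (ℤ.1ℤ ℤ.* (a ℤ.* a)) (tℤ c ℤ.* (a ℤ.* b))) (cong₂ _+_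
          (trans (cong ι (ℤ.*-identityˡ (a ℤ.* a))) (ι-* a a))
          (trans (ι-* (tℤ c) (a ℤ.* b)) (cong₂ _*_ (sym (t≡ι c)) (ι-* a b)))))
        (trans (ι-* (nℤ c) (b ℤ.* b)) (cong₂ _*_ (sym (n≡ι c)) (ι-* b b)))))

    el-injective : ∀ {a b e f} → el a b ≡ el e f → a ≡ e × b ≡ f
    el-injective eq = ι-injective (cong proj₁ eq) , ι-injective (cong proj₂ eq)

    inO-el : ∀ a b → inO (el a b)
    inO-el a b = (a , refl) , (b , refl)

    el-inO : ∀ {x} → inO x → ∃₂ λ a b → x ≡ el a b
    el-inO ((a , p) , (b , q)) = a , b , cong₂ _,_ p q

    inO-⊕ : ∀ x y → inO x → inO y → inO (x ⊕ y)
    inO-⊕ x y p q = go (el-inO p) (el-inO q)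
      where
      go : (∃₂ λ a b → x ≡ el a b) → (∃₂ λ e f → y ≡ el e f) → inO (x ⊕ y)
      go (a , b , ex) (e , f , ey) = subst inO (trans (el-⊕ a b e f) (sym (cong₂ _⊕_ ex ey))) (inO-el (a ℤ.+ e) (b ℤ.+ f))

    inO-⊗ : ∀ x y → inO x → inO y → inO (x ⊗ y)
    inO-⊗ x y p q = go (el-inO p) (el-inO q)
      where
      go : (∃₂ λ a b → x ≡ el a b) → (∃₂ λ e f → y ≡ el e f) → inO (x ⊗ y)
      go (a , b , ex) (e , f , ey) = subst inO (trans (sym (el-⊗ a b e f)) (sym (cong₂ _⊗_ ex ey)))
        (inO-el (a ℤ.* e ℤ.- nℤ c ℤ.* (b ℤ.* f)) (a ℤ.* f ℤ.+ b ℤ.* e ℤ.+ tℤ c ℤ.* (b ℤ.* f)))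

    clear : ∀ x → ∃ λ D → ∃₂ λ u v → D ≢ 0 × el (+ D) (+ 0) ⊗ x ≡ el u v
    clear (a , b) with clear-denominator a | clear-denominator b
    ... | D , u , D≢0 , eu | D′ , v , D′≢0 , ev = D ℕ.* D′ , + D′ ℤ.* u , + D ℤ.* v ,
      (λ e → [ D≢0 , D′≢0 ]′ (ℕ.m*n≡0⇒m≡0∨n≡0 D e)) ,
      trans (scale (ι (+ (D ℕ.* D′))) a b) (cong₂ _,_
        (trans (cong (_* a) ι-prod) (trans (e₁ (ι (+ D)) (ι (+ D′)) a) (trans (cong (ι (+ D′) *_) eu) (sym (ι-* (+ D′) u)))))
        (trans (cong (_* b) ι-prod) (trans (*-assoc (ι (+ D)) (ι (+ D′)) b) (trans (cong (ι (+ D) *_) ev) (sym (ι-* (+ D) v))))))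
      where
      ι-prod : ι (+ (D ℕ.* D′)) ≡ ι (+ D) * ι (+ D′)
      ι-prod = trans (cong ι (ℤ.pos-* D D′)) (ι-* (+ D) (+ D′))
      e₁ : ∀ m m′ a → m * m′ * a ≡ m′ * (m * a)
      e₁ = solve-∀ ring

    el-nonzero : ∀ {a} → a ≢ + 0 → el a (+ 0) ≢ 0E
    el-nonzero a≢0 e = ι≢0 a≢0 (cong proj₁ e)

    zero-product : ∀ {p x} → p ≢ 0ℚ → p * x ≡ 0ℚ → x ≡ 0ℚ
    zero-product {p} p≢0 e = *-cancel p p≢0 (trans e (sym (*-zeroʳ p)))

    el-nonzero′ : ∀ {a b} → b ≢ + 0 → el a b ≢ 0E
    el-nonzero′ b≢0 e = ι≢0 b≢0 (cong proj₂ e)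

    1E≢0E : 1E ≢ 0E
    1E≢0E e = one≢zero (cong proj₁ e)

    -- Clearing denominators reduces this to the integral norm form, which is positive definite.
    norm≡0 : ∀ x → norm x ≡ 0ℚ → x ≡ 0E
    norm≡0 x N≡0 = cleared (clear x)
      where
      cleared : (∃ λ D → ∃₂ λ u v → D ≢ 0 × el (+ D) (+ 0) ⊗ x ≡ el u v) → x ≡ 0E
      cleared (D , u , v , D≢0 , eq) = cong₂ _,_ (zero-product δ≢0 (cong proj₁ δx≡0)) (zero-product δ≢0 (cong proj₂ δx≡0))
        where
        δ = ι (+ D)
        δ≢0 : δ ≢ 0ℚ
        δ≢0 = ι≢0 (λ e → D≢0 (ℤ.+-injective e))
        N-uv : norm (el u v) ≡ 0ℚ
        N-uv = trans (cong norm (sym eq)) (trans (norm-⊗ (el (+ D) (+ 0)) x) (trans (cong (norm (el (+ D) (+ 0)) *_) N≡0) (*-zeroʳ (norm (el (+ D) (+ 0))))))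
        P≡0 : principal c u v ≡ ℤ.0ℤ
        P≡0 = ι-injective {principal c u v} {ℤ.0ℤ} (trans (sym (norm-el u v)) N-uv)
        uv≡0 : el u v ≡ 0E
        uv≡0 = cong₂ el (proj₁ (principal≡0 c u v P≡0)) (proj₂ (principal≡0 c u v P≡0))
        δx≡0 : (δ * proj₁ x , δ * proj₂ x) ≡ 0E
        δx≡0 = trans (sym (scale δ (proj₁ x) (proj₂ x))) (trans eq uv≡0)

    norm-nonzero : ∀ {x} → x ≢ 0E → norm x ≢ 0ℚ
    norm-nonzero {x} x≢0 N≡0 = x≢0 (norm≡0 x N≡0)

    inverse : ∀ x → x ≢ 0E → ∃ λ y → y ⊗ x ≡ 1E
    inverse x x≢0 = invert (reciprocal (norm x) (norm-nonzero x≢0))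
      where
      invert : (∃ λ q → norm x * q ≡ 1ℚ) → ∃ λ y → y ⊗ x ≡ 1E
      invert (q , eq) = conj x ⊗ (q , 0ℚ) , trans (⊗-comm (conj x ⊗ (q , 0ℚ)) x)
        (trans (sym (⊗-assoc x (conj x) (q , 0ℚ))) (trans (cong (_⊗ (q , 0ℚ)) (⊗-conj x))
          (trans (scalar-⊗ (norm x) q) (cong (_, 0ℚ) eq))))

    cancel-inverse : ∀ x y z → y ⊗ x ≡ 1E → y ⊗ (x ⊗ z) ≡ z
    cancel-inverse x y z inv = trans (sym (⊗-assoc y x z)) (trans (cong (_⊗ z) inv) (⊗-identityˡ z))

    ⊗-cancelˡ : ∀ x {y z} → x ≢ 0E → x ⊗ y ≡ x ⊗ z → y ≡ z
    ⊗-cancelˡ x {y} {z} x≢0 eq = cancelled (inverse x x≢0)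
      where
      cancelled : (∃ λ w → w ⊗ x ≡ 1E) → y ≡ z
      cancelled (w , inv) = trans (sym (cancel-inverse x w y inv)) (trans (cong (w ⊗_) eq) (cancel-inverse x w z inv))

    ⊗-nonzero : ∀ {x y} → x ≢ 0E → y ≢ 0E → x ⊗ y ≢ 0E
    ⊗-nonzero {x} {y} x≢0 y≢0 e = y≢0 (⊗-cancelˡ x x≢0 (trans e (sym (⊗-zeroʳ x))))

-- Triangular bases of subgroups of ℤ²

module HermiteNormalForm where
  import Data.Nat.Divisibility as ℕ
  open import Data.Nat.GCD using (module GCD; module Bézout)
  open import Data.Integer hiding (suc; pred)
  open import Data.Integer.Properties
  open import Data.Integer.Tactic.RingSolver using (solve-∀)
  open import Data.List using (List; []; _∷_)
  open import Data.List.Relation.Unary.All as All using (All; []; _∷_)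

  record Bezout (m n : ℤ) : Set where
    constructor bezout
    field
      g x y m′ n′ : ℤ
      m≡ : m ≡ g * m′
      n≡ : n ≡ g * n′
      combination : x * m + y * n ≡ g

  private
    signed : ∀ z → ∃ λ s → (z ≡ + ∣ z ∣ * s) × (+ ∣ z ∣ ≡ s * z)
    signed (+ n) = 1ℤ , sym (*-identityʳ (+ n)) , sym (*-identityˡ (+ n))
    signed -[1+ n ] = -1ℤ , sym (trans (*-comm (+ suc n) -1ℤ) (-1*i≡-i (+ suc n))) , sym (-1*i≡-i -[1+ n ])

    bezout-ℕ : ∀ m n → Bezout (+ m) (+ n)
    bezout-ℕ m n with Bézout.lemma m n
    ... | Bézout.result d gcd-d identity with GCD.commonDivisor gcd-d
    ...   | ℕ.divides m′ em , ℕ.divides n′ en = go identity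
      where
      em′ : + m ≡ + d * + m′
      em′ = trans (cong +_ (trans em (ℕ.*-comm m′ d))) (pos-* d m′)
      en′ : + n ≡ + d * + n′
      en′ = trans (cong +_ (trans en (ℕ.*-comm n′ d))) (pos-* d n′)
      cast : ∀ {d x y m n} → d ℕ.+ y ℕ.* n ≡ x ℕ.* m → + d + + y * + n ≡ + x * + m
      cast {d} {x} {y} {m} {n} e = trans (cong (λ z → + d + z) (sym (pos-* y n))) (trans (sym (pos-+ d (y ℕ.* n))) (trans (cong +_ e) (pos-* x m)))
      move : ∀ d u v → d + u ≡ v → v + - u ≡ d
      move d u v refl = e d u
        where
        e : ∀ d u → d + u + - u ≡ d
        e = solve-∀
      go : Bézout.Identity d m n → Bezout (+ m) (+ n)
      go (Bézout.+- x y e) = bezout (+ d) (+ x) (- + y) (+ m′) (+ n′) em′ en′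
        (trans (cong (λ z → + x * + m + z) (sym (neg-distribˡ-* (+ y) (+ n)))) (move (+ d) (+ y * + n) (+ x * + m) (cast {d} {x} {y} e)))
      go (Bézout.-+ x y e) = bezout (+ d) (- + x) (+ y) (+ m′) (+ n′) em′ en′
        (trans (+-comm (- + x * + m) (+ y * + n)) (trans (cong (λ z → + y * + n + z) (sym (neg-distribˡ-* (+ x) (+ m)))) (move (+ d) (+ x * + m) (+ y * + n) (cast {d} {y} {x} e))))

  opaque
    bezout-of : ∀ m n → Bezout m n
    bezout-of m n = go (signed m) (signed n) (bezout-ℕ ∣ m ∣ ∣ n ∣)
      where
      go : (∃ λ s → (m ≡ + ∣ m ∣ * s) × (+ ∣ m ∣ ≡ s * m)) → (∃ λ s → (n ≡ + ∣ n ∣ * s) × (+ ∣ n ∣ ≡ s * n)) → Bezout (+ ∣ m ∣) (+ ∣ n ∣) → Bezout m n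
      go (s , m≡ , ∣m∣≡) (t , n≡ , ∣n∣≡) (bezout g x y m′ n′ em en comb) =
        bezout g (x * s) (y * t) (m′ * s) (n′ * t)
          (trans m≡ (trans (cong (_* s) em) (*-assoc g m′ s)))
          (trans n≡ (trans (cong (_* t) en) (*-assoc g n′ t)))
          (trans (cong₂ _+_ (trans (*-assoc x s m) (cong (x *_) (sym ∣m∣≡))) (trans (*-assoc y t n) (cong (y *_) (sym ∣n∣≡)))) comb)

  record Subgroup (P : ℤ → ℤ → Set) : Set where
    field
      add : ∀ {a b c d} → P a b → P c d → P (a + c) (b + d)
      multiple : ∀ k {a b} → P a b → P (k * a) (k * b)

  data Triangular (a b c : ℤ) : ℤ → ℤ → Set where
    combine : ∀ u v → Triangular a b c (u * a + v * b) (v * c)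

  triangular : ∀ {a b c} u v {x y} → x ≡ u * a + v * b → y ≡ v * c → Triangular a b c x y
  triangular u v refl refl = combine u v

  triangular-subgroup : ∀ a b c → Subgroup (Triangular a b c)
  triangular-subgroup a b c = record
    { add = λ { (combine u v) (combine u′ v′) → triangular (u + u′) (v + v′) (e₁ u v u′ v′ a b) (sym (*-distribʳ-+ c v v′)) }
    ; multiple = λ { k (combine u v) → triangular (k * u) (k * v) (e₂ k u v a b) (sym (*-assoc k v c)) }
    }
    where
    e₁ : ∀ u v u′ v′ a b → u * a + v * b + (u′ * a + v′ * b) ≡ (u + u′) * a + (v + v′) * b
    e₁ = solve-∀
    e₂ : ∀ k u v a b → k * (u * a + v * b) ≡ k * u * a + k * v * b
    e₂ = solve-∀

  module _ {P : ℤ → ℤ → Set} (sub : Subgroup P) where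
    open Subgroup sub

    triangular⊆ : ∀ {a b c} → P a 0ℤ → P b c → ∀ {x y} → Triangular a b c x y → P x y
    triangular⊆ {a} {b} {c} pa pb (combine u v) = subst (P (u * a + v * b)) (e u v c) (add (multiple u pa) (multiple v pb))
      where
      e : ∀ u v c → u * 0ℤ + v * c ≡ v * c
      e = solve-∀

  -- `inside` expresses that the basis lies in the subgroup generated by `gens` by quantifying over
  -- all subgroups P that contain `gens`. It is applied to membership in the lattice and to
  -- stability under ω.
  record Basis (gens : List (ℤ × ℤ)) : Set₁ where
    field
      a b c : ℤ
      a≢0 : a ≢ 0ℤ
      c≢0 : c ≢ 0ℤ
      inside : ∀ {P} → Subgroup P → All (λ (p , q) → P p q) gens → P a 0ℤ × P b c
      covers : All (λ (p , q) → Triangular a b c p q) gens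

  private
    module Step (a b c p q : ℤ) (a≢0 : a ≢ 0ℤ) (c≢0 : c ≢ 0ℤ) where
      open Bezout (bezout-of c q) renaming (g to g; m′ to c′; n′ to q′; m≡ to c≡; n≡ to q≡) public
      -- q′ (b , c) - c′ (p , q) has second coordinate 0; its first coordinate k then enters a gcd
      -- with a.
      k = q′ * b + - c′ * p
      open Bezout (bezout-of a k) using () renaming (g to a′; x to s; y to r; m′ to a₁; n′ to k₁; m≡ to a≡; n≡ to k≡; combination to combination′) public

      factor≢0 : ∀ {z g m} → z ≢ 0ℤ → z ≡ g * m → g ≢ 0ℤ
      factor≢0 {m = m} z≢0 e refl = z≢0 (trans e (*-zeroˡ m))

      g≢0 : g ≢ 0ℤ
      g≢0 = factor≢0 c≢0 c≡

      unit : x * c′ + y * q′ ≡ 1ℤ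
      unit = *-cancelˡ-≡ g (x * c′ + y * q′) 1ℤ {{≢-nonZero g≢0}}
        (trans (e g x y c′ q′) (trans (sym (cong₂ (λ c q → x * c + y * q) c≡ q≡)) (trans combination (sym (*-identityʳ g)))))
        where
        e : ∀ g x y c′ q′ → g * (x * c′ + y * q′) ≡ x * (g * c′) + y * (g * q′)
        e = solve-∀

      b′ = x * b + y * p


      inside : ∀ {P} → Subgroup P → P a 0ℤ → P b c → P p q → P a′ 0ℤ × P b′ g
      inside {P} sub pa pb pp =
        subst₂ P combination′ (trans (cong (λ z → s * 0ℤ + r * z) second) (e₀ s r)) (add (multiple s pa) (multiple r
          (add (multiple q′ pb) (multiple (- c′) pp)))) ,
        subst (P b′) combination (add (multiple x pb) (multiple y pp))
        where
        open Subgroup sub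
        e₀ : ∀ s r → s * 0ℤ + r * 0ℤ ≡ 0ℤ
        e₀ = solve-∀
        e₁ : ∀ g c′ q′ → q′ * (g * c′) + - c′ * (g * q′) ≡ 0ℤ
        e₁ = solve-∀
        second : q′ * c + - c′ * q ≡ 0ℤ
        second = trans (cong₂ (λ c q → q′ * c + - c′ * q) c≡ q≡) (e₁ g c′ q′)

      H = Triangular a′ b′ g

      with-unit : ∀ z → z ≡ (x * c′ + y * q′) * z
      with-unit z = sym (trans (cong (_* z) unit) (*-identityˡ z))

      covers-a : H a 0ℤ
      covers-a = triangular a₁ 0ℤ (trans a≡ (trans (*-comm a′ a₁) (sym (trans (cong (λ z → a₁ * a′ + z) (*-zeroˡ b′)) (+-identityʳ (a₁ * a′)))))) (sym (*-zeroˡ g))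

      -- The passage from (b , c), (p , q) to (b′ , g), (k , 0) has determinant - 1 by `unit`, so it
      -- can be undone over ℤ.
      covers-b : H b c
      covers-b = triangular (y * k₁) c′ (trans (with-unit b) (trans (e x y c′ q′ b p) (cong (_+ c′ * b′) (trans (cong (y *_) k≡) (e′ y a′ k₁))))) (trans c≡ (*-comm g c′))
        where
        e : ∀ x y c′ q′ b p → (x * c′ + y * q′) * b ≡ y * (q′ * b + - c′ * p) + c′ * (x * b + y * p)
        e = solve-∀
        e′ : ∀ y a k → y * (a * k) ≡ y * k * a
        e′ = solve-∀

      covers-p : H p q
      covers-p = triangular (- x * k₁) q′ (trans (with-unit p) (trans (e x y c′ q′ b p) (cong (_+ q′ * b′) (trans (cong (- x *_) k≡) (e′ (- x) a′ k₁))))) (trans q≡ (*-comm g q′))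
        where
        e : ∀ x y c′ q′ b p → (x * c′ + y * q′) * p ≡ - x * (q′ * b + - c′ * p) + q′ * (x * b + y * p)
        e = solve-∀
        e′ : ∀ y a k → y * (a * k) ≡ y * k * a
        e′ = solve-∀

  -- The seeds (M , 0) and (0 , M) already have rank two, so a and c start nonzero and remain so
  -- when they are replaced by divisors.
  hermite : ∀ M → M ≢ 0ℤ → ∀ gens → Basis ((M , 0ℤ) ∷ (0ℤ , M) ∷ gens)
  hermite M M≢0 [] = record
    { a = M ; b = 0ℤ ; c = M ; a≢0 = M≢0 ; c≢0 = M≢0
    ; inside = λ { _ (pa ∷ pb ∷ []) → pa , pb }
    ; covers = triangular 1ℤ 0ℤ (e₁ M) (sym (*-zeroˡ M)) ∷ triangular 0ℤ 1ℤ (e₂ M) (sym (*-identityˡ M)) ∷ []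
    }
    where
    e₁ : ∀ M → M ≡ 1ℤ * M + 0ℤ * 0ℤ
    e₁ = solve-∀
    e₂ : ∀ M → 0ℤ ≡ 0ℤ * M + 1ℤ * 0ℤ
    e₂ = solve-∀
  hermite M M≢0 ((p , q) ∷ gens) = extend (hermite M M≢0 gens)
    where
    extend : Basis ((M , 0ℤ) ∷ (0ℤ , M) ∷ gens) → Basis ((M , 0ℤ) ∷ (0ℤ , M) ∷ (p , q) ∷ gens)
    extend basis = record
      { a = S.a′ ; b = S.b′ ; c = S.g
      ; a≢0 = S.factor≢0 B.a≢0 S.a≡ ; c≢0 = S.g≢0
      ; inside = λ { sub (m₁ ∷ m₂ ∷ pp ∷ rest) → let pa , pb = B.inside sub (m₁ ∷ m₂ ∷ rest) in S.inside sub pa pb pp }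
      ; covers = reorder (All.map (λ h → triangular⊆ (triangular-subgroup S.a′ S.b′ S.g) S.covers-a S.covers-b h) B.covers)
      }
      where
      module B = Basis basis
      module S = Step B.a B.b B.c p q B.a≢0 B.c≢0
      reorder : All (λ (p , q) → S.H p q) ((M , 0ℤ) ∷ (0ℤ , M) ∷ gens) → All (λ (p , q) → S.H p q) ((M , 0ℤ) ∷ (0ℤ , M) ∷ (p , q) ∷ gens)
      reorder (m₁ ∷ m₂ ∷ rest) = m₁ ∷ m₂ ∷ S.covers-p ∷ rest

-- Closure properties of unary lattices and common denominators

module Lattices where
  open import Data.Integer hiding (suc; pred)
  import Data.Integer.Properties as ℤ
  import Data.Integer.Tactic.RingSolver as ℤ-ring
  open import Data.List using ([]; _∷_)
  open import Data.Vec as Vec using (Vec; []; _∷_; zipWith; map; replicate)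
  open import Data.Vec.Relation.Unary.All as All using (All; []; _∷_)
  open import Data.Vec.Relation.Unary.Any using (Any; here; there)
  open CaseForms
  open QuadraticField using (module Order)

  module Lattice (c : Case) where
    open Field (dOf c)
    open Order c

    lincomb-⊕ : ∀ {k} (cs ds gs : Vec E k) → lincomb (zipWith _⊕_ cs ds) gs ≡ lincomb cs gs ⊕ lincomb ds gs
    lincomb-⊕ [] [] [] = sym (⊕-identityˡ 0E)
    lincomb-⊕ (x ∷ cs) (y ∷ ds) (g ∷ gs) = trans (cong₂ _⊕_ (⊗-distribʳ-⊕ g x y) (lincomb-⊕ cs ds gs))
      (interchange (x ⊗ g) (y ⊗ g) (lincomb cs gs) (lincomb ds gs))

    lincomb-⊗ : ∀ {k} s (cs gs : Vec E k) → lincomb (map (s ⊗_) cs) gs ≡ s ⊗ lincomb cs gs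
    lincomb-⊗ s [] [] = sym (⊗-zeroʳ s)
    lincomb-⊗ s (x ∷ cs) (g ∷ gs) = trans (cong₂ _⊕_ (⊗-assoc s x g) (lincomb-⊗ s cs gs)) (sym (⊗-distribˡ-⊕ s (x ⊗ g) (lincomb cs gs)))

    lincomb-0 : ∀ {k} (gs : Vec E k) → lincomb (replicate k 0E) gs ≡ 0E
    lincomb-0 [] = refl
    lincomb-0 (g ∷ gs) = trans (cong₂ _⊕_ (⊗-zeroˡ g) (lincomb-0 gs)) (⊕-identityˡ 0E)

    inO-0 : inO 0E
    inO-0 = (0ℤ , refl) , (0ℤ , refl)

    inO-1 : inO 1E
    inO-1 = (1ℤ , refl) , (0ℤ , refl)

    all-0 : ∀ k → All inO (replicate k 0E)
    all-0 zero = []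
    all-0 (suc k) = inO-0 ∷ all-0 k

    ∈L-⊕ : ∀ L {x y} → x ∈L L → y ∈L L → (x ⊕ y) ∈L L
    ∈L-⊕ L (cs , p , refl) (ds , q , refl) = zipWith _⊕_ cs ds , all p q , sym (lincomb-⊕ cs ds (gens L))
      where
      all : ∀ {k} {cs ds : Vec E k} → All inO cs → All inO ds → All inO (zipWith _⊕_ cs ds)
      all [] [] = []
      all (_∷_ {x = x} p ps) (_∷_ {x = y} q qs) = inO-⊕ x y p q ∷ all ps qs

    ∈L-⊗ : ∀ L {s x} → inO s → x ∈L L → (s ⊗ x) ∈L L
    ∈L-⊗ L {s} o (cs , p , refl) = map (s ⊗_) cs , all p , sym (lincomb-⊗ s cs (gens L))
      where
      all : ∀ {k} {cs : Vec E k} → All inO cs → All inO (map (s ⊗_) cs)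
      all [] = []
      all (_∷_ {x = x} p ps) = inO-⊗ s x o p ∷ all ps

    generators : ∀ {k} (gs : Vec E k) → All (λ g → ∃ λ cs → All inO cs × g ≡ lincomb cs gs) gs
    generators [] = []
    generators {suc k} (g ∷ gs) =
      (1E ∷ replicate k 0E , inO-1 ∷ all-0 k , sym (trans (cong₂ _⊕_ (⊗-identityˡ g) (lincomb-0 gs)) (⊕-identityʳ g)))
      ∷ All.map (λ { {x} (cs , p , e) → 0E ∷ cs , inO-0 ∷ p ,
          trans e (sym (trans (cong (_⊕ lincomb cs gs) (⊗-zeroˡ g)) (⊕-identityˡ (lincomb cs gs)))) }) (generators gs)

    record Submodule (P : E → Set) : Set where
      field
        zero∈ : P 0E
        add : ∀ x y → P x → P y → P (x ⊕ y)
        multiple : ∀ s x → inO s → P x → P (s ⊗ x)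

    lattice⊆ : ∀ {P : E → Set} → Submodule P → ∀ L → All P (gens L) → ∀ {x} → x ∈L L → P x
    lattice⊆ {P} sub L all (cs , o , refl) = go cs (gens L) o all
      where
      open Submodule sub
      go : ∀ {k} (cs gs : Vec E k) → All inO cs → All P gs → P (lincomb cs gs)
      go [] [] [] [] = zero∈
      go (c ∷ cs) (g ∷ gs) (o ∷ os) (p ∷ ps) = add (c ⊗ g) (lincomb cs gs) (multiple c g o p) (go cs gs os ps)

    integers : ∀ {k} → Vec (ℤ × ℤ) k → Vec E k
    integers = map (λ (p , q) → el p q)

    el-scalar : ∀ D u v → el D 0ℤ ⊗ el u v ≡ el (D * u) (D * v)
    el-scalar D u v = trans (el-⊗ D 0ℤ u v) (cong₂ el (e₁ (nℤ c) D u v) (e₂ (tℤ c) D u v))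
      where
      e₁ : ∀ n D u v → D * u - n * (0ℤ * v) ≡ D * u
      e₁ = ℤ-ring.solve-∀
      e₂ : ∀ t D u v → D * v + 0ℤ * u + t * (0ℤ * v) ≡ D * v
      e₂ = ℤ-ring.solve-∀

    el-ω : ∀ u v → el 0ℤ 1ℤ ⊗ el u v ≡ el (- (nℤ c * v)) (u + tℤ c * v)
    el-ω u v = trans (el-⊗ 0ℤ 1ℤ u v) (cong₂ el (e₁ (nℤ c) u v) (e₂ (tℤ c) u v))
      where
      e₁ : ∀ n u v → 0ℤ * u - n * (1ℤ * v) ≡ - (n * v)
      e₁ = ℤ-ring.solve-∀
      e₂ : ∀ t u v → 0ℤ * v + 1ℤ * u + t * (1ℤ * v) ≡ u + t * v
      e₂ = ℤ-ring.solve-∀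

    clear-all : ∀ {k} (xs : Vec E k) → ∃ λ D → D ≢ 0ℤ × ∃ λ ps → map (el D 0ℤ ⊗_) xs ≡ integers ps
    clear-all [] = 1ℤ , (λ ()) , [] , refl
    clear-all (x ∷ xs) = step (clear x) (clear-all xs)
      where
      scaled : ∀ {k} D D′ (xs : Vec E k) ps → map (el D′ 0ℤ ⊗_) xs ≡ integers ps →
        map (el (D * D′) 0ℤ ⊗_) xs ≡ integers (map (λ (p , q) → D * p , D * q) ps)
      scaled D D′ [] [] e = refl
      scaled D D′ (x ∷ xs) ((p , q) ∷ ps) e = cong₂ _∷_
        (trans (cong (_⊗ x) (trans (cong (el (D * D′)) (sym (ℤ.*-zeroʳ D))) (sym (el-scalar D D′ 0ℤ))))
          (trans (⊗-assoc (el D 0ℤ) (el D′ 0ℤ) x) (trans (cong (el D 0ℤ ⊗_) (cong Vec.head e)) (el-scalar D p q))))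
        (scaled D D′ xs ps (cong Vec.tail e))
      step : (∃ λ D → ∃₂ λ u v → D ≢ 0 × el (+ D) (+ 0) ⊗ x ≡ el u v) →
        (∃ λ D → D ≢ 0ℤ × ∃ λ ps → map (el D 0ℤ ⊗_) xs ≡ integers ps) →
        ∃ λ D → D ≢ 0ℤ × ∃ λ ps → map (el D 0ℤ ⊗_) (x ∷ xs) ≡ integers ps
      step (D , u , v , D≢0 , e) (D′ , D′≢0 , ps , es) = + D * D′ ,
        (λ e → [ (λ p → D≢0 (ℤ.+-injective p)) , D′≢0 ]′ (ℤ.i*j≡0⇒i≡0∨j≡0 (+ D) e)) ,
        (D′ * u , D′ * v) ∷ map (λ (p , q) → + D * p , + D * q) ps ,
        cong₂ _∷_
          (trans (cong (_⊗ x) (trans (cong₂ el (ℤ.*-comm (+ D) D′) (sym (ℤ.*-zeroʳ D′))) (sym (el-scalar D′ (+ D) 0ℤ))))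
            (trans (⊗-assoc (el D′ 0ℤ) (el (+ D) 0ℤ) x) (trans (cong (el D′ 0ℤ ⊗_) e) (el-scalar D′ u v))))
          (scaled (+ D) D′ xs ps es)

    nonzero-generator : ∀ L → ∃ λ g → g ∈L L × g ≢ 0E
    nonzero-generator L = go (gens L) (nonzero L) (generators (gens L))
      where
      go : ∀ {k} (gs : Vec E k) {P : E → Set} → Any (λ x → x ≢ 0E) gs → All P gs → ∃ λ g → P g × g ≢ 0E
      go (g ∷ gs) (here g≢0) (p ∷ _) = g , p , g≢0
      go (g ∷ gs) (there any) (_ ∷ ps) = go gs any ps

-- Every unary lattice is a multiple of ℤ A + ℤ (B + ω)

module Spans where
  open import Data.Integer hiding (suc; pred)
  import Data.Integer.Properties as ℤ
  import Data.Integer.Tactic.RingSolver as ℤ-ring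
  open import Data.List as List using (List; []; _∷_)
  import Data.List.Relation.Unary.All as List
  open import Data.Vec as Vec using (Vec; []; _∷_; map)
  open import Data.Vec.Relation.Unary.All using (All; []; _∷_)
  open CaseForms
  open HermiteNormalForm
  open QuadraticField using (module Order)
  open Lattices using (module Lattice)

  module Span (c : Case) where
    open Field (dOf c)
    open Order c
    open Lattice c

    private
      t₀ = tℤ c
      n₀ = nℤ c

    InSpan : E → ℤ → ℤ → E → Set
    InSpan γ A B x = ∃₂ λ u v → x ≡ γ ⊗ el (u * A + v * B) v

    -- L = γ (ℤ A + ℤ (B + ω)), where A C = N(B + ω)
    record IsSpan (L : UnaryLattice) : Set where
      field
        γ : E
        A B C : ℤ
        γ≢0 : γ ≢ 0E
        A≢0 : A ≢ 0ℤ
        AC≡ : A * C ≡ B * B + t₀ * B + n₀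
        ⊆span : ∀ {x} → x ∈L L → InSpan γ A B x
        span⊆ : ∀ u v → (γ ⊗ el (u * A + v * B) v) ∈L L

    private
      ω·_ : ℤ × ℤ → ℤ × ℤ
      ω· (p , q) = - (n₀ * q) , p + t₀ * q

      -- The normal form works over ℤ, so each generator over O contributes its ω-multiple as well.
      with-multiples : ∀ {k} → Vec (ℤ × ℤ) k → List (ℤ × ℤ)
      with-multiples [] = []
      with-multiples (p ∷ ps) = p ∷ ω· p ∷ with-multiples ps

    module FromGenerators (L : UnaryLattice) (γ₀ : E) (γ₀≢0 : γ₀ ≢ 0E) (D : ℤ) (D≢0 : D ≢ 0ℤ)
      (D∈ : (γ₀ ⊗ el D 0ℤ) ∈L L) (ps : Vec (ℤ × ℤ) (len L)) (gens≡ : gens L ≡ map (γ₀ ⊗_) (integers ps)) where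

      P : ℤ → ℤ → Set
      P x y = (γ₀ ⊗ el x y) ∈L L

      P-subgroup : Subgroup P
      P-subgroup = record
        { add = λ {a} {b} {e} {f} p q → subst (_∈L L) (trans (sym (⊗-distribˡ-⊕ γ₀ (el a b) (el e f))) (cong (γ₀ ⊗_) (sym (el-⊕ a b e f)))) (∈L-⊕ L p q)
        ; multiple = λ k {a} {b} p → subst (_∈L L) (trans (⊗-swap (el k 0ℤ) γ₀ (el a b)) (cong (γ₀ ⊗_) (el-scalar k a b))) (∈L-⊗ L (inO-el k 0ℤ) p)
        }

      P-ω : ∀ x y → P x y → P (- (n₀ * y)) (x + t₀ * y)
      P-ω x y p = subst (_∈L L) (trans (⊗-swap (el 0ℤ 1ℤ) γ₀ (el x y)) (cong (γ₀ ⊗_) (el-ω x y))) (∈L-⊗ L (inO-el 0ℤ 1ℤ) p)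

      P-gens : List.All (λ (p , q) → P p q) (with-multiples ps)
      P-gens = go (gens L) ps gens≡ (generators (gens L))
        where
        go : ∀ {k} (gs : Vec E k) ps → gs ≡ map (γ₀ ⊗_) (integers ps) → All (_∈L L) gs → List.All (λ (p , q) → P p q) (with-multiples ps)
        go [] [] _ [] = List.[]
        go (g ∷ gs) ((p , q) ∷ ps) e (g∈ ∷ gs∈) = pq List.∷ P-ω p q pq List.∷ go gs ps (cong Vec.tail e) gs∈
          where
          pq : P p q
          pq = subst (_∈L L) (cong Vec.head e) g∈

      0,D : P 0ℤ D
      0,D = subst₂ P (e₁ n₀) (e₂ t₀ D) (P-ω D 0ℤ D∈)
        where
        e₁ : ∀ n → - (n * 0ℤ) ≡ 0ℤ
        e₁ = ℤ-ring.solve-∀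
        e₂ : ∀ t D → D + t * 0ℤ ≡ D
        e₂ = ℤ-ring.solve-∀

      basis : Basis ((D , 0ℤ) ∷ (0ℤ , D) ∷ with-multiples ps)
      basis = hermite D D≢0 (with-multiples ps)

      module B = Basis basis
      H : ℤ → ℤ → Set
      H = Triangular B.a B.b B.c

      H-sub : Subgroup H
      H-sub = triangular-subgroup B.a B.b B.c

      private
        module HS = Subgroup H-sub

      -- multiplication by ω preserves the span, since ω² is an integral combination of 1 and ω
      Stable : ℤ → ℤ → Set
      Stable x y = H x y × H (- (n₀ * y)) (x + t₀ * y)

      Stable-sub : Subgroup Stable
      Stable-sub = record
        { add = λ { {a} {b} {e} {f} (p , q) (p′ , q′) → HS.add p p′ , subst₂ H (e₁ n₀ b f) (e₂ t₀ a b e f) (HS.add q q′) }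
        ; multiple = λ { k {a} {b} (p , q) → HS.multiple k p , subst₂ H (e₃ n₀ k b) (e₄ t₀ k a b) (HS.multiple k q) }
        }
        where
        e₁ : ∀ n b f → - (n * b) + - (n * f) ≡ - (n * (b + f))
        e₁ = ℤ-ring.solve-∀
        e₂ : ∀ t a b e f → a + t * b + (e + t * f) ≡ a + e + t * (b + f)
        e₂ = ℤ-ring.solve-∀
        e₃ : ∀ n k b → k * - (n * b) ≡ - (n * (k * b))
        e₃ = ℤ-ring.solve-∀
        e₄ : ∀ t k a b → k * (a + t * b) ≡ k * a + t * (k * b)
        e₄ = ℤ-ring.solve-∀

      stable-multiple : ∀ p q → H p q → H (- (n₀ * q)) (p + t₀ * q) →
        Stable p q × Stable (- (n₀ * q)) (p + t₀ * q)
      stable-multiple p q h h′ = (h , h′) , (h′ , subst₂ H (e₁ t₀ n₀ p q) (e₂ t₀ n₀ p q) (HS.add (HS.multiple t₀ h′) (HS.multiple (- n₀) h)))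
        where
        e₁ : ∀ t n p q → t * - (n * q) + - n * p ≡ - (n * (p + t * q))
        e₁ = ℤ-ring.solve-∀
        e₂ : ∀ t n p q → t * (p + t * q) + - n * q ≡ - (n * q) + t * (p + t * q)
        e₂ = ℤ-ring.solve-∀

      stable-gens : List.All (λ (p , q) → Stable p q) ((D , 0ℤ) ∷ (0ℤ , D) ∷ with-multiples ps)
      stable-gens with D,0 List.∷ 0,D List.∷ rest ← B.covers =
        proj₁ first List.∷ subst₂ Stable (e₁ n₀) (e₂ t₀ D) (proj₂ first) List.∷ go ps rest
        where
        e₁ : ∀ n → - (n * 0ℤ) ≡ 0ℤ
        e₁ = ℤ-ring.solve-∀
        e₂ : ∀ t D → D + t * 0ℤ ≡ D
        e₂ = ℤ-ring.solve-∀
        first : Stable D 0ℤ × Stable (- (n₀ * 0ℤ)) (D + t₀ * 0ℤ)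
        first = stable-multiple D 0ℤ D,0 (subst₂ H (sym (e₁ n₀)) (sym (e₂ t₀ D)) 0,D)
        go : ∀ {k} (ps : Vec (ℤ × ℤ) k) → List.All (λ (p , q) → H p q) (with-multiples ps) → List.All (λ (p , q) → Stable p q) (with-multiples ps)
        go [] List.[] = List.[]
        go ((p , q) ∷ ps) (h List.∷ h′ List.∷ hs) = let s , s′ = stable-multiple p q h h′ in s List.∷ s′ List.∷ go ps hs

      stable-basis : Stable B.a 0ℤ × Stable B.b B.c
      stable-basis = B.inside Stable-sub stable-gens

      P-basis : P B.a 0ℤ × P B.b B.c
      P-basis = B.inside P-subgroup (D∈ List.∷ 0,D List.∷ P-gens)

      stable : ∀ {x y} → H x y → Stable x y
      stable = triangular⊆ Stable-sub (proj₁ stable-basis) (proj₂ stable-basis)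

      record Shape : Set where
        field
          A B C : ℤ
          a≡ : B.a ≡ B.c * A
          b≡ : B.b ≡ B.c * B
          AC≡ : A * C ≡ B * B + t₀ * B + n₀

      private
        invert : ∀ {x y} → H x y → ∃₂ λ u v → x ≡ u * B.a + v * B.b × y ≡ v * B.c
        invert (combine u v) = u , v , refl , refl

      -- Multiplication by ω sends (a , 0) to (0 , a), so c divides a. It sends (b , c) to (- n c ,
      -- b + t c), so b + t c = v c and c divides b, with quotient B = v - t. The first coordinate
      -- of this image, divided by c, reads A (- u) = B² + t B + n.
      shape : Shape
      shape = go (invert (proj₂ (proj₁ stable-basis))) (invert (proj₂ (proj₂ stable-basis)))
        where
        instance _ = ≢-nonZero B.c≢0
        go : (∃₂ λ u v → - (n₀ * 0ℤ) ≡ u * B.a + v * B.b × B.a + t₀ * 0ℤ ≡ v * B.c) →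
             (∃₂ λ u v → - (n₀ * B.c) ≡ u * B.a + v * B.b × B.b + t₀ * B.c ≡ v * B.c) → Shape
        go (_ , A , _ , ea) (u , v , eu , ev) = record { A = A ; B = v - t₀ ; C = - u ; a≡ = a≡ ; b≡ = b≡
          ; AC≡ = ℤ.*-cancelˡ-≡ B.c (A * - u) ((v - t₀) * (v - t₀) + t₀ * (v - t₀) + n₀)
              (trans (e₁ B.c A u v t₀) (trans (cong (λ z → v * (B.c * (v - t₀)) - z) (trans (cong₂ (λ a b → u * a + v * b) (sym a≡) (sym b≡)) (sym eu)))
                (e₂ B.c v t₀ n₀))) }
          where
          e₀ : ∀ a t → a ≡ a + t * 0ℤ
          e₀ = ℤ-ring.solve-∀
          a≡ : B.a ≡ B.c * A
          a≡ = trans (e₀ B.a t₀) (trans ea (ℤ.*-comm A B.c))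
          e₃ : ∀ b t c → b ≡ b + t * c - t * c
          e₃ = ℤ-ring.solve-∀
          e₄ : ∀ v t c → v * c - t * c ≡ c * (v - t)
          e₄ = ℤ-ring.solve-∀
          b≡ : B.b ≡ B.c * (v - t₀)
          b≡ = trans (e₃ B.b t₀ B.c) (trans (cong (_- t₀ * B.c) ev) (e₄ v t₀ B.c))
          e₁ : ∀ c A u v t → c * (A * - u) ≡ v * (c * (v - t)) - (u * (c * A) + v * (c * (v - t)))
          e₁ = ℤ-ring.solve-∀
          e₂ : ∀ c v t n → v * (c * (v - t)) - - (n * c) ≡ c * ((v - t) * (v - t) + t * (v - t) + n)
          e₂ = ℤ-ring.solve-∀

      module S = Shape shape

      private
        rescale : ∀ u v → γ₀ ⊗ el (u * B.a + v * B.b) (v * B.c) ≡ (γ₀ ⊗ el B.c 0ℤ) ⊗ el (u * S.A + v * S.B) v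
        rescale u v = trans (cong (γ₀ ⊗_) (trans
            (cong₂ el (trans (cong₂ (λ a b → u * a + v * b) S.a≡ S.b≡) (e B.c S.A S.B u v)) (ℤ.*-comm v B.c))
            (sym (el-scalar B.c (u * S.A + v * S.B) v))))
          (sym (⊗-assoc γ₀ (el B.c 0ℤ) (el (u * S.A + v * S.B) v)))
          where
          e : ∀ c A B u v → u * (c * A) + v * (c * B) ≡ c * (u * A + v * B)
          e = ℤ-ring.solve-∀

      Q : E → Set
      Q x = ∃₂ λ y z → H y z × x ≡ γ₀ ⊗ el y z

      Q-submodule : Submodule Q
      Q-submodule = record
        { zero∈ = 0ℤ , 0ℤ , triangular 0ℤ 0ℤ (e₀ B.a B.b) (sym (ℤ.*-zeroˡ B.c)) , sym (⊗-zeroʳ γ₀)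
        ; add = λ { x y (p , q , h , ex) (p′ , q′ , h′ , ey) → p + p′ , q + q′ , HS.add h h′ ,
            trans (cong₂ _⊕_ ex ey) (trans (sym (⊗-distribˡ-⊕ γ₀ (el p q) (el p′ q′))) (cong (γ₀ ⊗_) (sym (el-⊕ p q p′ q′)))) }
        ; multiple = λ s x o (p , q , h , ex) → multiple s x (el-inO o) p q h ex
        }
        where
        e₀ : ∀ a b → 0ℤ ≡ 0ℤ * a + 0ℤ * b
        e₀ = ℤ-ring.solve-∀
        e₁ : ∀ n i j p q → i * p + j * - (n * q) ≡ i * p - n * (j * q)
        e₁ = ℤ-ring.solve-∀
        e₂ : ∀ t i j p q → i * q + j * (p + t * q) ≡ i * q + j * p + t * (j * q)
        e₂ = ℤ-ring.solve-∀
        multiple : ∀ s x → (∃₂ λ i j → s ≡ el i j) → ∀ p q → H p q → x ≡ γ₀ ⊗ el p q → Q (s ⊗ x)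
        multiple s x (i , j , es) p q h ex = i * p - n₀ * (j * q) , i * q + j * p + t₀ * (j * q) ,
          subst₂ H (e₁ n₀ i j p q) (e₂ t₀ i j p q) (HS.add (HS.multiple i h) (HS.multiple j (proj₂ (stable h)))) ,
          trans (cong₂ _⊗_ es ex) (trans (⊗-swap (el i j) γ₀ (el p q)) (cong (γ₀ ⊗_) (el-⊗ i j p q)))

      Q-gens : All Q (gens L)
      Q-gens = subst (All Q) (sym gens≡) (go ps (rest B.covers))
        where
        rest : ∀ {x y l} → List.All (λ (p , q) → H p q) (x ∷ y ∷ l) → List.All (λ (p , q) → H p q) l
        rest (_ List.∷ _ List.∷ l) = l
        go : ∀ {k} (ps : Vec (ℤ × ℤ) k) → List.All (λ (p , q) → H p q) (with-multiples ps) → All Q (map (γ₀ ⊗_) (integers ps))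
        go [] _ = []
        go ((p , q) ∷ ps) (h List.∷ _ List.∷ hs) = (p , q , h , refl) ∷ go ps hs

      isSpan : IsSpan L
      isSpan = record
        { γ = γ₀ ⊗ el B.c 0ℤ ; A = S.A ; B = S.B ; C = S.C
        ; γ≢0 = ⊗-nonzero γ₀≢0 (el-nonzero B.c≢0)
        ; A≢0 = λ e → B.a≢0 (trans S.a≡ (trans (cong (B.c *_) e) (ℤ.*-zeroʳ B.c)))
        ; AC≡ = S.AC≡
        ; ⊆span = λ p → from (lattice⊆ Q-submodule L Q-gens p)
        ; span⊆ = λ u v → subst (_∈L L) (rescale u v) (triangular⊆ P-subgroup (proj₁ P-basis) (proj₂ P-basis) (combine u v))
        }
        where
        from : ∀ {x} → Q x → InSpan (γ₀ ⊗ el B.c 0ℤ) S.A S.B x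
        from (y , z , h , ex) = go (invert h)
          where
          go : (∃₂ λ u v → y ≡ u * B.a + v * B.b × z ≡ v * B.c) → _
          go (u , v , ey , ez) = u , v , trans ex (trans (cong₂ (λ y z → γ₀ ⊗ el y z) ey ez) (rescale u v))

    -- Dividing by a nonzero lattice element g puts 1 into the lattice, and a common denominator D
    -- makes the generators integral. For γ₀ = g / D the element γ₀ D = g lies in L and provides the
    -- seeds of the normal form.
    isSpan : ∀ L → IsSpan L
    isSpan L = go (nonzero-generator L)
      where
      go : (∃ λ g → g ∈L L × g ≢ 0E) → IsSpan L
      go (g , g∈ , g≢0) = go₁ (inverse g g≢0)
        where
        go₁ : (∃ λ g⁻¹ → g⁻¹ ⊗ g ≡ 1E) → IsSpan L
        go₁ (g⁻¹ , inv) = go₂ (clear-all (map (g⁻¹ ⊗_) (gens L)))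
          where
          go₂ : (∃ λ D → D ≢ 0ℤ × ∃ λ ps → map (el D 0ℤ ⊗_) (map (g⁻¹ ⊗_) (gens L)) ≡ integers ps) → IsSpan L
          go₂ (D , D≢0 , ps , eps) = go₃ (inverse (el D 0ℤ) (el-nonzero D≢0))
            where
            go₃ : (∃ λ δ → δ ⊗ el D 0ℤ ≡ 1E) → IsSpan L
            go₃ (δ , δD) = FromGenerators.isSpan L (g ⊗ δ) γ₀≢0 D D≢0 (subst (_∈L L) (sym γ₀D) g∈) ps
                (trans (recover (gens L)) (cong (map ((g ⊗ δ) ⊗_)) eps))
              where
              γ₀D : (g ⊗ δ) ⊗ el D 0ℤ ≡ g
              γ₀D = trans (⊗-assoc g δ (el D 0ℤ)) (trans (cong (g ⊗_) δD) (⊗-identityʳ g))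
              γ₀≢0 : g ⊗ δ ≢ 0E
              γ₀≢0 e = g≢0 (trans (sym γ₀D) (trans (cong (_⊗ el D 0ℤ) e) (⊗-zeroˡ (el D 0ℤ))))
              recover : ∀ {k} (gs : Vec E k) → gs ≡ map ((g ⊗ δ) ⊗_) (map (el D 0ℤ ⊗_) (map (g⁻¹ ⊗_) gs))
              recover [] = refl
              recover (x ∷ gs) = cong₂ _∷_ (sym (trans (sym (⊗-assoc (g ⊗ δ) (el D 0ℤ) (g⁻¹ ⊗ x))) (trans (cong (_⊗ (g⁻¹ ⊗ x)) γ₀D)
                (trans (⊗-swap g g⁻¹ x) (cancel-inverse g g⁻¹ x inv))))) (recover gs)

-- Gauss reduction and the two ideal classes

module Reduction where
  open import Data.Bool using (Bool; true; _∧_; _∨_; not; T)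
  open import Data.Bool.Properties using (T-∧; T-∨)
  open import Data.Nat using (_≡ᵇ_)
  open import Data.Nat.Induction using (<-rec)
  open import Data.Integer hiding (suc; pred)
  import Data.Integer.Properties as ℤ
  open import Data.Nat.DivMod using (m*n%n≡0)
  open import Data.Integer.DivMod using (_/ℕ_; _%ℕ_; a≡a%ℕn+[a/ℕn]*n)
  open import Data.Integer.Tactic.RingSolver using (solve-∀)
  open import Data.Unit using (tt)
  open import Function.Bundles using (Equivalence)
  open Integers
  open Residues using (below; below-sound)
  open CaseForms
  open LowerBound using (disc; principal≥0; principal≡0)
  open QuadraticField using (module Order)
  open Lattices using (module Lattice)
  open Spans using (module Span)

  normω : Case → ℤ → ℤ
  normω c B = B * B + tℤ c * B + nℤ c

  -- Membership of ℤ a + ℤ (r + ω) in the principal class or in the class of ℤ k + ℤ β: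
  -- directly, or after a shift of r by s a followed by the inversion A ↔ C.
  direct : Case → ℕ → ℤ → Bool
  direct c a r = (a ≡ᵇ kOf c) ∧ ((r - βa c) %ℕ kOf c ≡ᵇ 0)

  inverted : Case → ℕ → ℤ → ℤ → Bool
  inverted c a r s = (∣ normω c B ∣ ≡ᵇ a ℕ.* kOf c) ∧ ((- B - tℤ c - βa c) %ℕ kOf c ≡ᵇ 0)
    where B = r + s * + a

  two-classes : Case → ℕ → ℤ → Bool
  two-classes c a r = (a ≡ᵇ 1) ∨ direct c a r ∨ inverted c a r -1ℤ ∨ inverted c a r 0ℤ ∨ inverted c a r 1ℤ

  reduced : Case → (a : ℕ) .{{_ : ℕ.NonZero a}} → ℤ → Bool
  reduced c a r = (∣ normω c r ∣ ℕ.% a ≡ᵇ 0) ∧ (a ℕ.* a ℕ.≤ᵇ ∣ normω c r ∣)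
    ∧ (0ℤ ≤ᵇ + a - (+ 2 * r + tℤ c)) ∧ (0ℤ ≤ᵇ + a + (+ 2 * r + tℤ c) - 1ℤ)

  private
    -- The ranges 1 ≤ a ≤ 11 and - 6 ≤ r ≤ 5 contain all reduced ideals: 3 a² ≤ `disc c` ≤ 427
    -- forces a ≤ 11, and |2 r + t| ≤ a then bounds r.
    table : Case → Bool
    table c = below 11 λ j → below 12 λ i → not (reduced c (suc j) (+ i - + 6)) ∨ two-classes c (suc j) (+ i - + 6)

  opaque
    class-number-two : ∀ c → T (table c)
    class-number-two = every-case table tt

  private
    modus-ponens : ∀ {b b′} → T (not b ∨ b′) → T b → T b′
    modus-ponens {true} t _ = t

    disc≤427 : ∀ c → 0ℤ ≤ + 427 - disc c
    disc≤427 c = ℤ.≤ᵇ⇒≤ (every-case (λ c → 0ℤ ≤ᵇ + 427 - disc c) tt c)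

    t≥0 : ∀ c → 0ℤ ≤ tℤ c
    t≥0 c = ℤ.≤ᵇ⇒≤ (every-case (λ c → 0ℤ ≤ᵇ tℤ c) tt c)

    t≤1 : ∀ c → 0ℤ ≤ 1ℤ - tℤ c
    t≤1 c = ℤ.≤ᵇ⇒≤ (every-case (λ c → 0ℤ ≤ᵇ 1ℤ - tℤ c) tt c)

    module Bounds (a e : ℕ) (r t n D : ℤ) (D≡ : D ≡ + 4 * n - t * t)
      (N≡ : + a * (+ a + + e) ≡ r * r + t * r + n)
      (hi : 0ℤ ≤ + a - (+ 2 * r + t)) (lo : 0ℤ ≤ + a + (+ 2 * r + t) - 1ℤ)
      (D≤ : 0ℤ ≤ + 427 - D) (0≤t : 0ℤ ≤ t) (t≤ : 0ℤ ≤ 1ℤ - t) where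
      X = + 2 * r + t

      -- D = 4 a (a + e) - X², where X² ≤ a².
      3a²≤D : 0ℤ ≤ D - + 3 * (+ a * + a)
      3a²≤D = subst (0ℤ ≤_) (trans (e₁ (+ a) (+ e) r t) (trans (cong (λ z → + 4 * z - X * X - + 3 * (+ a * + a)) N≡)
          (trans (e₂ (+ a) r t n) (cong (_- + 3 * (+ a * + a)) (sym D≡)))))
        (0≤m+n (square-bound (+ a) X hi (subst (0ℤ ≤_) (e₀ (+ a) X) (0≤m+n lo (0≤+ 1)))) (0≤m*n (0≤+ 4) (0≤m*n (0≤+ a) (0≤+ e))))
        where
        e₀ : ∀ a x → a + x - 1ℤ + 1ℤ ≡ a + x
        e₀ = solve-∀
        e₁ : ∀ a e r t → let X = + 2 * r + t in
          a * a - X * X + + 4 * (a * e) ≡ + 4 * (a * (a + e)) - X * X - + 3 * (a * a)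
        e₁ = solve-∀
        e₂ : ∀ a r t n → let X = + 2 * r + t in
          + 4 * (r * r + t * r + n) - X * X - + 3 * (a * a) ≡ + 4 * n - t * t - + 3 * (a * a)
        e₂ = solve-∀

      3a²≤427 : 3 ℕ.* (a ℕ.* a) ℕ.≤ 427
      3a²≤427 = ℤ.drop‿+≤+ (subst (_≤ + 427) (trans (cong (+ 3 *_) (sym (ℤ.pos-* a a))) (sym (ℤ.pos-* 3 (a ℕ.* a))))
        (ℤ.0≤i-j⇒j≤i (subst (0ℤ ≤_) (e₁ D (+ 3 * (+ a * + a))) (0≤m+n D≤ 3a²≤D))))
        where
        e₁ : ∀ D s → + 427 - D + (D - s) ≡ + 427 - s
        e₁ = solve-∀

      a≤11 : a ℕ.≤ 11
      a≤11 with a ℕ.≤? 11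
      ... | yes p = p
      ... | no p = contradiction 3a²≤427 (ℕ.<⇒≱ (ℕ.≤-trans (ℕ.≤ᵇ⇒≤ 428 432 tt) (ℕ.*-monoʳ-≤ 3 (ℕ.*-mono-≤ (ℕ.≰⇒> p) (ℕ.≰⇒> p)))))

      0≤11-a : 0ℤ ≤ + 11 - + a
      0≤11-a = ℤ.i≤j⇒0≤j-i (+≤+ a≤11)

      index : ∃ λ i → i ℕ.< 12 × r ≡ + i - + 6
      index = go (0≤⇒+ low)
        where
        e₁ : ∀ a r t → (a + (+ 2 * r + t) - 1ℤ) + (+ 11 - a) + (1ℤ - t) + + 2 ≡ + 2 * (r + + 6) + + 1
        e₁ = solve-∀
        e₂ : ∀ a r t → (a - (+ 2 * r + t)) + (+ 11 - a) + t ≡ + 2 * (+ 11 - (r + + 6)) + + 1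
        e₂ = solve-∀
        low : 0ℤ ≤ r + + 6
        low = 0≤-div 2 (r + + 6) (subst (0ℤ ≤_) (e₁ (+ a) r t) (0≤m+n (0≤m+n (0≤m+n lo 0≤11-a) t≤) (0≤+ 2)))
        high : 0ℤ ≤ + 11 - (r + + 6)
        high = 0≤-div 2 (+ 11 - (r + + 6)) (subst (0ℤ ≤_) (e₂ (+ a) r t) (0≤m+n (0≤m+n hi 0≤11-a) 0≤t))
        e₃ : ∀ r → r ≡ r + + 6 - + 6
        e₃ = solve-∀
        go : (∃ λ i → r + + 6 ≡ + i) → ∃ λ i → i ℕ.< 12 × r ≡ + i - + 6
        go (i , ei) = i , s≤s (ℤ.drop‿+≤+ (ℤ.0≤i-j⇒j≤i (subst (λ z → 0ℤ ≤ + 11 - z) ei high))) , trans (e₃ r) (cong (_- + 6) ei)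

  reduced⇒two-classes : ∀ c a .{{_ : ℕ.NonZero a}} e r → + a * (+ a + + e) ≡ normω c r →
    0ℤ ≤ + a - (+ 2 * r + tℤ c) → 0ℤ ≤ + a + (+ 2 * r + tℤ c) - 1ℤ → T (two-classes c a r)
  reduced⇒two-classes c (suc j) e r N≡ hi lo = go j e r N≡ hi lo (proj₂ index) a≤11
    where
    open Bounds (suc j) e r (tℤ c) (nℤ c) (disc c) refl N≡ hi lo (disc≤427 c) (t≥0 c) (t≤1 c)
    go : ∀ j e r → + suc j * (+ suc j + + e) ≡ normω c r → 0ℤ ≤ + suc j - (+ 2 * r + tℤ c) → 0ℤ ≤ + suc j + (+ 2 * r + tℤ c) - 1ℤ →
      ∀ {i} → i ℕ.< 12 × r ≡ + i - + 6 → suc j ℕ.≤ 11 → T (two-classes c (suc j) r)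
    go j e r N≡ hi lo {i} (i<12 , refl) a≤11 = modus-ponens {reduced c (suc j) r}
      (below-sound 12 (λ i → not (reduced c (suc j) (+ i - + 6)) ∨ two-classes c (suc j) (+ i - + 6))
        (below-sound 11 (λ j → below 12 λ i → not (reduced c (suc j) (+ i - + 6)) ∨ two-classes c (suc j) (+ i - + 6)) (class-number-two c) a≤11) i<12)
      (Equivalence.from (T-∧ {∣ normω c r ∣ ℕ.% suc j ≡ᵇ 0}) (ℕ.≡⇒≡ᵇ (∣ normω c r ∣ ℕ.% suc j) 0 divisible
        , Equivalence.from (T-∧ {suc j ℕ.* suc j ℕ.≤ᵇ ∣ normω c r ∣}) (ℕ.≤⇒≤ᵇ a²≤N
        , Equivalence.from (T-∧ {0ℤ ≤ᵇ + suc j - (+ 2 * r + tℤ c)}) (ℤ.≤⇒≤ᵇ hi , ℤ.≤⇒≤ᵇ lo))))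
      where
      ∣N∣ : ∣ normω c r ∣ ≡ suc j ℕ.* (suc j ℕ.+ e)
      ∣N∣ = trans (cong ∣_∣ (sym N≡)) (ℤ.abs-* (+ suc j) (+ suc j + + e))
      divisible : ∣ normω c r ∣ ℕ.% suc j ≡ 0
      divisible = trans (cong (ℕ._% suc j) (trans ∣N∣ (ℕ.*-comm (suc j) (suc j ℕ.+ e)))) (m*n%n≡0 (suc j ℕ.+ e) (suc j))
      a²≤N : suc j ℕ.* suc j ℕ.≤ ∣ normω c r ∣
      a²≤N = subst (suc j ℕ.* suc j ℕ.≤_) (sym ∣N∣) (ℕ.*-monoʳ-≤ (suc j) (ℕ.m≤m+n (suc j) e))

  module Reduce (c : Case) where
    open Field (dOf c)
    open Order c
    open Lattice c
    open Span c

    private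
      t₀ = tℤ c
      n₀ = nℤ c

    N[_+ω] : ℤ → ℤ
    N[ B +ω] = normω c B

    record SpanOf (L : UnaryLattice) (A B : ℤ) : Set where
      field
        γ : E
        γ≢0 : γ ≢ 0E
        ⊆span : ∀ {x} → x ∈L L → InSpan γ A B x
        span⊆ : ∀ u v → (γ ⊗ el (u * A + v * B) v) ∈L L

    module _ {L : UnaryLattice} where

      -- The functions f and g are the two directions of a change of ℤ-basis, and γ′ absorbs the
      -- factor by which the ideal is rescaled.
      reparametrise : ∀ {A B A′ B′} (s : SpanOf L A B) (γ′ : E) → γ′ ≢ 0E →
        (f g : ℤ → ℤ → ℤ × ℤ) →
        (∀ u v → let u′ , v′ = f u v in SpanOf.γ s ⊗ el (u * A + v * B) v ≡ γ′ ⊗ el (u′ * A′ + v′ * B′) v′) →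
        (∀ u v → let u′ , v′ = g u v in γ′ ⊗ el (u * A′ + v * B′) v ≡ SpanOf.γ s ⊗ el (u′ * A + v′ * B) v′) →
        SpanOf L A′ B′
      reparametrise {A} {B} {A′} {B′} s γ′ γ′≢0 f g ef eg = record
        { γ = γ′ ; γ≢0 = γ′≢0
        ; ⊆span = λ p → let u , v , e = SpanOf.⊆span s p in proj₁ (f u v) , proj₂ (f u v) , trans e (ef u v)
        ; span⊆ = λ u v → subst (_∈L L) (sym (eg u v)) (SpanOf.span⊆ s (proj₁ (g u v)) (proj₂ (g u v)))
        }

      shift : ∀ {A B} κ → SpanOf L A B → SpanOf L A (B + κ * A)
      shift {A} {B} κ s = reparametrise s γ γ≢0 (λ u v → u - v * κ , v) (λ u v → u + v * κ , v)
        (λ u v → cong (λ z → γ ⊗ el z v) (e₁ u v A B κ)) (λ u v → cong (λ z → γ ⊗ el z v) (e₂ u v A B κ))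
        where
        open SpanOf s
        e₁ : ∀ u v A B κ → u * A + v * B ≡ (u - v * κ) * A + v * (B + κ * A)
        e₁ = solve-∀
        e₂ : ∀ u v A B κ → u * A + v * (B + κ * A) ≡ (u + v * κ) * A + v * B
        e₂ = solve-∀

      negate : ∀ {A B} → SpanOf L A B → SpanOf L (- A) B
      negate {A} {B} s = reparametrise s γ γ≢0 (λ u v → - u , v) (λ u v → - u , v)
        (λ u v → cong (λ z → γ ⊗ el z v) (e₁ u v A B)) (λ u v → cong (λ z → γ ⊗ el z v) (e₂ u v A B))
        where
        open SpanOf s
        e₁ : ∀ u v A B → u * A + v * B ≡ - u * - A + v * B
        e₁ = solve-∀
        e₂ : ∀ u v A B → u * - A + v * B ≡ - u * A + v * B
        e₂ = solve-∀

      -- (B + ω) (ℤ C + ℤ (- B - t + ω)) = C (ℤ A + ℤ (B + ω)) because (B + ω) (- B - t + ω) = - A C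
      invert : ∀ {A B C} → C ≢ 0ℤ → A * C ≡ N[ B +ω] → SpanOf L A B → SpanOf L C (- B - t₀)
      invert {A} {B} {C} C≢0 AC s = go (inverse (el C 0ℤ) (el-nonzero C≢0))
        where
        open SpanOf s
        e₁ : ∀ t n u v A B C → B * (u * C + v * (- B - t)) - n * (1ℤ * v) ≡
          C * (u * B) - v * (B * B + t * B + n)
        e₁ t n u v A B C = e t n u v B C
          where
          e : ∀ t n u v B C → B * (u * C + v * (- B - t)) - n * (1ℤ * v) ≡
            C * (u * B) - v * (B * B + t * B + n)
          e = solve-∀
        e₂ : ∀ u v A B C → C * (u * B) - v * (A * C) ≡ C * (- v * A + u * B)
        e₂ = solve-∀
        e₃ : ∀ t u v B C → B * v + 1ℤ * (u * C + v * (- B - t)) + t * (1ℤ * v) ≡ C * u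
        e₃ = solve-∀
        key : ∀ u v → el B 1ℤ ⊗ el (u * C + v * (- B - t₀)) v ≡ el C 0ℤ ⊗ el (- v * A + u * B) u
        key u v = trans (el-⊗ B 1ℤ (u * C + v * (- B - t₀)) v) (trans (cong₂ el
          (trans (e₁ t₀ n₀ u v A B C) (trans (cong (λ z → C * (u * B) - v * z) (sym AC)) (e₂ u v A B C)))
          (e₃ t₀ u v B C)) (sym (el-scalar C (- v * A + u * B) u)))
        go : (∃ λ δ → δ ⊗ el C 0ℤ ≡ 1E) → SpanOf L C (- B - t₀)
        go (δ , inv) = reparametrise s γ′ γ′≢0 (λ u v → v , - u) (λ u v → - v , u)
          (λ u v → sym (trans (main v (- u)) (cong (λ z → γ ⊗ el (z * A + v * B) v) (ℤ.neg-involutive u)))) main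
          where
          γ′ = γ ⊗ (δ ⊗ el B 1ℤ)
          main : ∀ u v → γ′ ⊗ el (u * C + v * (- B - t₀)) v ≡ γ ⊗ el (- v * A + u * B) u
          main u v = trans (⊗-assoc γ (δ ⊗ el B 1ℤ) w) (cong (γ ⊗_) (trans (⊗-assoc δ (el B 1ℤ) w)
            (trans (cong (δ ⊗_) (key u v)) (cancel-inverse (el C 0ℤ) δ (el (- v * A + u * B) u) inv))))
            where w = el (u * C + v * (- B - t₀)) v
          δ≢0 : δ ≢ 0E
          δ≢0 e = 1E≢0E (trans (sym inv) (trans (cong (_⊗ el C 0ℤ) e) (⊗-zeroˡ (el C 0ℤ))))
          γ′≢0 : γ′ ≢ 0E
          γ′≢0 = ⊗-nonzero γ≢0 (⊗-nonzero δ≢0 (el-nonzero′ {B} {1ℤ} (λ ())))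

      Classified : Set
      Classified = SpanOf L 1ℤ 0ℤ ⊎ SpanOf L (+ kOf c) (βa c)

      private
        zero-residue : ∀ z k .{{_ : ℕ.NonZero k}} → T (z %ℕ k ≡ᵇ 0) → ∃ λ q → z ≡ q * + k
        zero-residue z k e = z /ℕ k , trans (a≡a%ℕn+[a/ℕn]*n z k) (trans (cong (λ r → + r + z /ℕ k * + k) (ℕ.≡ᵇ⇒≡ (z %ℕ k) 0 e)) (ℤ.+-identityˡ (z /ℕ k * + k)))

        to-β : ∀ {B} → T ((B - βa c) %ℕ kOf c ≡ᵇ 0) → SpanOf L (+ kOf c) B → SpanOf L (+ kOf c) (βa c)
        to-β {B} e s = go (zero-residue (B - βa c) (kOf c) e)
          where
          e₁ : ∀ B b q k → B - b ≡ q * k → B + - q * k ≡ b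
          e₁ B b q k eq = trans (cong (λ z → B + z) (trans (sym (ℤ.neg-distribˡ-* q k)) (cong -_ (sym eq)))) (e₂ B b)
            where
            e₂ : ∀ B b → B + - (B - b) ≡ b
            e₂ = solve-∀
          go : (∃ λ q → B - βa c ≡ q * + kOf c) → SpanOf L (+ kOf c) (βa c)
          go (q , eq) = subst (SpanOf L (+ kOf c)) (e₁ B (βa c) q (+ kOf c) eq) (shift (- q) s)

        normω-shift : ∀ A B κ C → A * C ≡ normω c B → A * (C + + 2 * κ * B + t₀ * κ + κ * κ * A) ≡ normω c (B + κ * A)
        normω-shift A B κ C eq = trans (e₁ t₀ A B κ C) (trans (cong (_+ (A * (+ 2 * κ * B + t₀ * κ + κ * κ * A))) eq) (e₂ t₀ n₀ A B κ))
          where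
          e₁ : ∀ t A B κ C → A * (C + + 2 * κ * B + t * κ + κ * κ * A) ≡ A * C + A * (+ 2 * κ * B + t * κ + κ * κ * A)
          e₁ = solve-∀
          e₂ : ∀ t n A B κ → B * B + t * B + n + A * (+ 2 * κ * B + t * κ + κ * κ * A) ≡
            (B + κ * A) * (B + κ * A) + t * (B + κ * A) + n
          e₂ = solve-∀

        normω≡principal : ∀ B → normω c B ≡ principal c B 1ℤ
        normω≡principal B = e t₀ n₀ B
          where
          e : ∀ t n B → B * B + t * B + n ≡ 1ℤ * (B * B) + t * (B * 1ℤ) + n * (1ℤ * 1ℤ)
          e = solve-∀

        normω≥0 : ∀ B → 0ℤ ≤ normω c B
        normω≥0 B = subst (0ℤ ≤_) (sym (normω≡principal B)) (principal≥0 c B 1ℤ)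

        normω≢0 : ∀ B → normω c B ≢ 0ℤ
        normω≢0 B e = contradiction (proj₂ (principal≡0 c B 1ℤ (trans (sym (normω≡principal B)) e))) λ ()

        cofactor-positive : ∀ a .{{_ : ℕ.NonZero a}} B C → + a * C ≡ normω c B → ∃ λ m → C ≡ + suc m
        cofactor-positive a B C eq = go (0≤⇒+ C≥0)
          where
          C≥0 : 0ℤ ≤ C
          C≥0 = ℤ.*-cancelˡ-≤-pos 0ℤ C (+ a) {{positive (+<+ (ℕ.>-nonZero⁻¹ a))}}
            (subst₂ _≤_ (sym (ℤ.*-zeroʳ (+ a))) (sym eq) (normω≥0 B))
          go : (∃ λ m → C ≡ + m) → ∃ λ m → C ≡ + suc m
          go (zero , e) = contradiction (trans (sym eq) (trans (cong (+ a *_) e) (ℤ.*-zeroʳ (+ a)))) (normω≢0 B)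
          go (suc m , e) = m , e

        -- The equation a k = N(B + ω) makes k the first parameter after inversion. The second one,
        -- - B - t, is congruent to `βa c` modulo k, so one more shift completes the match.
        from-inverted : ∀ a .{{_ : ℕ.NonZero a}} r s → T (inverted c a r s) → SpanOf L (+ a) r → SpanOf L (+ kOf c) (βa c)
        from-inverted a r s t span = to-β (proj₂ split) (invert (λ ()) norm≡ (shift s span))
          where
          B = r + s * + a
          split = Equivalence.to (T-∧ {∣ normω c B ∣ ≡ᵇ a ℕ.* kOf c}) t
          norm≡ : + a * + kOf c ≡ normω c B
          norm≡ = trans (sym (ℤ.pos-* a (kOf c))) (trans (cong +_ (sym (ℕ.≡ᵇ⇒≡ (∣ normω c B ∣) (a ℕ.* kOf c) (proj₁ split)))) (ℤ.0≤i⇒+∣i∣≡i (normω≥0 B)))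

        from-two-classes : ∀ a .{{_ : ℕ.NonZero a}} r → T (two-classes c a r) → SpanOf L (+ a) r → Classified
        from-two-classes a r t span = [ principal-class , [ direct-class , inverted-class ]′ ]′ split
          where
          split = [ inj₁ , (λ u → inj₂ (Equivalence.to (T-∨ {direct c a r}) u)) ]′ (Equivalence.to (T-∨ {a ≡ᵇ 1}) t)
          principal-class : T (a ≡ᵇ 1) → Classified
          principal-class e = inj₁ (subst₂ (SpanOf L) (cong +_ a≡1) (trans (cong (λ a → r + - r * + a) a≡1) (e₁ r)) (shift (- r) span))
            where
            a≡1 = ℕ.≡ᵇ⇒≡ a 1 e
            e₁ : ∀ r → r + - r * 1ℤ ≡ 0ℤ
            e₁ = solve-∀
          direct-class : T (direct c a r) → Classified
          direct-class u = let e , d = Equivalence.to (T-∧ {a ≡ᵇ kOf c}) u in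
            inj₂ (to-β d (subst (λ a → SpanOf L (+ a) r) (ℕ.≡ᵇ⇒≡ a (kOf c) e) span))
          inverted-class : T (inverted c a r -1ℤ ∨ inverted c a r 0ℤ ∨ inverted c a r 1ℤ) → Classified
          inverted-class u = inj₂ ([ (λ v → from-inverted a r -1ℤ v span) , (λ v →
            [ (λ w → from-inverted a r 0ℤ w span) , (λ w → from-inverted a r 1ℤ w span) ]′ (Equivalence.to (T-∨ {inverted c a r 0ℤ}) v)) ]′
            (Equivalence.to (T-∨ {inverted c a r -1ℤ}) u))

      -- Gauss reduction: make |2 B + t| ≤ A by a shift, then exchange A and C if C < A.
      reduce : ∀ a → 0 ℕ.< a → ∀ B C → + a * C ≡ normω c B → SpanOf L (+ a) B → Classified
      reduce = <-rec _ step
        where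
        step : ∀ a → (∀ {a′} → a′ ℕ.< a → 0 ℕ.< a′ → ∀ B C → + a′ * C ≡ normω c B → SpanOf L (+ a′) B → Classified) →
          0 ℕ.< a → ∀ B C → + a * C ≡ normω c B → SpanOf L (+ a) B → Classified
        step a rec 0<a B C AC span = rounded (round a t₀ B)
          where
          instance _ = ℕ.>-nonZero 0<a
          e₁ : ∀ r a κ → r + a * κ + - κ * a ≡ r
          e₁ = solve-∀
          rounded : (∃₂ λ r κ → B ≡ r + + a * κ × 0ℤ ≤ + a - (+ 2 * r + t₀) × 0ℤ ≤ + a + (+ 2 * r + t₀) - 1ℤ) → Classified
          rounded (r , κ , eB , hi , lo) = compare (cofactor-positive a r C′ AC′)
            where
            C′ = C + + 2 * - κ * B + t₀ * - κ + - κ * - κ * + a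
            B′≡ : B + - κ * + a ≡ r
            B′≡ = trans (cong (_+ - κ * + a) eB) (e₁ r (+ a) κ)
            AC′ : + a * C′ ≡ normω c r
            AC′ = trans (normω-shift (+ a) B (- κ) C AC) (cong (normω c) B′≡)
            span′ : SpanOf L (+ a) r
            span′ = subst (SpanOf L (+ a)) B′≡ (shift (- κ) span)
            e₂ : ∀ t n B A C → A * C ≡ B * B + t * B + n → C * A ≡ (- B - t) * (- B - t) + t * (- B - t) + n
            e₂ t n B A C eq = trans (ℤ.*-comm C A) (trans eq (e₃ t n B))
              where
              e₃ : ∀ t n B → B * B + t * B + n ≡ (- B - t) * (- B - t) + t * (- B - t) + n
              e₃ = solve-∀
            compare : (∃ λ m → C′ ≡ + suc m) → Classified
            compare (m , eC) = [ smaller , larger ]′ (ℕ.≤-<-connex a (suc m))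
              where
              AC″ : + a * + suc m ≡ normω c r
              AC″ = trans (cong (+ a *_) (sym eC)) AC′
              smaller : a ℕ.≤ suc m → Classified
              smaller a≤C = from-two-classes a r (reduced⇒two-classes c a (suc m ℕ.∸ a) r
                (trans (cong (λ z → + a * + z) (ℕ.m+[n∸m]≡n a≤C)) AC″) hi lo) span′
              larger : suc m ℕ.< a → Classified
              larger C<a = rec C<a (s≤s z≤n) (- r - t₀) (+ a) (e₂ t₀ n₀ r (+ a) (+ suc m) AC″) (invert (λ ()) AC″ span′)

    classify : ∀ L → Classified {L}
    classify L = go (isSpan L)
      where
      go : IsSpan L → Classified {L}
      go s = signed A refl
        where
        open IsSpan s
        span : SpanOf L A B
        span = record { γ = γ ; γ≢0 = γ≢0 ; ⊆span = ⊆span ; span⊆ = span⊆ }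
        signed : ∀ A′ → A ≡ A′ → Classified {L}
        signed (+ zero) e = contradiction e A≢0
        signed (+ suc a) e = reduce (suc a) (s≤s z≤n) B C (trans (cong (_* C) (sym e)) AC≡) (subst (λ A → SpanOf L A B) e span)
        signed -[1+ a ] e = reduce (suc a) (s≤s z≤n) B (- C) (trans (sym (ℤ.neg-distribʳ-* (+ suc a) C))
            (trans (ℤ.neg-distribˡ-* (+ suc a) C) (trans (cong (_* C) (sym e)) AC≡)))
          (subst (λ A → SpanOf L A B) (cong -_ e) (negate span))

-- Representations of both standard lattices, and the theorem

module Representations where
  open import Data.Integer as ℤ using (ℤ; +_; -[1+_]; 0ℤ; 1ℤ)
  import Data.Integer.Properties as ℤ
  import Data.Integer.Tactic.RingSolver as ℤ-ring
  open import Data.Rational using (ℚ; 0ℚ; 1ℚ; _/_; _+_; _*_)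
  import Data.Rational.Properties as ℚ
  open import Data.Product.Properties using (≡-dec)
  open import Data.Unit using (tt)
  open import Data.Vec as Vec using (Vec; []; _∷_; zipWith; map)
  import Data.Vec.Properties as Vec
  open import Data.Vec.Relation.Unary.All using (All; []; _∷_)
  open import Function.Bundles using (mk⇔)
  open Integers
  open Rationals
  open FormSums using (SumOf; total)
  open CaseForms
  open LowerBound using (critical; critical-needs-gOf; principal≥0; principal≡0)
  open QuadraticField using (module Order)
  open Lattices using (module Lattice)
  open Spans using (module Span)
  open Reduction using (module Reduce)

  norm-β : ∀ c → + kOf c ℤ.* cofactor c ≡ βa c ℤ.* βa c ℤ.+ tℤ c ℤ.* βa c ℤ.+ nℤ c
  norm-β c5 = refl
  norm-β c6 = refl
  norm-β c10 = refl
  norm-β c13 = refl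
  norm-β c15 = refl
  norm-β c22 = refl
  norm-β c35 = refl
  norm-β c37 = refl
  norm-β c51 = refl
  norm-β c58 = refl
  norm-β c91 = refl
  norm-β c115 = refl
  norm-β c123 = refl
  norm-β c187 = refl
  norm-β c235 = refl
  norm-β c267 = refl
  norm-β c403 = refl
  norm-β c427 = refl

  module Hermitian (c : Case) where
    open Field (dOf c)
    open Order c
    open Lattice c
    open Span c
    open Reduce c

    private
      t₀ = tℤ c
      n₀ = nℤ c
      k = + kOf c
      a₀ = βa c

    h-scale : ∀ L γ y z → h L (γ ⊗ y) (γ ⊗ z) ≡ (q L * norm γ , 0ℚ) ⊗ (y ⊗ conj z)
    h-scale L γ y z = trans (cong ((q L , 0ℚ) ⊗_) (trans (cong ((γ ⊗ y) ⊗_) (conj-⊗ γ z))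
        (trans (⊗-interchange γ y (conj γ) (conj z)) (cong (_⊗ (y ⊗ conj z)) (⊗-conj γ)))))
      (trans (sym (⊗-assoc (q L , 0ℚ) (norm γ , 0ℚ) (y ⊗ conj z))) (cong (_⊗ (y ⊗ conj z)) (scalar-⊗ (q L) (norm γ))))

    norm-1 : norm 1E ≡ 1ℚ
    norm-1 = trans (norm-el 1ℤ 0ℤ) (cong ι (e t₀ n₀))
      where
      e : ∀ t n → 1ℤ ℤ.* (1ℤ ℤ.* 1ℤ) ℤ.+ t ℤ.* (1ℤ ℤ.* 0ℤ) ℤ.+ n ℤ.* (0ℤ ℤ.* 0ℤ) ≡ 1ℤ
      e = ℤ-ring.solve-∀

    -- Multiplication by γ′ / γ carries one span onto the other, and the hypothesis says that it
    -- respects the scaling of the forms.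
    span⇒isometric : ∀ {L K A B} (s : SpanOf L A B) (s′ : SpanOf K A B) →
      q K * norm (SpanOf.γ s′) ≡ q L * norm (SpanOf.γ s) → Isometric L K
    span⇒isometric {L} {K} {A} {B} s s′ eq = go (inverse γ γ≢0)
      where
      open SpanOf s
      open SpanOf s′ using () renaming (γ to γ′; γ≢0 to γ′≢0; ⊆span to ⊆span′; span⊆ to span⊆′)
      go : (∃ λ δ → δ ⊗ γ ≡ 1E) → Isometric L K
      go (δ , inv) = record
        { f = λ x _ → μ ⊗ x
        ; into = λ x p → let u , v , e = ⊆span p in subst (_∈L K) (sym (image x u v e)) (span⊆′ u v)
        ; additive = λ x y _ _ _ → ⊗-distribˡ-⊕ μ x y
        ; homog = λ s x _ _ _ → ⊗-swap μ s x
        ; injective = λ x y _ _ e → ⊗-cancelˡ μ μ≢0 e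
        ; surjective = λ y p → let u , v , e = ⊆span′ p in γ ⊗ el (u ℤ.* A ℤ.+ v ℤ.* B) v , span⊆ u v ,
            trans (image (γ ⊗ el (u ℤ.* A ℤ.+ v ℤ.* B) v) u v refl) (sym e)
        ; isometric = λ x y _ _ → trans (h-scale K μ x y) (cong (λ q → (q , 0ℚ) ⊗ (x ⊗ conj y)) scaling)
        }
        where
        μ = γ′ ⊗ δ
        μγ : μ ⊗ γ ≡ γ′
        μγ = trans (⊗-assoc γ′ δ γ) (trans (cong (γ′ ⊗_) inv) (⊗-identityʳ γ′))
        μ≢0 : μ ≢ 0E
        μ≢0 e = γ′≢0 (trans (sym μγ) (trans (cong (_⊗ γ) e) (⊗-zeroˡ γ)))
        image : ∀ x u v → x ≡ γ ⊗ el (u ℤ.* A ℤ.+ v ℤ.* B) v → μ ⊗ x ≡ γ′ ⊗ el (u ℤ.* A ℤ.+ v ℤ.* B) v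
        image x u v e = trans (cong (μ ⊗_) e) (trans (sym (⊗-assoc μ γ (el (u ℤ.* A ℤ.+ v ℤ.* B) v))) (cong (_⊗ el (u ℤ.* A ℤ.+ v ℤ.* B) v) μγ))
        scaling : q K * norm μ ≡ q L
        scaling = *-cancel (norm γ) (norm-nonzero γ≢0) (trans (ℚ.*-comm (norm γ) (q K * norm μ)) (trans (ℚ.*-assoc (q K) (norm μ) (norm γ))
          (trans (cong (q K *_) (trans (sym (norm-⊗ μ γ)) (cong norm μγ))) (trans eq (ℚ.*-comm (q L) (norm γ))))))

    span-L1 : ∀ r → SpanOf (L1 r) 1ℤ 0ℤ
    span-L1 r = record
      { γ = 1E ; γ≢0 = 1E≢0E
      ; ⊆span = λ { (x ∷ [] , o ∷ [] , e) → let u , v , ex = el-inO o in u , v ,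
          trans e (trans (⊕-identityʳ (x ⊗ 1E)) (trans (⊗-identityʳ x) (trans ex
            (trans (cong (λ z → el z v) (e₁ u v)) (sym (⊗-identityˡ (el (u ℤ.* 1ℤ ℤ.+ v ℤ.* 0ℤ) v))))))) }
      ; span⊆ = λ u v → el (u ℤ.* 1ℤ ℤ.+ v ℤ.* 0ℤ) v ∷ [] , inO-el (u ℤ.* 1ℤ ℤ.+ v ℤ.* 0ℤ) v ∷ [] ,
          trans (⊗-comm 1E (el (u ℤ.* 1ℤ ℤ.+ v ℤ.* 0ℤ) v)) (sym (⊕-identityʳ (el (u ℤ.* 1ℤ ℤ.+ v ℤ.* 0ℤ) v ⊗ 1E)))
      }
      where
      e₁ : ∀ u v → u ≡ u ℤ.* 1ℤ ℤ.+ v ℤ.* 0ℤ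
      e₁ = ℤ-ring.solve-∀

    -- ω k = k β - a₀ k and ω β = (a₀ + t) β - N(β), where k divides N(β); so ℤ k + ℤ β is already
    -- closed under O.
    span-L2 : ∀ r → SpanOf (L2of c r) k a₀
    span-L2 r = record
      { γ = 1E ; γ≢0 = 1E≢0E
      ; ⊆span = λ { (x ∷ y ∷ [] , o ∷ o′ ∷ [] , e) → ⊆ x y (el-inO o) (el-inO o′) e }
      ; span⊆ = λ u v → el u 0ℤ ∷ el v 0ℤ ∷ [] , inO-el u 0ℤ ∷ inO-el v 0ℤ ∷ [] ,
          trans (⊗-identityˡ (el (u ℤ.* k ℤ.+ v ℤ.* a₀) v)) (sym (trans (cong (el u 0ℤ ⊗ el k 0ℤ ⊕_) (⊕-identityʳ (el v 0ℤ ⊗ el a₀ 1ℤ)))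
            (trans (cong₂ _⊕_ (el-scalar u k 0ℤ) (el-scalar v a₀ 1ℤ)) (trans (sym (el-⊕ (u ℤ.* k) (u ℤ.* 0ℤ) (v ℤ.* a₀) (v ℤ.* 1ℤ)))
              (cong (el (u ℤ.* k ℤ.+ v ℤ.* a₀)) (e₁ u v))))))
      }
      where
      e₁ : ∀ u v → u ℤ.* 0ℤ ℤ.+ v ℤ.* 1ℤ ≡ v
      e₁ = ℤ-ring.solve-∀
      ⊆ : ∀ {z} x y → (∃₂ λ i j → x ≡ el i j) → (∃₂ λ i j → y ≡ el i j) → z ≡ x ⊗ el k 0ℤ ⊕ (y ⊗ el a₀ 1ℤ ⊕ 0E) → InSpan 1E k a₀ z
      ⊆ {z} x y (i , j , ex) (i′ , j′ , ey) e = u , v ,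
          trans e (trans (cong₂ _⊕_ (trans (cong (_⊗ el k 0ℤ) ex) (el-⊗ i j k 0ℤ))
              (trans (⊕-identityʳ (y ⊗ el a₀ 1ℤ)) (trans (cong (_⊗ el a₀ 1ℤ) ey) (el-⊗ i′ j′ a₀ 1ℤ))))
            (trans (sym (el-⊕ (i ℤ.* k ℤ.- n₀ ℤ.* (j ℤ.* 0ℤ)) (i ℤ.* 0ℤ ℤ.+ j ℤ.* k ℤ.+ t₀ ℤ.* (j ℤ.* 0ℤ)) (i′ ℤ.* a₀ ℤ.- n₀ ℤ.* (j′ ℤ.* 1ℤ)) (i′ ℤ.* 1ℤ ℤ.+ j′ ℤ.* a₀ ℤ.+ t₀ ℤ.* (j′ ℤ.* 1ℤ))))
              (trans (cong₂ el first (e₂ t₀ k a₀ i j i′ j′)) (sym (⊗-identityˡ (el (u ℤ.* k ℤ.+ v ℤ.* a₀) v))))))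
        where
        u = i ℤ.- j ℤ.* a₀ ℤ.- j′ ℤ.* cofactor c
        v = j ℤ.* k ℤ.+ i′ ℤ.+ j′ ℤ.* a₀ ℤ.+ t₀ ℤ.* j′
        e₂ : ∀ t k a i j i′ j′ → i ℤ.* 0ℤ ℤ.+ j ℤ.* k ℤ.+ t ℤ.* (j ℤ.* 0ℤ) ℤ.+ (i′ ℤ.* 1ℤ ℤ.+ j′ ℤ.* a ℤ.+ t ℤ.* (j′ ℤ.* 1ℤ)) ≡ j ℤ.* k ℤ.+ i′ ℤ.+ j′ ℤ.* a ℤ.+ t ℤ.* j′
        e₂ = ℤ-ring.solve-∀
        e₃ : ∀ t n k a i j i′ j′ → i ℤ.* k ℤ.- n ℤ.* (j ℤ.* 0ℤ) ℤ.+ (i′ ℤ.* a ℤ.- n ℤ.* (j′ ℤ.* 1ℤ)) ≡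
          (i ℤ.- j ℤ.* a) ℤ.* k ℤ.- j′ ℤ.* (a ℤ.* a ℤ.+ t ℤ.* a ℤ.+ n) ℤ.+ (j ℤ.* k ℤ.+ i′ ℤ.+ j′ ℤ.* a ℤ.+ t ℤ.* j′) ℤ.* a
        e₃ = ℤ-ring.solve-∀
        e₄ : ∀ k a i j j′ m w → (i ℤ.- j ℤ.* a) ℤ.* k ℤ.- j′ ℤ.* (k ℤ.* m) ℤ.+ w ≡ (i ℤ.- j ℤ.* a ℤ.- j′ ℤ.* m) ℤ.* k ℤ.+ w
        e₄ = ℤ-ring.solve-∀
        first : i ℤ.* k ℤ.- n₀ ℤ.* (j ℤ.* 0ℤ) ℤ.+ (i′ ℤ.* a₀ ℤ.- n₀ ℤ.* (j′ ℤ.* 1ℤ)) ≡ u ℤ.* k ℤ.+ v ℤ.* a₀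
        first = trans (e₃ t₀ n₀ k a₀ i j i′ j′) (trans (cong (λ z → (i ℤ.- j ℤ.* a₀) ℤ.* k ℤ.- j′ ℤ.* z ℤ.+ v ℤ.* a₀) (sym (norm-β c)))
          (e₄ k a₀ i j j′ (cofactor c) (v ℤ.* a₀)))

    _≟E_ : (x y : E) → Dec (x ≡ y)
    _≟E_ = ≡-dec ℚ._≟_ ℚ._≟_

    sum-norms : ∀ {m} → Vec E m → ℚ
    sum-norms [] = 0ℚ
    sum-norms (w ∷ ws) = norm w + sum-norms ws

    hI-map : ∀ {m} x y (ws : Vec E m) → hI (map (x ⊗_) ws) (map (y ⊗_) ws) ≡ (sum-norms ws , 0ℚ) ⊗ (x ⊗ conj y)
    hI-map x y [] = sym (⊗-zeroˡ (x ⊗ conj y))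
    hI-map x y (w ∷ ws) = trans (cong₂ _⊕_ one (hI-map x y ws)) (trans (sym (⊗-distribʳ-⊕ (x ⊗ conj y) (norm w , 0ℚ) (sum-norms ws , 0ℚ)))
        (cong (_⊗ (x ⊗ conj y)) (cong (norm w + sum-norms ws ,_) (ℚ.+-identityʳ 0ℚ))))
      where
      one : (x ⊗ w) ⊗ conj (y ⊗ w) ≡ (norm w , 0ℚ) ⊗ (x ⊗ conj y)
      one = trans (cong ((x ⊗ w) ⊗_) (conj-⊗ y w)) (trans (⊗-interchange x w (conj y) (conj w))
        (trans (cong ((x ⊗ conj y) ⊗_) (⊗-conj w)) (⊗-comm (x ⊗ conj y) (norm w , 0ℚ))))

    map-injective : ∀ {m} x y (ws : Vec E m) → sum-norms ws ≢ 0ℚ → map (x ⊗_) ws ≡ map (y ⊗_) ws → x ≡ y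
    map-injective x y [] ne _ = contradiction refl ne
    map-injective x y (w ∷ ws) ne e = go (w ≟E 0E)
      where
      norm-0 : w ≡ 0E → norm w ≡ 0ℚ
      norm-0 w≡0 = cong proj₁ (trans (sym (⊗-conj w)) (trans (cong (_⊗ conj w) w≡0) (⊗-zeroˡ (conj w))))
      go : Dec (w ≡ 0E) → x ≡ y
      go (yes w≡0) = map-injective x y ws (λ s → ne (trans (cong₂ _+_ (norm-0 w≡0) s) (ℚ.+-identityʳ 0ℚ))) (cong Vec.tail e)
      go (no w≢0) = ⊗-cancelˡ w w≢0 (trans (⊗-comm w x) (trans (cong Vec.head e) (⊗-comm y w)))

    -- The map x ↦ (x w₁ , ... , x w_m) multiplies x ȳ by the sum of the norms of the wᵢ, so that
    -- preserving the form is one equation for this sum.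
    represents : ∀ K {m} (ws : Vec E m) → (∀ {x} → x ∈L K → All inO (map (x ⊗_) ws)) → sum-norms ws ≡ q K → q K ≢ 0ℚ → Represents K m
    represents K ws integral eq q≢0 = record
      { f = λ x _ → map (x ⊗_) ws
      ; into = λ x p → integral p
      ; additive = λ x y _ _ _ → additive x y ws
      ; homog = λ s x _ _ _ → homogeneous s x ws
      ; injective = λ x y _ _ e → map-injective x y ws (λ z → q≢0 (trans (sym eq) z)) e
      ; isometric = λ x y _ _ → trans (hI-map x y ws) (cong (λ q → (q , 0ℚ) ⊗ (x ⊗ conj y)) eq)
      }
      where
      additive : ∀ {m} x y (ws : Vec E m) → map ((x ⊕ y) ⊗_) ws ≡ zipWith _⊕_ (map (x ⊗_) ws) (map (y ⊗_) ws)
      additive x y [] = refl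
      additive x y (w ∷ ws) = cong₂ _∷_ (⊗-distribʳ-⊕ w x y) (additive x y ws)
      homogeneous : ∀ {m} s x (ws : Vec E m) → map ((s ⊗ x) ⊗_) ws ≡ map (s ⊗_) (map (x ⊗_) ws)
      homogeneous s x [] = refl
      homogeneous s x (w ∷ ws) = cong₂ _∷_ (⊗-assoc s x w) (homogeneous s x ws)

    map-identity : ∀ {m} (ws : Vec E m) → map (1E ⊗_) ws ≡ ws
    map-identity [] = refl
    map-identity (w ∷ ws) = cong₂ _∷_ (⊗-identityˡ w) (map-identity ws)

    module _ {L : UnaryLattice} {m : ℕ} (R : Represents L m) where
      private
        module R = Represents R

      -- homogeneity for the scalar 1 makes the image independent of the membership proof
      irrelevant : ∀ {x y} (p : x ∈L L) (p′ : y ∈L L) → x ≡ y → R.f x p ≡ R.f y p′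
      irrelevant {x} p p′ refl = trans (sym (map-identity (R.f x p))) (trans (sym (R.homog 1E x inO-1 p p″)) (trans (R.homog 1E x inO-1 p′ p″) (map-identity (R.f x p′))))
        where
        p″ : (1E ⊗ x) ∈L L
        p″ = subst (_∈L L) (sym (⊗-identityˡ x)) p

    transport : ∀ {L K m} → Isometric L K → Represents K m → Represents L m
    transport {L} {K} I R = record
      { f = λ x p → R.f (I.f x p) (I.into x p)
      ; into = λ x p → R.into (I.f x p) (I.into x p)
      ; additive = λ x y p p′ p″ → trans (irrelevant R (I.into (x ⊕ y) p″) (∈L-⊕ K (I.into x p) (I.into y p′)) (I.additive x y p p′ p″))
          (R.additive (I.f x p) (I.f y p′) (I.into x p) (I.into y p′) (∈L-⊕ K (I.into x p) (I.into y p′)))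
      ; homog = λ s x o p p′ → trans (irrelevant R (I.into (s ⊗ x) p′) (∈L-⊗ K o (I.into x p)) (I.homog s x o p p′))
          (R.homog s (I.f x p) o (I.into x p) (∈L-⊗ K o (I.into x p)))
      ; injective = λ x y p p′ e → I.injective x y p p′ (R.injective (I.f x p) (I.f y p′) (I.into x p) (I.into y p′) e)
      ; isometric = λ x y p p′ → trans (R.isometric (I.f x p) (I.f y p′) (I.into x p) (I.into y p′)) (I.isometric x y p p′)
      }
      where
      module I = Isometric I
      module R = Represents R

    q≢0 : ∀ {r} k .{{_ : ℕ.NonZero k}} → 1 ℕ.≤ r → + r / k ≢ 0ℚ
    q≢0 {r} k 1≤r e = ι≢0 {+ r} (λ e′ → ℕ.>⇒≢ 1≤r (ℤ.+-injective e′)) (trans (sym (ι-/ (+ r) k)) (trans (cong (ι (+ k) *_) e) (ℚ.*-zeroʳ (ι (+ k)))))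

    principal-vectors : ∀ {m} → Vec (ℤ × ℤ) m → Vec E m
    principal-vectors = map (λ (x , y) → el x y)

    sum-principal : ∀ {m} (v : Vec (ℤ × ℤ) m) → sum-norms (principal-vectors v) ≡ ι (total (principal c) v)
    sum-principal [] = refl
    sum-principal ((x , y) ∷ v) = trans (cong₂ _+_ (norm-el x y) (sum-principal v)) (sym (ι-+ (principal c x y) (total (principal c) v)))

    integral-L1 : ∀ r {x} → x ∈L L1 r → ∃₂ λ a b → x ≡ el a b
    integral-L1 r p = let u , v , e = SpanOf.⊆span (span-L1 r) p in
      u ℤ.* 1ℤ ℤ.+ v ℤ.* 0ℤ , v , trans e (⊗-identityˡ (el (u ℤ.* 1ℤ ℤ.+ v ℤ.* 0ℤ) v))

    represents-L1 : ∀ {m} r → 1 ℕ.≤ r → SumOf (principal c) m (+ r) → Represents (L1 r) m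
    represents-L1 r 1≤r (v , eq) = represents (L1 r) (principal-vectors v) integral (trans (sum-principal v) (cong ι eq)) (q≢0 1 1≤r)
      where
      go : ∀ {m} x → inO x → (v : Vec (ℤ × ℤ) m) → All inO (map (x ⊗_) (principal-vectors v))
      go x o [] = []
      go x o ((a , b) ∷ v) = inO-⊗ x (el a b) o (inO-el a b) ∷ go x o v
      integral : ∀ {x} → x ∈L L1 r → All inO (map (x ⊗_) (principal-vectors v))
      integral {x} p = let a , b , e = integral-L1 r p in go x (subst inO (sym e) (inO-el a b)) v

    k≢0 : k ≢ 0ℤ
    k≢0 ()

    -- k x + y β̄, an element of the conjugate of the ideal k O + β O
    conjugate-element : ℤ → ℤ → E
    conjugate-element x y = el (k ℤ.* x ℤ.+ (a₀ ℤ.+ t₀) ℤ.* y) (ℤ.- y)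

    norm-conjugate-element : ∀ x y → norm (conjugate-element x y) ≡ ι (k ℤ.* other c x y)
    norm-conjugate-element x y = trans (norm-el (k ℤ.* x ℤ.+ (a₀ ℤ.+ t₀) ℤ.* y) (ℤ.- y)) (cong ι
        (trans (e₁ t₀ n₀ k a₀ x y) (trans (cong (λ z → k ℤ.* (k ℤ.* (x ℤ.* x) ℤ.+ (+ 2 ℤ.* a₀ ℤ.+ t₀) ℤ.* (x ℤ.* y)) ℤ.+ z ℤ.* (y ℤ.* y)) (sym (norm-β c)))
          (e₂ k (+ 2 ℤ.* a₀ ℤ.+ t₀) (cofactor c) x y))))
      where
      e₁ : ∀ t n k a x y → let X = k ℤ.* x ℤ.+ (a ℤ.+ t) ℤ.* y in
        1ℤ ℤ.* (X ℤ.* X) ℤ.+ t ℤ.* (X ℤ.* ℤ.- y) ℤ.+ n ℤ.* (ℤ.- y ℤ.* ℤ.- y) ≡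
        k ℤ.* (k ℤ.* (x ℤ.* x) ℤ.+ (+ 2 ℤ.* a ℤ.+ t) ℤ.* (x ℤ.* y)) ℤ.+ (a ℤ.* a ℤ.+ t ℤ.* a ℤ.+ n) ℤ.* (y ℤ.* y)
      e₁ = ℤ-ring.solve-∀
      e₂ : ∀ k b m x y → k ℤ.* (k ℤ.* (x ℤ.* x) ℤ.+ b ℤ.* (x ℤ.* y)) ℤ.+ k ℤ.* m ℤ.* (y ℤ.* y) ≡ k ℤ.* (k ℤ.* (x ℤ.* x) ℤ.+ b ℤ.* (x ℤ.* y) ℤ.+ m ℤ.* (y ℤ.* y))
      e₂ = ℤ-ring.solve-∀

    norm-scalar : ∀ a → norm (el a 0ℤ) ≡ ι (a ℤ.* a)
    norm-scalar a = trans (norm-el a 0ℤ) (cong ι (e t₀ n₀ a))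
      where
      e : ∀ t n a → 1ℤ ℤ.* (a ℤ.* a) ℤ.+ t ℤ.* (a ℤ.* 0ℤ) ℤ.+ n ℤ.* (0ℤ ℤ.* 0ℤ) ≡ a ℤ.* a
      e = ℤ-ring.solve-∀

    module Divided (δ : E) (inv : δ ⊗ el k 0ℤ ≡ 1E) where
      vectors : ∀ {m} → Vec (ℤ × ℤ) m → Vec E m
      vectors = map (λ (x , y) → δ ⊗ conjugate-element x y)

      norm-vector : ∀ x y → ι k * norm (δ ⊗ conjugate-element x y) ≡ ι (other c x y)
      norm-vector x y = *-cancel (ι k) (ι≢0 k≢0) (trans (sym (ℚ.*-assoc (ι k) (ι k) (norm w)))
          (trans (cong (_* norm w) (trans (sym (ι-* k k)) (sym (norm-scalar k)))) (trans (sym (norm-⊗ (el k 0ℤ) w))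
            (trans (cong norm kw) (trans (norm-conjugate-element x y) (ι-* k (other c x y)))))))
        where
        w = δ ⊗ conjugate-element x y
        kw : el k 0ℤ ⊗ w ≡ conjugate-element x y
        kw = cancel-inverse δ (el k 0ℤ) (conjugate-element x y) (trans (⊗-comm (el k 0ℤ) δ) inv)

      sum-vectors : ∀ {m} (v : Vec (ℤ × ℤ) m) → ι k * sum-norms (vectors v) ≡ ι (total (other c) v)
      sum-vectors [] = ℚ.*-zeroʳ (ι k)
      sum-vectors ((x , y) ∷ v) = trans (ℚ.*-distribˡ-+ (ι k) (norm (δ ⊗ conjugate-element x y)) (sum-norms (vectors v)))
        (trans (cong₂ _+_ (norm-vector x y) (sum-vectors v)) (sym (ι-+ (other c x y) (total (other c) v))))

      -- (u k + v β) (k x + y β̄) is divisible by k because β β̄ = k `cofactor c`; this is the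
      -- inclusion of 𝔘₂ 𝔘̄₂ in k O.
      integral-vector : ∀ u v x y → inO (el (u ℤ.* k ℤ.+ v ℤ.* a₀) v ⊗ (δ ⊗ conjugate-element x y))
      integral-vector u v x y = subst inO (sym (trans (⊗-swap (el (u ℤ.* k ℤ.+ v ℤ.* a₀) v) δ (conjugate-element x y))
          (trans (cong (δ ⊗_) (trans (el-⊗ (u ℤ.* k ℤ.+ v ℤ.* a₀) v (k ℤ.* x ℤ.+ (a₀ ℤ.+ t₀) ℤ.* y) (ℤ.- y)) (trans (cong₂ el first (e₃ t₀ k a₀ u v x y)) (sym (el-scalar k X Y)))))
            (cancel-inverse (el k 0ℤ) δ (el X Y) inv)))) (inO-el X Y)
        where
        X = u ℤ.* (k ℤ.* x ℤ.+ (a₀ ℤ.+ t₀) ℤ.* y) ℤ.+ v ℤ.* a₀ ℤ.* x ℤ.+ v ℤ.* cofactor c ℤ.* y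
        Y = ℤ.- u ℤ.* y ℤ.+ v ℤ.* x
        e₁ : ∀ t n k a u v x y → (u ℤ.* k ℤ.+ v ℤ.* a) ℤ.* (k ℤ.* x ℤ.+ (a ℤ.+ t) ℤ.* y) ℤ.- n ℤ.* (v ℤ.* ℤ.- y) ≡
          k ℤ.* (u ℤ.* (k ℤ.* x ℤ.+ (a ℤ.+ t) ℤ.* y) ℤ.+ v ℤ.* a ℤ.* x) ℤ.+ (a ℤ.* a ℤ.+ t ℤ.* a ℤ.+ n) ℤ.* (v ℤ.* y)
        e₁ = ℤ-ring.solve-∀
        e₂ : ∀ k m v y w → k ℤ.* w ℤ.+ k ℤ.* m ℤ.* (v ℤ.* y) ≡ k ℤ.* (w ℤ.+ v ℤ.* m ℤ.* y)
        e₂ = ℤ-ring.solve-∀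
        first : (u ℤ.* k ℤ.+ v ℤ.* a₀) ℤ.* (k ℤ.* x ℤ.+ (a₀ ℤ.+ t₀) ℤ.* y) ℤ.- n₀ ℤ.* (v ℤ.* ℤ.- y) ≡ k ℤ.* X
        first = trans (e₁ t₀ n₀ k a₀ u v x y) (trans (cong (λ z → k ℤ.* (u ℤ.* (k ℤ.* x ℤ.+ (a₀ ℤ.+ t₀) ℤ.* y) ℤ.+ v ℤ.* a₀ ℤ.* x) ℤ.+ z ℤ.* (v ℤ.* y)) (sym (norm-β c)))
          (e₂ k (cofactor c) v y (u ℤ.* (k ℤ.* x ℤ.+ (a₀ ℤ.+ t₀) ℤ.* y) ℤ.+ v ℤ.* a₀ ℤ.* x)))
        e₃ : ∀ t k a u v x y → (u ℤ.* k ℤ.+ v ℤ.* a) ℤ.* ℤ.- y ℤ.+ v ℤ.* (k ℤ.* x ℤ.+ (a ℤ.+ t) ℤ.* y) ℤ.+ t ℤ.* (v ℤ.* ℤ.- y) ≡ k ℤ.* (ℤ.- u ℤ.* y ℤ.+ v ℤ.* x)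
        e₃ = ℤ-ring.solve-∀

    represents-L2 : ∀ {m} r → 1 ℕ.≤ r → SumOf (other c) m (+ r) → Represents (L2of c r) m
    represents-L2 {m} r 1≤r (v , eq) = go (inverse (el k 0ℤ) (el-nonzero k≢0))
      where
      go : (∃ λ δ → δ ⊗ el k 0ℤ ≡ 1E) → Represents (L2of c r) m
      go (δ , inv) = represents (L2of c r) (D.vectors v) integral
          (*-cancel (ι k) (ι≢0 k≢0) (trans (D.sum-vectors v) (trans (cong ι eq) (sym (ι-/ (+ r) (kOf c)))))) (q≢0 (kOf c) 1≤r)
        where
        module D = Divided δ inv
        all : ∀ {m} x u w → x ≡ el (u ℤ.* k ℤ.+ w ℤ.* a₀) w → (v : Vec (ℤ × ℤ) m) → All inO (map (x ⊗_) (D.vectors v))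
        all x u w e [] = []
        all x u w e ((a , b) ∷ v) = subst (λ x → inO (x ⊗ (δ ⊗ conjugate-element a b))) (sym e) (D.integral-vector u w a b) ∷ all x u w e v
        integral : ∀ {x} → x ∈L L2of c r → All inO (map (x ⊗_) (D.vectors v))
        integral {x} p = let u , w , e = SpanOf.⊆span (span-L2 r) p in all x u w (trans e (⊗-identityˡ (el (u ℤ.* k ℤ.+ w ℤ.* a₀) w))) v

    -- The image of 1 has m integral coordinates, whose norms add up to h(1 , 1) = r.
    sum-of-principal : ∀ r {m} → Represents (L1 r) m → SumOf (principal c) m (+ r)
    sum-of-principal r {m} R = go (R.f 1E one∈) (R.into 1E one∈) (R.isometric 1E 1E one∈ one∈)
      where
      module R = Represents R
      one∈ : 1E ∈L L1 r
      one∈ = 1E ∷ [] , inO-1 ∷ [] , sym (trans (⊕-identityʳ (1E ⊗ 1E)) (⊗-identityˡ 1E))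
      coordinates : ∀ {m} (ws : Vec E m) → All inO ws → ∃ λ (v : Vec (ℤ × ℤ) m) → hI ws ws ≡ (ι (total (principal c) v) , 0ℚ)
      coordinates [] [] = [] , refl
      coordinates (w ∷ ws) (o ∷ os) = let x , y , e = el-inO o ; v , ev = coordinates ws os in
        (x , y) ∷ v , trans (cong₂ _⊕_ (trans (⊗-conj w) (cong (_, 0ℚ) (trans (cong norm e) (norm-el x y)))) ev)
          (cong₂ _,_ (sym (ι-+ (principal c x y) (total (principal c) v))) (ℚ.+-identityʳ 0ℚ))
      h-one : h (L1 r) 1E 1E ≡ (ι (+ r) , 0ℚ)
      h-one = trans (cong ((ι (+ r) , 0ℚ) ⊗_) (trans (⊗-conj 1E) (cong (_, 0ℚ) norm-1))) (⊗-identityʳ (ι (+ r) , 0ℚ))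
      go : (ws : Vec E m) → All inO ws → hI ws ws ≡ h (L1 r) 1E 1E → SumOf (principal c) m (+ r)
      go ws os iso = let v , e = coordinates ws os in v , ι-injective (cong proj₁ (trans (sym e) (trans iso h-one)))

    positive-definite-L1 : ∀ r → PosDefIntegral (L1 (suc r))
    positive-definite-L1 r = (λ x p x≢0 → positive x (integral-L1 (suc r) p) x≢0) , λ x y p p′ → integral x y (integral-L1 (suc r) p) (integral-L1 (suc r) p′)
      where
      positive : ∀ x → (∃₂ λ a b → x ≡ el a b) → x ≢ 0E → ∃ λ m → h (L1 (suc r)) x x ≡ ((+ suc m) / 1 , 0ℚ)
      positive x (a , b , ex) x≢0 = go (0≤⇒+ (principal≥0 c a b))
        where
        value : h (L1 (suc r)) x x ≡ (ι (+ suc r ℤ.* principal c a b) , 0ℚ)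
        value = trans (cong ((ι (+ suc r) , 0ℚ) ⊗_) (⊗-conj x)) (trans (scalar-⊗ (ι (+ suc r)) (norm x))
          (cong (_, 0ℚ) (trans (cong (ι (+ suc r) *_) (trans (cong norm ex) (norm-el a b))) (sym (ι-* (+ suc r) (principal c a b))))))
        go : (∃ λ p → principal c a b ≡ + p) → ∃ λ m → h (L1 (suc r)) x x ≡ ((+ suc m) / 1 , 0ℚ)
        go (zero , e) = contradiction (trans ex (cong₂ el (proj₁ (principal≡0 c a b e)) (proj₂ (principal≡0 c a b e)))) x≢0
        go (suc p , e) = p ℕ.+ r ℕ.* suc p , trans value (cong (λ z → ι z , 0ℚ) (trans (cong (+ suc r ℤ.*_) e) (sym (ℤ.pos-* (suc r) (suc p)))))
      integral : ∀ x y → (∃₂ λ a b → x ≡ el a b) → (∃₂ λ a b → y ≡ el a b) → inO (h (L1 (suc r)) x y)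
      integral x y (a , b , ex) (a′ , b′ , ey) = inO-⊗ (el (+ suc r) 0ℤ) (x ⊗ conj y) (inO-el (+ suc r) 0ℤ)
        (inO-⊗ x (conj y) (subst inO (sym ex) (inO-el a b)) (subst inO (sym (trans (cong conj ey) (conj-el a′ b′))) (inO-el (a′ ℤ.+ t₀ ℤ.* b′) (ℤ.- b′))))

    1≤g : 1 ℕ.≤ gOf c
    1≤g = ℕ.≤ᵇ⇒≤ 1 (gOf c) (every-case (λ c → 1 ℕ.≤ᵇ gOf c) tt c)

    1≤lower : 1 ℕ.≤ lowerOf c
    1≤lower = ℕ.≤ᵇ⇒≤ 1 (lowerOf c) (every-case (λ c → 1 ℕ.≤ᵇ lowerOf c) tt c)

    Standard : UnaryLattice → Set
    Standard L = (∃ λ r → 1 ℕ.≤ r × Isometric L (L1 r)) ⊎ (∃ λ r → InR c r × Isometric L (L2of c r))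

    standard⇒represents : ∀ L → Standard L → Represents L (gOf c)
    standard⇒represents L (inj₁ (r , 1≤r , I)) = transport I (represents-L1 r 1≤r (principal-sum c r))
    standard⇒represents L (inj₂ (r , r∈R , I)) = transport I (represents-L2 r (ℕ.≤-trans 1≤lower (proj₁ r∈R)) (other-sum c r r∈R))

    module _ (L : UnaryLattice) (posdef : PosDefIntegral L) where

      principal-shape : SpanOf L 1ℤ 0ℤ → Standard L
      principal-shape s = go (proj₁ posdef (γ ⊗ 1E) γ∈ (λ e → γ≢0 (trans (sym (⊗-identityʳ γ)) e)))
        where
        open SpanOf s
        γ∈ : (γ ⊗ 1E) ∈L L
        γ∈ = span⊆ 1ℤ 0ℤ
        value : h L (γ ⊗ 1E) (γ ⊗ 1E) ≡ (q L * norm γ , 0ℚ)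
        value = trans (h-scale L γ 1E 1E) (trans (cong ((q L * norm γ , 0ℚ) ⊗_) (trans (⊗-conj 1E) (cong (_, 0ℚ) norm-1))) (⊗-identityʳ (q L * norm γ , 0ℚ)))
        go : (∃ λ m → h L (γ ⊗ 1E) (γ ⊗ 1E) ≡ ((+ suc m) / 1 , 0ℚ)) → Standard L
        go (m , e) = inj₁ (suc m , s≤s z≤n , span⇒isometric s (span-L1 (suc m))
          (trans (cong (ι (+ suc m) *_) norm-1) (trans (ℚ.*-identityʳ (ι (+ suc m))) (cong proj₁ (trans (sym e) value)))))

      module _ (s : SpanOf L k a₀) {m : ℕ} (R : Represents L m) where
        open SpanOf s
        private
          module R = Represents R
          Q = q L * norm γ
          e₁ = γ ⊗ el k 0ℤ
          e₂ = γ ⊗ el a₀ 1ℤ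
          β = el a₀ 1ℤ
          unit₁ : ∀ k a → 1ℤ ℤ.* k ℤ.+ 0ℤ ℤ.* a ≡ k
          unit₁ = ℤ-ring.solve-∀
          unit₂ : ∀ k a → 0ℤ ℤ.* k ℤ.+ 1ℤ ℤ.* a ≡ a
          unit₂ = ℤ-ring.solve-∀
          e₁∈ : e₁ ∈L L
          e₁∈ = subst (λ z → (γ ⊗ el z 0ℤ) ∈L L) (unit₁ k a₀) (span⊆ 1ℤ 0ℤ)
          e₂∈ : e₂ ∈L L
          e₂∈ = subst (λ z → (γ ⊗ el z 1ℤ) ∈L L) (unit₂ k a₀) (span⊆ 0ℤ 1ℤ)

        h₁₁ : h L e₁ e₁ ≡ (Q * ι (k ℤ.* k) , 0ℚ)
        h₁₁ = trans (h-scale L γ (el k 0ℤ) (el k 0ℤ)) (trans (cong ((Q , 0ℚ) ⊗_) (trans (⊗-conj (el k 0ℤ)) (cong (_, 0ℚ) (norm-scalar k)))) (scalar-⊗ Q (ι (k ℤ.* k))))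

        -- h(γ k , γ β) = Q k β̄, and β̄ has ω-coordinate - 1. Integrality of this entry is what
        -- makes Q k, the future r, an integer.
        h₁₂ : proj₂ (h L e₁ e₂) ≡ Q * ι (k ℤ.* ℤ.- 1ℤ)
        h₁₂ = cong proj₂ (trans (h-scale L γ (el k 0ℤ) β) (trans (cong ((Q , 0ℚ) ⊗_) (trans (cong (el k 0ℤ ⊗_) (conj-el a₀ 1ℤ)) (el-scalar k (a₀ ℤ.+ t₀ ℤ.* 1ℤ) (ℤ.- 1ℤ))))
          (scale Q (ι (k ℤ.* (a₀ ℤ.+ t₀ ℤ.* 1ℤ))) (ι (k ℤ.* ℤ.- 1ℤ)))))

        private
          -- Comparing ω-coordinates in β x = k y gives x₁ + (a₀ + t) x₂ = k y₂, so x = k y₂ - x₂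
          -- β̄.
          conjugate-coordinates : ∀ x y → inO x → inO y → β ⊗ x ≡ el k 0ℤ ⊗ y → ∃₂ λ X Y → x ≡ conjugate-element X Y
          conjugate-coordinates x y o o′ e = go (el-inO o) (el-inO o′)
            where
            e₃ : ∀ t a k x₁ x₂ y₂ → a ℤ.* x₂ ℤ.+ 1ℤ ℤ.* x₁ ℤ.+ t ℤ.* (1ℤ ℤ.* x₂) ≡ k ℤ.* y₂ → x₁ ≡ k ℤ.* y₂ ℤ.+ (a ℤ.+ t) ℤ.* ℤ.- x₂
            e₃ t a k x₁ x₂ y₂ eq = trans (e₄ t a x₁ x₂) (cong (ℤ._+ (a ℤ.+ t) ℤ.* ℤ.- x₂) eq)
              where
              e₄ : ∀ t a x₁ x₂ → x₁ ≡ a ℤ.* x₂ ℤ.+ 1ℤ ℤ.* x₁ ℤ.+ t ℤ.* (1ℤ ℤ.* x₂) ℤ.+ (a ℤ.+ t) ℤ.* ℤ.- x₂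
              e₄ = ℤ-ring.solve-∀
            go : (∃₂ λ a b → x ≡ el a b) → (∃₂ λ a b → y ≡ el a b) → ∃₂ λ X Y → x ≡ conjugate-element X Y
            go (x₁ , x₂ , ex) (y₁ , y₂ , ey) = y₂ , ℤ.- x₂ , trans ex (cong₂ el (e₃ t₀ a₀ k x₁ x₂ y₂ second) (sym (ℤ.neg-involutive x₂)))
              where
              second : a₀ ℤ.* x₂ ℤ.+ 1ℤ ℤ.* x₁ ℤ.+ t₀ ℤ.* (1ℤ ℤ.* x₂) ≡ k ℤ.* y₂
              second = proj₂ (el-injective {a₀ ℤ.* x₁ ℤ.- n₀ ℤ.* (1ℤ ℤ.* x₂)} {a₀ ℤ.* x₂ ℤ.+ 1ℤ ℤ.* x₁ ℤ.+ t₀ ℤ.* (1ℤ ℤ.* x₂)} {k ℤ.* y₁} {k ℤ.* y₂} (trans (sym (el-⊗ a₀ 1ℤ x₁ x₂)) (trans (trans (sym (cong (β ⊗_) ex)) (trans e (cong (el k 0ℤ ⊗_) ey))) (el-scalar k y₁ y₂))))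

          coordinates : ∀ {m} (as bs : Vec E m) → All inO as → All inO bs → map (β ⊗_) as ≡ map (el k 0ℤ ⊗_) bs →
            ∃ λ (v : Vec (ℤ × ℤ) m) → hI as as ≡ (ι (k ℤ.* total (other c) v) , 0ℚ)
          coordinates [] [] [] [] _ = [] , cong (λ z → ι z , 0ℚ) (sym (ℤ.*-zeroʳ k))
          coordinates (a ∷ as) (b ∷ bs) (o ∷ os) (o′ ∷ os′) e =
            cons (conjugate-coordinates a b o o′ (cong Vec.head e)) (coordinates as bs os os′ (cong Vec.tail e))
            where
            cons : (∃₂ λ X Y → a ≡ conjugate-element X Y) → (∃ λ (v : Vec (ℤ × ℤ) _) → hI as as ≡ (ι (k ℤ.* total (other c) v) , 0ℚ)) →
              ∃ λ (v : Vec (ℤ × ℤ) _) → hI (a ∷ as) (a ∷ as) ≡ (ι (k ℤ.* total (other c) v) , 0ℚ)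
            cons (x , y , ea) (v , ev) = (x , y) ∷ v , trans (cong₂ _⊕_ (trans (⊗-conj a) (cong (_, 0ℚ) (trans (cong norm ea) (norm-conjugate-element x y)))) ev)
              (cong₂ _,_ (trans (sym (ι-+ (k ℤ.* other c x y) (k ℤ.* total (other c) v))) (cong ι (sym (ℤ.*-distribˡ-+ k (other c x y) (total (other c) v))))) (ℚ.+-identityʳ 0ℚ))

          -- β (γ k) = k (γ β) in L, and a representation commutes with both scalars. So β maps each
          -- coordinate of the image of γ k into k O.
          images : map (β ⊗_) (R.f e₁ e₁∈) ≡ map (el k 0ℤ ⊗_) (R.f e₂ e₂∈)
          images = trans (sym (R.homog β e₁ (inO-el a₀ 1ℤ) e₁∈ (∈L-⊗ L (inO-el a₀ 1ℤ) e₁∈)))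
            (trans (irrelevant R (∈L-⊗ L (inO-el a₀ 1ℤ) e₁∈) (∈L-⊗ L (inO-el k 0ℤ) e₂∈) βe₁≡ke₂) (R.homog (el k 0ℤ) e₂ (inO-el k 0ℤ) e₂∈ (∈L-⊗ L (inO-el k 0ℤ) e₂∈)))
            where
            βe₁≡ke₂ : β ⊗ e₁ ≡ el k 0ℤ ⊗ e₂
            βe₁≡ke₂ = trans (⊗-swap β γ (el k 0ℤ)) (trans (cong (γ ⊗_) (⊗-comm β (el k 0ℤ))) (⊗-swap γ (el k 0ℤ) β))

        -- With r = Q k, the image of γ k has the norm sum Q k² = r k. On the other hand this sum is
        -- k times a sum of m values of `other c`, so r is such a sum and lies in R_d.
        other-shape : Standard L
        other-shape = go (proj₂ (proj₂ posdef e₁ e₂ e₁∈ e₂∈)) (proj₁ posdef e₁ e₁∈ (⊗-nonzero γ≢0 (el-nonzero k≢0)))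
            (coordinates (R.f e₁ e₁∈) (R.f e₂ e₂∈) (R.into e₁ e₁∈) (R.into e₂ e₂∈) images)
          where
          go : isℤ (proj₂ (h L e₁ e₂)) → (∃ λ n → h L e₁ e₁ ≡ ((+ suc n) / 1 , 0ℚ)) →
            (∃ λ v → hI (R.f e₁ e₁∈) (R.f e₁ e₁∈) ≡ (ι (k ℤ.* total (other c) v) , 0ℚ)) → Standard L
          go (z , ez) (n , en) (v , ev) = natural (ℤ.- z) refl
            where
            e₅ : ∀ k → k ≡ k ℤ.* ℤ.- 1ℤ ℤ.* ℤ.- 1ℤ
            e₅ = ℤ-ring.solve-∀
            e₆ : ∀ z → z ℤ.* ℤ.- 1ℤ ≡ ℤ.- z
            e₆ = ℤ-ring.solve-∀
            Qk : Q * ι k ≡ ι (ℤ.- z)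
            Qk = trans (cong (Q *_) (trans (cong ι (e₅ k)) (ι-* (k ℤ.* ℤ.- 1ℤ) (ℤ.- 1ℤ)))) (trans (sym (ℚ.*-assoc Q (ι (k ℤ.* ℤ.- 1ℤ)) (ι (ℤ.- 1ℤ))))
              (trans (cong (_* ι (ℤ.- 1ℤ)) (trans (sym h₁₂) ez)) (trans (sym (ι-* z (ℤ.- 1ℤ))) (cong ι (e₆ z)))))
            Qkk : Q * ι (k ℤ.* k) ≡ ι (ℤ.- z ℤ.* k)
            Qkk = trans (cong (Q *_) (ι-* k k)) (trans (sym (ℚ.*-assoc Q (ι k) (ι k))) (trans (cong (_* ι k) Qk) (sym (ι-* (ℤ.- z) k))))
            zk≡ : ℤ.- z ℤ.* k ≡ + suc n
            zk≡ = ι-injective (trans (sym Qkk) (cong proj₁ (trans (sym h₁₁) en)))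
            total≡ : total (other c) v ≡ ℤ.- z
            total≡ = ℤ.*-cancelˡ-≡ k (total (other c) v) (ℤ.- z) (trans (ι-injective (trans (cong proj₁ (trans (sym ev) (trans (R.isometric e₁ e₁ e₁∈ e₁∈) h₁₁))) Qkk)) (ℤ.*-comm (ℤ.- z) k))
            natural : ∀ r → ℤ.- z ≡ r → Standard L
            natural (+ zero) e = contradiction (trans (sym zk≡) (cong (ℤ._* k) e)) λ ()
            natural -[1+ r ] e = contradiction (trans (sym zk≡) (cong (ℤ._* k) e)) λ ()
            natural (+ suc r) e = inj₂ (suc r , other-sum⇒InR c (s≤s z≤n) (v , trans total≡ e) , span⇒isometric s (span-L2 (suc r))
              (trans (cong (+ suc r / kOf c *_) norm-1) (trans (ℚ.*-identityʳ (+ suc r / kOf c))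
                (*-cancel (ι k) (ι≢0 k≢0) (trans (ι-/ (+ suc r) (kOf c)) (trans (cong ι (sym e)) (trans (sym Qk) (ℚ.*-comm Q (ι k)))))))))

      InS⇒standard : (∃ λ m → 1 ℕ.≤ m × Represents L m) → Standard L
      InS⇒standard (m , _ , R) = [ principal-shape , (λ s → other-shape s R) ]′ (classify L)

    claim : Claim c
    claim = (λ L posdef → mk⇔ (λ (_ , reps) → InS⇒standard L posdef reps) (λ std → posdef , gOf c , 1≤g , standard⇒represents L std))
      , 1≤g , upper , lower
      where
      upper : ∀ L → InS L → Represents L (gOf c)
      upper L (posdef , reps) = standard⇒represents L (InS⇒standard L posdef reps)
      L1∈S : ∀ r → InS (L1 (suc r))
      L1∈S r = positive-definite-L1 r , gOf c , 1≤g , represents-L1 (suc r) (s≤s z≤n) (principal-sum c (suc r))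
      critical-positive : ∃ λ r → critical c ≡ suc r
      critical-positive = ℕ.pred (critical c) , sym (ℕ.suc-pred (critical c) {{ℕ.>-nonZero (ℕ.≤ᵇ⇒≤ 1 (critical c) (every-case (λ c → 1 ℕ.≤ᵇ critical c) tt c))}})
      -- The test lattice is L₁ʳ with r = `critical c`: it belongs to 𝔖_d(1), but r is not a sum of
      -- fewer than `gOf c` norms.
      lower : ∀ g′ → 1 ℕ.≤ g′ → (∀ L → InS L → Represents L g′) → gOf c ℕ.≤ g′
      lower g′ _ all = [ (λ le → le) , (λ g′<g → contradiction (needs g′<g critical-positive) λ ()) ]′ (ℕ.≤-<-connex (gOf c) g′)
        where
        open import Data.Empty using (⊥)
        needs : g′ ℕ.< gOf c → (∃ λ r → critical c ≡ suc r) → ⊥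
        needs g′<g (r , e) = critical-needs-gOf c g′<g (subst (λ n → SumOf (principal c) g′ (+ n)) (sym e) (sum-of-principal (suc r) (all (L1 (suc r)) (L1∈S r))))

theorem1 : (c : Case) → Claim c
theorem1 c = Representations.Hermitian.claim c
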